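{- Let $A=\{a_k\}_{k\in\mathbb{Z}}$ and $B=\{b_k\}_{k\in\mathbb{Z}}$ be sequences of complex numbers, each being $o(k^{c})$ as $k\to\pm\infty$ for some $c<1$. Let $k>1$ be an integer and let $\alpha,\beta$ be nonzero real numbers. Then $$\begin{aligned} &\alpha^{2k-1}\beta\pi\sum_{n=1}^\infty\frac{a_n\coth\left(\frac{n\beta\pi}{\alpha};B\right)}{n^{2k-1}}+(-1)^k\beta^{2k-1}\alpha\pi\sum_{n=1}^\infty\frac{b_n\coth\left(\frac{n\alpha\pi}{\beta};A\right)}{n^{2k-1}}\\ &=b_0\alpha^{2k}D^{(A)}(2k)+(-1)^ka_0\beta^{2k}D^{(B)}(2k)-2\sum_{\substack{j_1+j_2=k\\ j_1,j_2\ge1}}(-1)^{j_2}\alpha^{2j_1}\beta^{2j_2}D^{(A)}(2j_1)D^{(B)}(2j_2). \end{aligned}$$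
   Context: Growth conditions $a_k=o(k^c)$ are understood with $|k|^c$ for negative $k$. For a sequence $A=\{a_k\}$ (likewise $B=\{b_k\}$): $D^{(A)}(j):=\sum_{k=1}^\infty\frac{a_k}{k^j}$ for $j>1$. The cotangent function with sequence $A$ is defined by $$\pi\cot(\pi s;A):=\frac{a_0}{s}-2s\sum_{k=1}^\infty\frac{a_k}{k^2-s^2},$$ and the hyperbolic cotangent with sequence $A$ by $\coth(s;A):=i\cot(is;A)$. -}

module Defs where

open import Data.Nat as ℕ using (ℕ; zero; suc; s≤s; z≤n)
import Data.Nat.Properties as ℕP
open import Data.Integer as ℤ using (ℤ; +_; -[1+_])
import Data.Integer.Properties as ℤP
open import Data.Rational as ℚ using (ℚ; 0ℚ; 1ℚ; ½; ↥_; ↧ₙ_)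
import Data.Rational.Properties as ℚP
open import Data.Rational.Solver using (module +-*-Solver)
import Data.Rational.Unnormalised as ℚᵘ
import Data.Rational.Unnormalised.Properties as ℚᵘP
open import Data.Product using (Σ-syntax; ∃-syntax; _×_; _,_; proj₁; proj₂)
open import Data.Sum using (_⊎_; inj₁; inj₂)
open import Relation.Nullary using (yes; no; contradiction)
open import Relation.Binary.PropositionalEquality
  using (_≡_; _≢_; refl; sym; trans; cong; cong₂; subst; subst₂)

private
  ½-pos : 0ℚ ℚ.< ½
  ½-pos = ℚP.positive⁻¹ ½

  *-pos : ∀ {p q} → 0ℚ ℚ.< p → 0ℚ ℚ.< q → 0ℚ ℚ.< p ℚ.* q
  *-pos {p} {q} 0<p 0<q =
    subst (ℚ._< p ℚ.* q) (ℚP.*-zeroʳ p)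
      (ℚP.*-monoʳ-<-pos p {{ℚ.positive 0<p}} 0<q)

  half : ∀ p → ½ ℚ.* p ℚ.+ ½ ℚ.* p ≡ p
  half p = trans (sym (ℚP.*-distribʳ-+ p ½ ½)) (ℚP.*-identityˡ p)

  *-mono : ∀ {p q r s} → 0ℚ ℚ.≤ r → 0ℚ ℚ.≤ q →
           p ℚ.≤ q → r ℚ.≤ s → p ℚ.* r ℚ.≤ q ℚ.* s
  *-mono {q = q} {r = r} 0≤r 0≤q p≤q r≤s = ℚP.≤-trans
    (ℚP.*-monoʳ-≤-nonNeg r {{ℚ.nonNegative 0≤r}} p≤q)
    (ℚP.*-monoˡ-≤-nonNeg q {{ℚ.nonNegative 0≤q}} r≤s)

  ∣*∣-bound : ∀ a b {p q} → ℚ.∣ a ∣ ℚ.≤ p → ℚ.∣ b ∣ ℚ.≤ q →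
              ℚ.∣ a ℚ.* b ∣ ℚ.≤ p ℚ.* q
  ∣*∣-bound a b {p} {q} a≤p b≤q =
    subst (ℚ._≤ p ℚ.* q) (sym (ℚP.∣p*q∣≡∣p∣*∣q∣ a b))
      (*-mono (ℚP.0≤∣p∣ b) (ℚP.≤-trans (ℚP.0≤∣p∣ a) a≤p) a≤p b≤q)

  ∣+∣-bound : ∀ a b {p q} → ℚ.∣ a ∣ ℚ.≤ p → ℚ.∣ b ∣ ℚ.≤ q →
              ℚ.∣ a ℚ.+ b ∣ ℚ.≤ p ℚ.+ q
  ∣+∣-bound a b a≤p b≤q =
    ℚP.≤-trans (ℚP.∣p+q∣≤∣p∣+∣q∣ a b) (ℚP.+-mono-≤ a≤p b≤q)

  cancel : ∀ k i e → i ℚ.* k ≡ 1ℚ → k ℚ.* (i ℚ.* e) ≡ e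
  cancel k i e ik = trans (eq k i e)
    (trans (cong (ℚ._* e) ik) (ℚP.*-identityˡ e))
    where
    open +-*-Solver
    eq : ∀ k i e → k ℚ.* (i ℚ.* e) ≡ (i ℚ.* k) ℚ.* e
    eq = solve 3 (λ k i e → k :* (i :* e) := (i :* k) :* e) refl

  recip-diff : ∀ i j a b → i ℚ.* a ≡ 1ℚ → j ℚ.* b ≡ 1ℚ →
               (i ℚ.* j) ℚ.* (b ℚ.- a) ≡ i ℚ.- j
  recip-diff i j a b ia jb = trans (eq i j a b) (cong₂ ℚ._-_
    (trans (cong (i ℚ.*_) jb) (ℚP.*-identityʳ i))
    (trans (cong (j ℚ.*_) ia) (ℚP.*-identityʳ j)))
    where
    open +-*-Solver
    eq : ∀ i j a b → (i ℚ.* j) ℚ.* (b ℚ.- a) ≡ i ℚ.* (j ℚ.* b) ℚ.- j ℚ.* (i ℚ.* a)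
    eq = solve 4 (λ i j a b →
      (i :* j) :* (b :- a) := i :* (j :* b) :- j :* (i :* a)) refl

  cancel² : ∀ i d e → i ℚ.* d ≡ 1ℚ → (i ℚ.* i) ℚ.* (e ℚ.* (d ℚ.* d)) ≡ e
  cancel² i d e id = trans (eq i d e)
    (trans (cong (ℚ._* e) (cong₂ ℚ._*_ id id)) (ℚP.*-identityˡ e))
    where
    open +-*-Solver
    eq : ∀ i d e → (i ℚ.* i) ℚ.* (e ℚ.* (d ℚ.* d)) ≡ ((i ℚ.* d) ℚ.* (i ℚ.* d)) ℚ.* e
    eq = solve 3 (λ i d e →
      (i :* i) :* (e :* (d :* d)) := ((i :* d) :* (i :* d)) :* e) refl

  ∣∣-swap : ∀ p q → ℚ.∣ p ℚ.- q ∣ ≡ ℚ.∣ q ℚ.- p ∣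
  ∣∣-swap p q = trans (cong ℚ.∣_∣ (eq p q)) (ℚP.∣-p∣≡∣p∣ (q ℚ.- p))
    where
    open +-*-Solver
    eq : ∀ p q → p ℚ.- q ≡ ℚ.- (q ℚ.- p)
    eq = solve 2 (λ p q → p :- q := :- (q :- p)) refl

  product-close : ∀ a b c d K L i j ε → i ℚ.* K ≡ 1ℚ → j ℚ.* L ≡ 1ℚ →
    ℚ.∣ a ∣ ℚ.≤ K → ℚ.∣ d ∣ ℚ.≤ L →
    ℚ.∣ a ℚ.- b ∣ ℚ.≤ j ℚ.* (½ ℚ.* ε) → ℚ.∣ c ℚ.- d ∣ ℚ.≤ i ℚ.* (½ ℚ.* ε) →
    ℚ.∣ a ℚ.* c ℚ.- b ℚ.* d ∣ ℚ.≤ ε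
  product-close a b c d K L i j ε iK jL a≤K d≤L a-b c-d =
    subst₂ ℚ._≤_ (cong ℚ.∣_∣ (eq a b c d))
      (trans (cong₂ ℚ._+_ (cancel K i (½ ℚ.* ε) iK)
               (trans (ℚP.*-comm (j ℚ.* (½ ℚ.* ε)) L) (cancel L j (½ ℚ.* ε) jL)))
             (half ε))
      (∣+∣-bound (a ℚ.* (c ℚ.- d)) ((a ℚ.- b) ℚ.* d)
        (∣*∣-bound a (c ℚ.- d) a≤K c-d) (∣*∣-bound (a ℚ.- b) d a-b d≤L))
    where
    open +-*-Solver
    eq : ∀ a b c d → a ℚ.* (c ℚ.- d) ℚ.+ (a ℚ.- b) ℚ.* d ≡ a ℚ.* c ℚ.- b ℚ.* d
    eq = solve 4 (λ a b c d → a :* (c :- d) :+ (a :- b) :* d := a :* c :- b :* d) refl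

  >⇒≢ : ∀ {p} → 0ℚ ℚ.< p → p ≢ 0ℚ
  >⇒≢ 0<p refl = ℚP.<-irrefl refl 0<p

-- The reciprocal made total by 1/0 = 0; abstract only to keep type checking fast.
abstract
  inv : ℚ → ℚ
  inv p with p ℚP.≟ 0ℚ
  ... | yes _   = 0ℚ
  ... | no p≢0 = (ℚ.1/ p) {{ℚ.≢-nonZero p≢0}}

  inv-inverse : ∀ p → p ≢ 0ℚ → inv p ℚ.* p ≡ 1ℚ
  inv-inverse p p≢0 with p ℚP.≟ 0ℚ
  ... | yes p≡0 = contradiction p≡0 p≢0
  ... | no  q   = ℚP.*-inverseˡ p {{ℚ.≢-nonZero q}}

  inv-pos : ∀ {p} → 0ℚ ℚ.< p → 0ℚ ℚ.< inv p
  inv-pos {p} 0<p with p ℚP.≟ 0ℚ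
  ... | yes p≡0 = contradiction p≡0 (>⇒≢ 0<p)
  ... | no  q   = ℚP.positive⁻¹ _ {{ℚP.1/pos⇒pos p {{ℚ.positive 0<p}}}}

-- Real numbers are Cauchy sequences of rationals that carry a modulus of
-- convergence; _≈ᴿ_ is their equality.
IsCauchy : (ℕ → ℚ) → Set
IsCauchy x = ∀ ε → 0ℚ ℚ.< ε → ∃[ N ] ∀ m n → N ℕ.≤ m → N ℕ.≤ n →
             ℚ.∣ x m ℚ.- x n ∣ ℚ.≤ ε

record ℝ : Set where
  no-eta-equality; pattern
  constructor mkℝ
  field
    approx : ℕ → ℚ
    cauchy : IsCauchy approx

open ℝ public

infix  4 _≈ᴿ_ _<ᴿ_ _≤ᴿ_ _#ᴿ_
infixl 6 _+ᴿ_ _-ᴿ_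
infixl 7 _*ᴿ_ _÷ᴿ_[_]
infix  8 -ᴿ_
infixr 9 _^ᴿ_

record _≈ᴿ_ (x y : ℝ) : Set where
  constructor mk≈
  field
    close : ∀ ε → 0ℚ ℚ.< ε → ∃[ N ] ∀ n → N ℕ.≤ n →
            ℚ.∣ approx x n ℚ.- approx y n ∣ ℚ.≤ ε

record _<ᴿ_ (x y : ℝ) : Set where
  constructor mk<
  field
    gap     : ℚ
    gap-pos : 0ℚ ℚ.< gap
    from    : ℕ
    apart   : ∀ n → from ℕ.≤ n → approx x n ℚ.+ gap ℚ.≤ approx y n

record _≤ᴿ_ (x y : ℝ) : Set where
  constructor mk≤
  field
    almost : ∀ ε → 0ℚ ℚ.< ε → ∃[ N ] ∀ n → N ℕ.≤ n →
             approx x n ℚ.≤ approx y n ℚ.+ ε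

-- Apartness, the constructive form of x ≠ y.
_#ᴿ_ : ℝ → ℝ → Set
x #ᴿ y = x <ᴿ y ⊎ y <ᴿ x

private abstract
  const-cauchy : ∀ q → IsCauchy (λ _ → q)
  const-cauchy q ε 0<ε = 0 , λ _ _ _ _ →
    subst (λ d → ℚ.∣ d ∣ ℚ.≤ ε) (sym (ℚP.+-inverseʳ q)) (ℚP.<⇒≤ 0<ε)

  +-cauchy : ∀ x y → IsCauchy (λ n → approx x n ℚ.+ approx y n)
  +-cauchy (mkℝ x cx) (mkℝ y cy) ε 0<ε =
    let M , hx = cx (½ ℚ.* ε) (*-pos ½-pos 0<ε)
        N , hy = cy (½ ℚ.* ε) (*-pos ½-pos 0<ε)
    in M ℕ.⊔ N , λ m n p q → subst₂ ℚ._≤_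
      (cong ℚ.∣_∣ (eq (x m) (x n) (y m) (y n)))
      (half ε)
      (∣+∣-bound (x m ℚ.- x n) (y m ℚ.- y n)
                 (hx m n (ℕP.m⊔n≤o⇒m≤o M N p) (ℕP.m⊔n≤o⇒m≤o M N q))
                 (hy m n (ℕP.m⊔n≤o⇒n≤o M N p) (ℕP.m⊔n≤o⇒n≤o M N q)))
    where
    open +-*-Solver
    eq : ∀ a b c d → (a ℚ.- b) ℚ.+ (c ℚ.- d) ≡ (a ℚ.+ c) ℚ.- (b ℚ.+ d)
    eq = solve 4 (λ a b c d → (a :- b) :+ (c :- d) := (a :+ c) :- (b :+ d)) refl

  neg-cauchy : ∀ x → IsCauchy (λ n → ℚ.- approx x n)
  neg-cauchy (mkℝ x cx) ε 0<ε =
    let N , h = cx ε 0<ε in N , λ m n p q →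
      subst (ℚ._≤ ε)
        (trans (sym (ℚP.∣-p∣≡∣p∣ (x m ℚ.- x n)))
               (cong ℚ.∣_∣ (ℚP.neg-distrib-+ (x m) (ℚ.- x n))))
        (h m n p q)

  bounded : ∀ x → ∃[ K ] 0ℚ ℚ.< K × ∃[ N ] ∀ n → N ℕ.≤ n →
            ℚ.∣ approx x n ∣ ℚ.≤ K
  bounded (mkℝ x cx) =
    let N , h = cx 1ℚ (ℚP.positive⁻¹ 1ℚ) in
    ℚ.∣ x N ∣ ℚ.+ 1ℚ ,
    ℚP.+-mono-≤-< {0ℚ} {ℚ.∣ x N ∣} {0ℚ} {1ℚ}
      (ℚP.0≤∣p∣ (x N)) (ℚP.positive⁻¹ 1ℚ) ,
    N , λ n N≤n →
      subst (λ a → ℚ.∣ a ∣ ℚ.≤ ℚ.∣ x N ∣ ℚ.+ 1ℚ)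
        (eq (x n) (x N))
        (∣+∣-bound (x N) (x n ℚ.- x N) ℚP.≤-refl (h n N N≤n ℕP.≤-refl))
    where
    open +-*-Solver
    eq : ∀ a b → b ℚ.+ (a ℚ.- b) ≡ a
    eq = solve 2 (λ a b → b :+ (a :- b) := a) refl

  *-cauchy : ∀ x y → IsCauchy (λ n → approx x n ℚ.* approx y n)
  *-cauchy (mkℝ x cx) (mkℝ y cy) ε 0<ε =
    let K , 0<K , M₁ , bx = bounded (mkℝ x cx)
        L , 0<L , M₂ , by = bounded (mkℝ y cy)
        M₃ , hx = cx (inv L ℚ.* (½ ℚ.* ε)) (*-pos (inv-pos 0<L) (*-pos ½-pos 0<ε))
        M₄ , hy = cy (inv K ℚ.* (½ ℚ.* ε)) (*-pos (inv-pos 0<K) (*-pos ½-pos 0<ε))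
    in (M₁ ℕ.⊔ M₂) ℕ.⊔ (M₃ ℕ.⊔ M₄) , λ m n p q →
      let m₁₂ = ℕP.m⊔n≤o⇒m≤o (M₁ ℕ.⊔ M₂) (M₃ ℕ.⊔ M₄) p
          m₃₄ = ℕP.m⊔n≤o⇒n≤o (M₁ ℕ.⊔ M₂) (M₃ ℕ.⊔ M₄) p
          n₁₂ = ℕP.m⊔n≤o⇒m≤o (M₁ ℕ.⊔ M₂) (M₃ ℕ.⊔ M₄) q
          n₃₄ = ℕP.m⊔n≤o⇒n≤o (M₁ ℕ.⊔ M₂) (M₃ ℕ.⊔ M₄) q
      in product-close (x m) (x n) (y m) (y n) K L (inv K) (inv L) ε
        (inv-inverse K (>⇒≢ 0<K)) (inv-inverse L (>⇒≢ 0<L))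
        (bx m (ℕP.m⊔n≤o⇒m≤o M₁ M₂ m₁₂))
        (by n (ℕP.m⊔n≤o⇒n≤o M₁ M₂ n₁₂))
        (hx m n (ℕP.m⊔n≤o⇒m≤o M₃ M₄ m₃₄) (ℕP.m⊔n≤o⇒m≤o M₃ M₄ n₃₄))
        (hy m n (ℕP.m⊔n≤o⇒n≤o M₃ M₄ m₃₄) (ℕP.m⊔n≤o⇒n≤o M₃ M₄ n₃₄))

fromℚ : ℚ → ℝ
fromℚ q = mkℝ (λ _ → q) (const-cauchy q)

fromℕ : ℕ → ℝ
fromℕ n = fromℚ (+ n ℚ./ 1)

0ᴿ 1ᴿ : ℝ
0ᴿ = fromℚ 0ℚ
1ᴿ = fromℚ 1ℚ

_+ᴿ_ : ℝ → ℝ → ℝ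
x +ᴿ y = mkℝ (λ n → approx x n ℚ.+ approx y n) (+-cauchy x y)

-ᴿ_ : ℝ → ℝ
-ᴿ x = mkℝ (λ n → ℚ.- approx x n) (neg-cauchy x)

_-ᴿ_ : ℝ → ℝ → ℝ
x -ᴿ y = x +ᴿ (-ᴿ y)

_*ᴿ_ : ℝ → ℝ → ℝ
x *ᴿ y = mkℝ (λ n → approx x n ℚ.* approx y n) (*-cauchy x y)

_^ᴿ_ : ℝ → ℕ → ℝ
x ^ᴿ zero  = 1ᴿ
x ^ᴿ suc n = x *ᴿ x ^ᴿ n

private abstract
  awayFrom0 : ∀ x → x #ᴿ 0ᴿ → ∃[ δ ] 0ℚ ℚ.< δ × ∃[ N ] ∀ n → N ℕ.≤ n →
              δ ℚ.≤ ℚ.∣ approx x n ∣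
  awayFrom0 x (inj₁ (mk< δ 0<δ N h)) = δ , 0<δ , N , λ n p →
    let a    = approx x n
        δ≤-a = subst₂ ℚ._≤_ (eq a δ) (ℚP.+-identityˡ (ℚ.- a))
                 (ℚP.+-monoˡ-≤ (ℚ.- a) (h n p))
    in subst (δ ℚ.≤_)
         (trans (sym (ℚP.0≤p⇒∣p∣≡p (ℚP.≤-trans (ℚP.<⇒≤ 0<δ) δ≤-a)))
                (ℚP.∣-p∣≡∣p∣ a))
         δ≤-a
    where
    open +-*-Solver
    eq : ∀ a d → a ℚ.+ d ℚ.- a ≡ d
    eq = solve 2 (λ a d → a :+ d :- a := d) refl
  awayFrom0 x (inj₂ (mk< δ 0<δ N h)) = δ , 0<δ , N , λ n p →
    let δ≤a = subst (ℚ._≤ approx x n) (ℚP.+-identityˡ δ) (h n p)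
    in subst (δ ℚ.≤_)
         (sym (ℚP.0≤p⇒∣p∣≡p (ℚP.≤-trans (ℚP.<⇒≤ 0<δ) δ≤a))) δ≤a

  recip-cauchy : ∀ x → x #ᴿ 0ᴿ → IsCauchy (λ n → inv (approx x n))
  recip-cauchy x x#0 = c
    where
    δ : ℚ
    δ   = proj₁ (awayFrom0 x x#0)
    0<δ : 0ℚ ℚ.< δ
    0<δ = proj₁ (proj₂ (awayFrom0 x x#0))
    M : ℕ
    M   = proj₁ (proj₂ (proj₂ (awayFrom0 x x#0)))
    far : ∀ n → M ℕ.≤ n → δ ℚ.≤ ℚ.∣ approx x n ∣
    far = proj₂ (proj₂ (proj₂ (awayFrom0 x x#0)))

    nz : ∀ n → M ℕ.≤ n → approx x n ≢ 0ℚ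
    nz n p eq = ℚP.<-irrefl refl
      (ℚP.<-≤-trans 0<δ (subst (λ a → δ ℚ.≤ ℚ.∣ a ∣) eq (far n p)))

    inv≤ : ∀ n → M ℕ.≤ n → ℚ.∣ inv (approx x n) ∣ ℚ.≤ inv δ
    inv≤ n p = ℚP.*-cancelʳ-≤-pos δ {{ℚ.positive 0<δ}}
      (subst (ℚ.∣ i ∣ ℚ.* δ ℚ.≤_)
        (trans (sym (ℚP.∣p*q∣≡∣p∣*∣q∣ i (approx x n)))
          (trans (cong ℚ.∣_∣ (inv-inverse (approx x n) (nz n p)))
                 (sym (inv-inverse δ (>⇒≢ 0<δ)))))
        (ℚP.*-monoˡ-≤-nonNeg ℚ.∣ i ∣ {{ℚP.∣-∣-nonNeg i}} (far n p)))
      where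
      i : ℚ
      i = inv (approx x n)

    scale : ∀ ε → (inv δ ℚ.* inv δ) ℚ.* (ε ℚ.* (δ ℚ.* δ)) ≡ ε
    scale ε = cancel² (inv δ) δ ε (inv-inverse δ (>⇒≢ 0<δ))

    c : ∀ ε → 0ℚ ℚ.< ε → ∃[ N ] ∀ m n → N ℕ.≤ m → N ℕ.≤ n →
        ℚ.∣ inv (approx x m) ℚ.- inv (approx x n) ∣ ℚ.≤ ε
    c ε 0<ε with cauchy x (ε ℚ.* (δ ℚ.* δ)) (*-pos 0<ε (*-pos 0<δ 0<δ))
    ... | N , h = M ℕ.⊔ N , λ m n p q →
      let M≤m = ℕP.m⊔n≤o⇒m≤o M N p
          M≤n = ℕP.m⊔n≤o⇒m≤o M N q
      in subst₂ ℚ._≤_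
        (cong ℚ.∣_∣ (recip-diff (inv (approx x m)) (inv (approx x n)) (approx x m) (approx x n)
          (inv-inverse (approx x m) (nz m M≤m)) (inv-inverse (approx x n) (nz n M≤n))))
        (scale ε)
        (∣*∣-bound (inv (approx x m) ℚ.* inv (approx x n)) (approx x n ℚ.- approx x m)
                   (∣*∣-bound (inv (approx x m)) (inv (approx x n)) (inv≤ m M≤m) (inv≤ n M≤n))
                   (h n m (ℕP.m⊔n≤o⇒n≤o M N q) (ℕP.m⊔n≤o⇒n≤o M N p)))

-- At most finitely many approximants vanish, so inv 0 = 0 does not matter.
recip : (x : ℝ) → x #ᴿ 0ᴿ → ℝ
recip x x#0 = mkℝ (λ n → inv (approx x n)) (recip-cauchy x x#0)

_÷ᴿ_[_] : (x y : ℝ) → y #ᴿ 0ᴿ → ℝ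
x ÷ᴿ y [ y#0 ] = x *ᴿ recip y y#0

sgn : ℕ → ℚ
sgn zero    = 1ℚ
sgn (suc n) = ℚ.- sgn n

private
  /-mono : ∀ a b c d → a ℕ.* suc d ℕ.≤ c ℕ.* suc b →
           + a ℚ./ suc b ℚ.≤ + c ℚ./ suc d
  /-mono a b c d h = ℚP.toℚᵘ-cancel-≤
    (ℚᵘP.≤-respˡ-≃ (ℚᵘP.≃-sym (ℚP.toℚᵘ-fromℚᵘ (ℚᵘ.mkℚᵘ (+ a) b)))
    (ℚᵘP.≤-respʳ-≃ (ℚᵘP.≃-sym (ℚP.toℚᵘ-fromℚᵘ (ℚᵘ.mkℚᵘ (+ c) d)))
    (ℚᵘ.*≤* (subst₂ ℤ._≤_ (ℤP.pos-* a (suc d)) (ℤP.pos-* c (suc b)) (ℤ.+≤+ h)))))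

  1/↧≤ : ∀ p → 0ℚ ℚ.< p → + 1 ℚ./ ↧ₙ p ℚ.≤ p
  1/↧≤ (ℚ.mkℚ (+ zero) _ _) 0<p with () ← ℚ.positive 0<p
  1/↧≤ (ℚ.mkℚ -[1+ _ ] _ _) 0<p with () ← ℚ.positive 0<p
  1/↧≤ p@(ℚ.mkℚ ℤ.+[1+ k ] d-1 _) _ = subst (+ 1 ℚ./ suc d-1 ℚ.≤_) (ℚP.fromℚᵘ-toℚᵘ p)
    (/-mono 1 d-1 (suc k) d-1 (ℕP.*-monoˡ-≤ (suc d-1) (s≤s (z≤n {k}))))

abstract
  term : ℕ → ℚ
  term n = + 4 ℚ./ suc (2 ℕ.* n)

  term≥0 : ∀ n → 0ℚ ℚ.≤ term n
  term≥0 n = /-mono 0 0 4 (2 ℕ.* n) z≤n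

  term-anti : ∀ n → term (suc n) ℚ.≤ term n
  term-anti n = /-mono 4 (2 ℕ.* suc n) 4 (2 ℕ.* n)
    (ℕP.*-monoʳ-≤ 4 (s≤s (ℕP.*-monoʳ-≤ 2 (ℕP.n≤1+n n))))

  1≤term₀-term₁ : 1ℚ ℚ.≤ term 0 ℚ.- term 1
  1≤term₀-term₁ = ℚP.≤ᵇ⇒≤ _

  term-small : ∀ p → 0ℚ ℚ.< p → term (2 ℕ.* ↧ₙ p) ℚ.≤ p
  term-small p 0<p = ℚP.≤-trans
    (/-mono 4 (2 ℕ.* (2 ℕ.* ↧ₙ p)) 1 (ℚ.denominator-1 p) (bound (↧ₙ p)))
    (1/↧≤ p 0<p)
    where
    bound : ∀ q → 4 ℕ.* q ℕ.≤ 1 ℕ.* suc (2 ℕ.* (2 ℕ.* q))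
    bound q = subst₂ ℕ._≤_ (sym (ℕP.*-assoc 2 2 q))
      (sym (ℕP.*-identityˡ (suc (2 ℕ.* (2 ℕ.* q)))))
      (ℕP.n≤1+n (2 ℕ.* (2 ℕ.* q)))

-- Partial sums of 4 - 4/3 + 4/5 - ⋯ = π.
leibniz : ℕ → ℚ
leibniz zero    = 0ℚ
leibniz (suc n) = leibniz n ℚ.+ sgn n ℚ.* term n

private
  -- term n - term (n + 1) + ⋯ , with d terms.
  tail : ℕ → ℕ → ℚ
  tail n zero    = 0ℚ
  tail n (suc d) = term n ℚ.- tail (suc n) d

  tail-bounds : ∀ n d → 0ℚ ℚ.≤ tail n d × tail n d ℚ.≤ term n
  tail-bounds n zero    = ℚP.≤-refl , term≥0 n
  tail-bounds n (suc d) =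
    let lo , hi = tail-bounds (suc n) d in
    subst (ℚ._≤ term n ℚ.- tail (suc n) d) (ℚP.+-inverseʳ (tail (suc n) d))
      (ℚP.+-monoˡ-≤ (ℚ.- tail (suc n) d) {tail (suc n) d} {term n} (ℚP.≤-trans hi (term-anti n))) ,
    subst (term n ℚ.- tail (suc n) d ℚ.≤_) (ℚP.+-identityʳ (term n))
      (ℚP.+-monoʳ-≤ (term n) {ℚ.- tail (suc n) d} {ℚ.- 0ℚ} (ℚP.neg-antimono-≤ {0ℚ} {tail (suc n) d} lo))

  leibniz-tail : ∀ d n → leibniz (d ℕ.+ n) ℚ.- leibniz n ≡ sgn n ℚ.* tail n d
  leibniz-tail zero    n = trans (ℚP.+-inverseʳ (leibniz n)) (sym (ℚP.*-zeroʳ (sgn n)))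
  leibniz-tail (suc d) n = trans
    (cong (λ k → leibniz k ℚ.- leibniz n) (sym (ℕP.+-suc d n)))
    (trans (split (leibniz (d ℕ.+ suc n)) (leibniz n) (sgn n ℚ.* term n))
    (trans (cong (ℚ._+ sgn n ℚ.* term n) (leibniz-tail d (suc n)))
           (regroup (sgn n) (term n) (tail (suc n) d))))
    where
    open +-*-Solver
    split : ∀ a b c → a ℚ.- b ≡ (a ℚ.- (b ℚ.+ c)) ℚ.+ c
    split = solve 3 (λ a b c → a :- b := (a :- (b :+ c)) :+ c) refl
    regroup : ∀ s v t → (ℚ.- s) ℚ.* t ℚ.+ s ℚ.* v ≡ s ℚ.* (v ℚ.- t)
    regroup = solve 3 (λ s v t → (:- s) :* t :+ s :* v := s :* (v :- t)) refl

  ∣sgn∣ : ∀ n → ℚ.∣ sgn n ∣ ≡ 1ℚ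
  ∣sgn∣ zero    = refl
  ∣sgn∣ (suc n) = trans (ℚP.∣-p∣≡∣p∣ (sgn n)) (∣sgn∣ n)

  leibniz-close : ∀ N m → N ℕ.≤ m → ℚ.∣ leibniz m ℚ.- leibniz N ∣ ℚ.≤ term N
  leibniz-close N m N≤m = subst (ℚ._≤ term N)
    (sym (trans (cong (λ k → ℚ.∣ leibniz k ℚ.- leibniz N ∣) (sym (ℕP.m∸n+n≡m N≤m)))
         (trans (cong ℚ.∣_∣ (leibniz-tail d N))
         (trans (ℚP.∣p*q∣≡∣p∣*∣q∣ (sgn N) (tail N d))
         (trans (cong (ℚ._* ℚ.∣ tail N d ∣) (∣sgn∣ N))
         (trans (ℚP.*-identityˡ ℚ.∣ tail N d ∣)
                (ℚP.0≤p⇒∣p∣≡p (proj₁ (tail-bounds N d)))))))))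
    (proj₂ (tail-bounds N d))
    where d = m ℕ.∸ N

  between : ∀ a b z ε → ℚ.∣ a ℚ.- z ∣ ℚ.≤ ½ ℚ.* ε → ℚ.∣ b ℚ.- z ∣ ℚ.≤ ½ ℚ.* ε →
            ℚ.∣ a ℚ.- b ∣ ℚ.≤ ε
  between a b z ε az bz = subst₂ ℚ._≤_ (cong ℚ.∣_∣ (eq a b z)) (half ε)
    (∣+∣-bound (a ℚ.- z) (z ℚ.- b) az (subst (ℚ._≤ ½ ℚ.* ε) (∣∣-swap b z) bz))
    where
    open +-*-Solver
    eq : ∀ a b z → (a ℚ.- z) ℚ.+ (z ℚ.- b) ≡ a ℚ.- b
    eq = solve 3 (λ a b z → (a :- z) :+ (z :- b) := a :- b) refl

private abstract
  leibniz-cauchy : IsCauchy leibniz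
  leibniz-cauchy ε 0<ε =
    let N   = 2 ℕ.* ↧ₙ (½ ℚ.* ε)
        termN≤ = term-small (½ ℚ.* ε) (*-pos ½-pos 0<ε)
    in N , λ m n p q → between (leibniz m) (leibniz n) (leibniz N) ε
      (ℚP.≤-trans (leibniz-close N m p) termN≤)
      (ℚP.≤-trans (leibniz-close N n q) termN≤)

π : ℝ
π = mkℝ leibniz leibniz-cauchy

abstract
  π#0 : π #ᴿ 0ᴿ
  π#0 = inj₂ (mk< 1ℚ (ℚP.positive⁻¹ 1ℚ) 1 λ where
    (suc n) _ → subst₂ ℚ._≤_ (sym (ℚP.+-identityˡ 1ℚ)) (sym (value n))
      (ℚP.≤-trans 1≤term₀-term₁ (ℚP.+-monoʳ-≤ (term 0) {ℚ.- term 1} {ℚ.- tail 1 n}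
        (ℚP.neg-antimono-≤ {tail 1 n} {term 1} (proj₂ (tail-bounds 1 n))))))
    where
    value : ∀ n → leibniz (suc n) ≡ term 0 ℚ.- tail 1 n
    value n = trans (sym (ℚP.+-identityʳ (leibniz (suc n))))
      (trans (cong (λ k → leibniz k ℚ.- leibniz 0) (sym (ℕP.+-identityʳ (suc n))))
      (trans (leibniz-tail (suc n) 0) (ℚP.*-identityˡ (term 0 ℚ.- tail 1 n))))

1/ℚ_^_ : (m j : ℕ) → .{{_ : ℕ.NonZero m}} → ℚ
1/ℚ m ^ j = (+ 1 ℚ./ (m ℕ.^ j)) {{ℕP.m^n≢0 m j}}

_^ℤ_ : (m : ℕ) → ℤ → .{{_ : ℕ.NonZero m}} → ℚ
m ^ℤ (+ p)    = + (m ℕ.^ p) ℚ./ 1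
m ^ℤ -[1+ p ] = 1/ℚ m ^ suc p

-- t = m ^ c for a real exponent c: t is at most m ^ r for every rational
-- r > c and at least m ^ r for every rational r < c.  For r = p / q, comparing
-- t with m ^ r means comparing t ^ q with m ^ p.  This determines t, as
-- m ^ r is continuous in r.
record IsPower (m : ℕ) .{{_ : ℕ.NonZero m}} (c t : ℝ) : Set where
  field
    positive : 0ᴿ <ᴿ t
    upper    : ∀ r → c <ᴿ fromℚ r → t ^ᴿ (↧ₙ r) ≤ᴿ fromℚ (m ^ℤ (↥ r))
    lower    : ∀ r → fromℚ r <ᴿ c → fromℚ (m ^ℤ (↥ r)) ≤ᴿ t ^ᴿ (↧ₙ r)

record ℂ : Set where
  no-eta-equality; pattern
  constructor _+i_
  field
    re im : ℝ

open ℂ public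

infix  4 _≈_ ∣_∣≤_
infix  5 _≉0 _+i_
infixl 6 _+_ _-_
infixl 7 _*_ _÷_[_]
infixr 9 _^_

record _≈_ (z w : ℂ) : Set where
  field
    re≈ : re z ≈ᴿ re w
    im≈ : im z ≈ᴿ im w

ofℝ : ℝ → ℂ
ofℝ x = x +i 0ᴿ

ofℕ : ℕ → ℂ
ofℕ n = ofℝ (fromℕ n)

0ᶜ 1ᶜ -1ᶜ 𝑖 : ℂ
0ᶜ  = ofℝ 0ᴿ
1ᶜ  = ofℝ 1ᴿ
-1ᶜ = ofℝ (-ᴿ 1ᴿ)
𝑖   = 0ᴿ +i 1ᴿ

_+_ _-_ _*_ : ℂ → ℂ → ℂ
z + w = (re z +ᴿ re w) +i (im z +ᴿ im w)
z - w = (re z -ᴿ re w) +i (im z -ᴿ im w)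
z * w = (re z *ᴿ re w -ᴿ im z *ᴿ im w) +i (re z *ᴿ im w +ᴿ im z *ᴿ re w)

_^_ : ℂ → ℕ → ℂ
z ^ zero  = 1ᶜ
z ^ suc n = z * z ^ n

∣_∣² : ℂ → ℝ
∣ z ∣² = re z *ᴿ re z +ᴿ im z *ᴿ im z

-- z ≠ 0, constructively.
_≉0 : ℂ → Set
z ≉0 = ∣ z ∣² #ᴿ 0ᴿ

_÷_[_] : (z w : ℂ) → w ≉0 → ℂ
z ÷ w [ w≉0 ] = z * (re w ÷ᴿ ∣ w ∣² [ w≉0 ] +i (-ᴿ (im w ÷ᴿ ∣ w ∣² [ w≉0 ])))

1/_^_ : (m j : ℕ) → .{{_ : ℕ.NonZero m}} → ℂ
1/ m ^ j = ofℝ (fromℚ (1/ℚ m ^ j))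

-- |z| ≤ r, squared to avoid the square root in |z|.
∣_∣≤_ : ℂ → ℝ → Set
∣ z ∣≤ r = 0ᴿ ≤ᴿ r × ∣ z ∣² ≤ᴿ r *ᴿ r

-- a k = o(|k| ^ c) as k → ±∞; here ε * t is ε |k| ^ c.
_=o[k^_] : (ℤ → ℂ) → ℝ → Set
a =o[k^ c ] = ∀ ε → 0ᴿ <ᴿ ε → ∃[ N ] ∀ k .{{_ : ℤ.NonZero k}} → N ℕ.≤ ℤ.∣ k ∣ →
  ∃[ t ] IsPower ℤ.∣ k ∣ c t × ∣ a k ∣≤ (ε *ᴿ t)

-- ∑< n f = f 0 + ⋯ + f (n - 1)
∑< : ℕ → (ℕ → ℂ) → ℂ
∑< zero    f = 0ᶜ
∑< (suc n) f = ∑< n f + f n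

HasSum : (ℕ → ℂ) → ℂ → Set
HasSum f S = ∀ ε → 0ᴿ <ᴿ ε → ∃[ N ] ∀ n → N ℕ.≤ n → ∣ ∑< n f - S ∣≤ ε

record Summable (f : ℕ → ℂ) : Set where
  field
    sum    : ℂ
    hasSum : HasSum f sum

-- Up to _≈_, independent of the proof of summability.
∑ : ∀ {f} → Summable f → ℂ
∑ = Summable.sum

-- The sum of f j₁ j₂ over j₁ + j₂ = k with j₁ , j₂ ≥ 1, for k ≥ 2:
-- j₁ = i + 1 and j₂ = k - 1 - i for 0 ≤ i < k - 1.
∑[j₁+j₂≡_] : (k : ℕ) → (∀ j₁ j₂ → 1 ℕ.≤ j₁ → 1 ℕ.≤ j₂ → ℂ) → ℂ
∑[j₁+j₂≡ k ] f =
  ∑< (k ℕ.∸ 1) λ i → f (suc i) (suc (k ℕ.∸ 2 ℕ.∸ i)) (s≤s z≤n) (s≤s z≤n)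

-- An infinite series need not converge, and division needs a nonzero divisor;
-- so D, cot and coth are functions of evidence that their value is defined.
DirichletConverges : (ℤ → ℂ) → Set
DirichletConverges A =
  ∀ j → 1 ℕ.< j → Summable λ n → A (+ suc n) * 1/ suc n ^ j

D : ∀ A → DirichletConverges A → ∀ j → 1 ℕ.< j → ℂ
D A conv j 1<j = ∑ (conv j 1<j)

1<2* : ∀ {j} → 1 ℕ.≤ j → 1 ℕ.< 2 ℕ.* j
1<2* = ℕP.*-monoʳ-≤ 2

infix 8 _/π

_/π : ℂ → ℂ
z /π = z * ofℝ (1ᴿ ÷ᴿ π [ π#0 ])

-- cot(z; A) is specified through π cot(πs; A), so it is evaluated at s = z / π
-- and then divided by π.
CotDefined : (ℤ → ℂ) → ℂ → Set
CotDefined A z =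
  (z /π ≉0) ×
  (Σ[ k²-s²≉0 ∈ (∀ n → ofℕ (suc n) ^ 2 - (z /π) ^ 2 ≉0) ]
    Summable λ n → A (+ suc n) ÷ (ofℕ (suc n) ^ 2 - (z /π) ^ 2) [ k²-s²≉0 n ])

cot : ∀ A z → CotDefined A z → ℂ
cot A z (s≉0 , _ , series) =
  (A (+ 0) ÷ z /π [ s≉0 ] - ofℕ 2 * z /π * ∑ series) /π

CothDefined : (ℤ → ℂ) → ℂ → Set
CothDefined A z = CotDefined A (𝑖 * z)

coth : ∀ A z → CothDefined A z → ℂ
coth A z d = 𝑖 * cot A (𝑖 * z) d

{-# OPTIONS --safe #-}

-- Both sides are limits of finite sums over n, m < N.  Since
-- coth(nβπ/α; B) = (1/π) (b₀ α/(nβ) + 2 (nβ/α) ∑ₘ bₘ / (m² + (nβ/α)²)), the b₀ part of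
-- the first series gives b₀ α²ᵏ D(2k), and the rest is 2 α²ᵏ β² ∑ₙ∑ₘ aₙ bₘ n²⁻²ᵏ / E with
-- E = α²m² + β²n²; the second series contributes the same with the roles exchanged.
-- With X = α²/n² and Y = β²/m² we have E = n²m² (X + Y), so the two double sums add up
-- termwise to 2 aₙ bₘ XY (Xᵏ⁻¹ - (-Y)ᵏ⁻¹) / (X + Y), a finite geometric sum whose terms
-- are products of a term of D(A) and a term of D(B).  The bound 1/(m² + (nβ/α)²) ≤ 1/m²
-- makes the tail of the inner sums small uniformly in n, so the square partial sums
-- have the iterated sums as limits.
--
-- All convergence is by telescoping: |fₙ| ≤ gₙ - gₙ₊₁ with g rational and tending to 0.
-- For fₙ = aₙ/n², the growth condition yields an exponent e/(e+1) < 1, and powers with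
-- that exponent are majorized by integers on blocks of indices of length growing by the
-- factor 2ᵉ⁺¹, which avoids roots.

module Submission where

open import Defs
open import Algebra.Bundles using (CommutativeRing)
open import Algebra.Solver.Ring.AlmostCommutativeRing
  using (fromCommutativeRing; _-Raw-AlmostCommutative⟶_)
import Algebra.Solver.Ring as RingSolver
open import Algebra.Structures using (IsCommutativeRing)
open import Data.Nat as ℕ using (ℕ; zero; suc; s≤s; z≤n)
import Data.Nat.Properties as ℕP
open import Data.Nat.Properties using (<⇒≤)
open import Data.Integer as ℤ using (ℤ; +_)
import Data.Integer.Properties as ℤP
import Data.Nat.Coprimality as Coprime
open import Data.Maybe using (Maybe; just; nothing)
open import Data.Product using (Σ-syntax; ∃-syntax; _×_; _,_; proj₁; proj₂)
open import Data.Rational as ℚ using (ℚ; 0ℚ; 1ℚ; ½)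
import Data.Rational.Properties as ℚP
import Data.Rational.Unnormalised as ℚᵘ
import Data.Rational.Unnormalised.Properties as ℚᵘP
open import Data.Rational.Solver using (module +-*-Solver)
open import Data.Sum using (inj₁; inj₂)
open import Function using (_$_)
open import Level using (0ℓ)
import Relation.Binary.Reasoning.Setoid as SetoidReasoning
open import Relation.Binary.PropositionalEquality
  using (_≡_; _≢_; refl; sym; trans; cong; cong₂; subst; subst₂)
open import Relation.Nullary using (yes; no; contradiction)

-- Polynomial identities

-- The statement asks for evidence: each series and each quotient comes with a proof that it is
-- defined. Constructively a bounded monotone sequence need not converge, so a comparison of norms
-- would not be enough; a telescoping majorant is an explicit rate, from which the limit itself is
-- built, and one and the same rate serves a whole family of inner series. No infinite double series
-- is ever formed or rearranged: for each N an identity between finite sums holds, and limits are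
-- taken only of finitely many sums and products. The second obstacle is that |k|ᶜ for real c is
-- known only through comparisons of its integer powers with rationals. The exponent e/(e+1) leads
-- to tᵉ⁺¹ against nᵉ; on a block that ends at 2^((e+1)J) the majorant 2^(eJ) is an exact root, so
-- integers suffice. Finally, apartness from 0 is always obtained by exhibiting an inverse.

record CommutativeℚAlgebra : Set₁ where
  constructor algebra
  infix  4 _∼_
  infixl 6 _⊕_ _⊖_
  infixl 7 _·_
  infix  8 -_
  field
    C                 : Set
    _∼_               : C → C → Set
    _⊕_ _·_ _⊖_       : C → C → C
    -_                : C → C
    0# 1#             : C
    isCommutativeRing : IsCommutativeRing _∼_ _⊕_ _·_ -_ 0# 1#
    minus             : ∀ x y → x ⊖ y ∼ x ⊕ - y
    ⟦_⟧               : ℚ → C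
    +-homo            : ∀ p q → ⟦ p ℚ.+ q ⟧ ∼ ⟦ p ⟧ ⊕ ⟦ q ⟧
    *-homo            : ∀ p q → ⟦ p ℚ.* q ⟧ ∼ ⟦ p ⟧ · ⟦ q ⟧
    -‿homo            : ∀ p → ⟦ ℚ.- p ⟧ ∼ - ⟦ p ⟧
    0-homo            : ⟦ 0ℚ ⟧ ∼ 0#
    1-homo            : ⟦ 1ℚ ⟧ ∼ 1#

-- Over an abstract algebra the operations are variables, so each identity is plain polynomial
-- algebra and the Cauchy sequences behind ℂ do not appear. Hypotheses of the form u · n ∼ 1# take
-- the place of division.
module RingIdentities (R : CommutativeℚAlgebra) where

  open CommutativeℚAlgebra R

  private
    ring : CommutativeRing _ _
    ring = record { isCommutativeRing = isCommutativeRing }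

  open CommutativeRing ring
    using (setoid; *-cong; +-cong; -‿cong; *-identityʳ)
    renaming (refl to ∼-refl; sym to ∼-sym; trans to ∼-trans)

  private
    φ : CommutativeRing.rawRing ℚP.+-*-commutativeRing -Raw-AlmostCommutative⟶ fromCommutativeRing ring
    φ = record
      { ⟦_⟧ = ⟦_⟧ ; +-homo = +-homo ; *-homo = *-homo ; -‿homo = -‿homo ; 0-homo = 0-homo ; 1-homo = 1-homo }

    decide : ∀ p q → Maybe (⟦ p ⟧ ∼ ⟦ q ⟧)
    decide p q with p ℚP.≟ q
    ... | yes refl = just ∼-refl
    ... | no  _    = nothing

    open module Solver = RingSolver _ (fromCommutativeRing ring) φ decide
      using (solve; _:=_; _:+_; _:*_; _:-_; :-_; con)

    open SetoidReasoning setoid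

  abstract
    -- With `p` = 1/π and `a′` = 1/α this puts the argument of the cotangent into the form s = iy
    -- with y = nβ/α, in which all later computations take place.
    scaled-argument : ∀ {x i n b a′ π p} → x ∼ (n · b · π · a′) → (p · π) ∼ 1# →
                      (i · x · p) ∼ (i · (n · b · a′))
    scaled-argument {x} {i} {n} {b} {a′} {π} {p} x≈ pπ = begin
      i · x · p                                    ≈⟨ *-cong (*-cong ∼-refl x≈) ∼-refl ⟩
      i · (n · b · π · a′) · p                     ≈⟨ solve 6 (λ i n b π a′ p →
        i :* (n :* b :* π :* a′) :* p := i :* (n :* b :* a′) :* (p :* π)) ∼-refl i n b π a′ p ⟩
      i · (n · b · a′) · (p · π)                   ≈⟨ *-cong ∼-refl pπ ⟩
      i · (n · b · a′) · 1#                        ≈⟨ *-identityʳ _ ⟩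
      i · (n · b · a′)                             ∎

    product-inverse : ∀ {n b a u b′ a′} → (u · n) ∼ 1# → (b′ · b) ∼ 1# → (a′ · a) ∼ 1# →
                      (n · b · a′ · (u · b′ · a)) ∼ 1#
    product-inverse {n} {b} {a} {u} {b′} {a′} un bb aa = begin
      n · b · a′ · (u · b′ · a)       ≈⟨ solve 6 (λ n b a u b′ a′ →
        n :* b :* a′ :* (u :* b′ :* a) := (u :* n) :* (b′ :* b) :* (a′ :* a)) ∼-refl n b a u b′ a′ ⟩
      u · n · (b′ · b) · (a′ · a)     ≈⟨ *-cong (*-cong un bb) aa ⟩
      1# · 1# · 1#                    ≈⟨ ∼-trans (*-identityʳ _) (*-identityʳ _) ⟩
      1#                              ∎

    rotated-inverse : ∀ {i s y y′} → (i · i) ∼ (- 1#) → s ∼ (i · y) → (y · y′) ∼ 1# →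
                      (s · (- (i · y′))) ∼ 1#
    rotated-inverse {i} {s} {y} {y′} ii s≈ yy = begin
      s · (- (i · y′))            ≈⟨ *-cong s≈ ∼-refl ⟩
      i · y · (- (i · y′))        ≈⟨ solve 3 (λ i y y′ → i :* y :* (:- (i :* y′)) :=
                                       :- (i :* i) :* (y :* y′)) ∼-refl i y y′ ⟩
      (- (i · i)) · (y · y′)      ≈⟨ *-cong (-‿cong ii) yy ⟩
      (- (- 1#)) · 1#             ≈⟨ solve 1 (λ o → (:- (:- o)) :* o := o :* o) ∼-refl 1# ⟩
      1# · 1#                     ≈⟨ *-identityʳ 1# ⟩
      1#                          ∎

    -- m² - s² = m² + y² for s = iy
    difference-inverse : ∀ {i s y m M S p} → (i · i) ∼ (- 1#) → s ∼ (i · y) → M ∼ (m · m) → S ∼ (s · s) →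
                         (p · (m · m ⊕ y · y)) ∼ 1# → ((M ⊖ S) · p) ∼ 1#
    difference-inverse {i} {s} {y} {m} {M} {S} {p} ii s≈ M≈ S≈ h = begin
      (M ⊖ S) · p                                   ≈⟨ *-cong (∼-trans (minus M S) (+-cong M≈ (-‿cong
                                                         (∼-trans S≈ (*-cong s≈ s≈))))) ∼-refl ⟩
      (m · m ⊕ (- (i · y · (i · y)))) · p           ≈⟨ solve 4 (λ i m y p →
        (m :* m :+ (:- (i :* y :* (i :* y)))) :* p := (m :* m :+ (:- (i :* i)) :* (y :* y)) :* p) ∼-refl i m y p ⟩
      (m · m ⊕ (- (i · i)) · (y · y)) · p           ≈⟨ *-cong (+-cong ∼-refl (*-cong (-‿cong
                                                         (∼-trans ii (-‿cong (∼-sym 1-homo)))) ∼-refl)) ∼-refl ⟩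
      (m · m ⊕ (- (- ⟦ 1ℚ ⟧)) · (y · y)) · p        ≈⟨ solve 3 (λ m y p →
        (m :* m :+ (:- (:- con 1ℚ)) :* (y :* y)) :* p := p :* (m :* m :+ y :* y)) ∼-refl m y p ⟩
      p · (m · m ⊕ y · y)                           ≈⟨ h ⟩
      1#                                            ∎

    -- Splits bp into b/m², a term of a series known to be dominated, and the weight m²p, which
    -- stays bounded when p is at most 1/m².
    weighted-term : ∀ {b u U m p} → U ∼ (u · u) → (u · m) ∼ 1# → (b · U · (m · m · p)) ∼ (b · p)
    weighted-term {b} {u} {U} {m} {p} U≈ um = begin
      b · U · (m · m · p)              ≈⟨ *-cong (*-cong ∼-refl U≈) ∼-refl ⟩
      b · (u · u) · (m · m · p)        ≈⟨ solve 4 (λ b u m p →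
        b :* (u :* u) :* (m :* m :* p) := b :* p :* (u :* m :* (u :* m))) ∼-refl b u m p ⟩
      b · p · (u · m · (u · m))        ≈⟨ *-cong ∼-refl (∼-trans (*-cong um um) (*-identityʳ 1#)) ⟩
      b · p · 1#                       ≈⟨ *-identityʳ _ ⟩
      b · p                            ∎

    -- The outer i of coth meets exactly one i in each summand, from 1/s = -i/y and from s = iy. As
    -- i² = -1, both signs come out positive.
    coth-value : ∀ {i b q s y y′ t v p} → (i · i) ∼ (- 1#) → s ∼ (i · y) → q ∼ (b · (- (i · y′))) →
                 (i · ((q ⊖ t · s · v) · p)) ∼ (p · (b · y′ ⊕ t · y · v))
    coth-value {i} {b} {q} {s} {y} {y′} {t} {v} {p} ii s≈ q≈ = begin
      i · ((q ⊖ t · s · v) · p)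
        ≈⟨ *-cong ∼-refl (*-cong (∼-trans (minus _ _) (+-cong q≈ (-‿cong (*-cong (*-cong ∼-refl s≈) ∼-refl)))) ∼-refl) ⟩
      i · ((b · (- (i · y′)) ⊕ (- (t · (i · y) · v))) · p)
        ≈⟨ solve 7 (λ i b y y′ t v p →
             i :* ((b :* (:- (i :* y′)) :+ (:- (t :* (i :* y) :* v))) :* p) :=
             (:- (i :* i)) :* (p :* (b :* y′ :+ t :* y :* v))) ∼-refl i b y y′ t v p ⟩
      (- (i · i)) · (p · (b · y′ ⊕ t · y · v))
        ≈⟨ *-cong (-‿cong (∼-trans ii (-‿cong (∼-sym 1-homo)))) ∼-refl ⟩
      (- (- ⟦ 1ℚ ⟧)) · (p · (b · y′ ⊕ t · y · v))
        ≈⟨ solve 1 (λ x → (:- (:- con 1ℚ)) :* x := x) ∼-refl (p · (b · y′ ⊕ t · y · v)) ⟩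
      p · (b · y′ ⊕ t · y · v) ∎

    -- Multiplying by α² replaces the denominator m² + (nβ/α)² by α²m² + β²n², which both series
    -- share up to the roles of n and m.
    cleared-denominator : ∀ {p a a′ b m n} → (a′ · a) ∼ 1# →
      (p · (m · m ⊕ (n · b · a′) · (n · b · a′))) ∼ 1# →
      (p · (a · a · (m · m) ⊕ b · b · (n · n))) ∼ (a · a)
    cleared-denominator {p} {a} {a′} {b} {m} {n} a′a h = begin
      p · (a · a · (m · m) ⊕ b · b · (n · n))
        ≈⟨ *-cong ∼-refl (+-cong ∼-refl (∼-sym (∼-trans (*-cong ∼-refl (∼-trans (*-cong a′a a′a) (*-identityʳ 1#)))
             (*-identityʳ _)))) ⟩
      p · (a · a · (m · m) ⊕ b · b · (n · n) · (a′ · a · (a′ · a)))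
        ≈⟨ solve 6 (λ p a a′ b m n →
             p :* (a :* a :* (m :* m) :+ b :* b :* (n :* n) :* (a′ :* a :* (a′ :* a))) :=
             a :* a :* (p :* (m :* m :+ (n :* b :* a′) :* (n :* b :* a′)))) ∼-refl p a a′ b m n ⟩
      a · a · (p · (m · m ⊕ (n · b · a′) · (n · b · a′)))
        ≈⟨ *-cong ∼-refl h ⟩
      a · a · 1#
        ≈⟨ *-identityʳ _ ⟩
      a · a ∎

    -- Here z, z₁, z₂ are the powers of 1/n with exponents 2k-2, 2k-1, 2k. The 1/y part of coth
    -- contributes a factor 1/n and raises the exponent, the y part contributes n and lowers it.
    split-term : ∀ {c₀ c₂ a c z z₁ z₂ p b₀ u n α α′ β β′ t v} → (u · n) ∼ 1# → z₁ ∼ (u · z) → z₂ ∼ (u · (u · z)) →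
      c ∼ (p · (b₀ · (u · β′ · α) ⊕ t · (n · β · α′) · v)) →
      c₀ ∼ (p · b₀ · β′ · α) → c₂ ∼ (p · t · β · α′) → (a · z₂ · c₀ ⊕ a · z · (v · c₂)) ∼ (a · c · z₁)
    split-term {c₀} {c₂} {a} {c} {z} {z₁} {z₂} {p} {b₀} {u} {n} {α} {α′} {β} {β′} {t} {v} un z₁≈ z₂≈ c≈ c₀≈ c₂≈ = begin
      a · z₂ · c₀ ⊕ a · z · (v · c₂)
        ≈⟨ +-cong (*-cong ∼-refl c₀≈) (*-cong ∼-refl (*-cong ∼-refl c₂≈)) ⟩
      a · z₂ · (p · b₀ · β′ · α) ⊕ a · z · (v · (p · t · β · α′))
        ≈⟨ +-cong (*-cong (*-cong ∼-refl z₂≈) ∼-refl) (∼-sym (∼-trans (*-cong ∼-refl un) (*-identityʳ _))) ⟩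
      a · (u · (u · z)) · (p · b₀ · β′ · α) ⊕ a · z · (v · (p · t · β · α′)) · (u · n)
        ≈⟨ +-cong (solve 7 (λ a u z p b₀ β′ α → a :* (u :* (u :* z)) :* (p :* b₀ :* β′ :* α) :=
             a :* (u :* z) :* (p :* (b₀ :* (u :* β′ :* α)))) ∼-refl a u z p b₀ β′ α)
             (solve 9 (λ a z v p t β α′ u n → a :* z :* (v :* (p :* t :* β :* α′)) :* (u :* n) :=
             a :* (u :* z) :* (p :* (t :* (n :* β :* α′) :* v))) ∼-refl a z v p t β α′ u n) ⟩
      a · (u · z) · (p · (b₀ · (u · β′ · α))) ⊕ a · (u · z) · (p · (t · (n · β · α′) · v))
        ≈⟨ solve 5 (λ a w p x y → a :* w :* (p :* x) :+ a :* w :* (p :* y) := a :* (p :* (x :+ y)) :* w) ∼-refl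
             a (u · z) p (b₀ · (u · β′ · α)) (t · (n · β · α′) · v) ⟩
      a · (p · (b₀ · (u · β′ · α) ⊕ t · (n · β · α′) · v)) · (u · z)
        ≈⟨ *-cong (*-cong ∼-refl (∼-sym c≈)) (∼-sym z₁≈) ⟩
      a · c · z₁ ∎

    -- The prefactor α²ᵏ⁻¹βπ cancels the 1/π of both coefficients, the 1/β of `c₀` and the 1/α of
    -- `c₂`.
    cleared-coefficients : ∀ {c₀ c₂ αo αj αk α α′ β β′ π p b₀ t S T} →
      αj ∼ (α · αo) → αk ∼ (α · (α · αo)) → (p · π) ∼ 1# → (α′ · α) ∼ 1# → (β′ · β) ∼ 1# →
      c₀ ∼ (p · b₀ · β′ · α) → c₂ ∼ (p · t · β · α′) → (αj · β · π · (c₀ · S ⊕ c₂ · T)) ∼ (b₀ · αk · S ⊕ t · β · β · αo · T)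
    cleared-coefficients {c₀} {c₂} {αo} {αj} {αk} {α} {α′} {β} {β′} {π} {p} {b₀} {t} {S} {T}
      αj≈ αk≈ pπ α′α β′β c₀≈ c₂≈ = begin
      αj · β · π · (c₀ · S ⊕ c₂ · T)
        ≈⟨ *-cong ∼-refl (+-cong (*-cong c₀≈ ∼-refl) (*-cong c₂≈ ∼-refl)) ⟩
      αj · β · π · ((p · b₀ · β′ · α) · S ⊕ (p · t · β · α′) · T)
        ≈⟨ *-cong (*-cong (*-cong αj≈ ∼-refl) ∼-refl) ∼-refl ⟩
      α · αo · β · π · ((p · b₀ · β′ · α) · S ⊕ (p · t · β · α′) · T)
        ≈⟨ solve 4 (λ w π x y → w :* π :* (x :+ y) := w :* π :* x :+ w :* π :* y) ∼-refl
             (α · αo · β) π ((p · b₀ · β′ · α) · S) ((p · t · β · α′) · T) ⟩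
      α · αo · β · π · ((p · b₀ · β′ · α) · S) ⊕ α · αo · β · π · ((p · t · β · α′) · T)
        ≈⟨ +-cong
             (solve 8 (λ α αo β π p b₀ β′ S → α :* αo :* β :* π :* ((p :* b₀ :* β′ :* α) :* S) :=
                b₀ :* (α :* (α :* αo)) :* S :* (p :* π :* (β′ :* β))) ∼-refl α αo β π p b₀ β′ S)
             (solve 8 (λ α αo β π p t α′ T → α :* αo :* β :* π :* ((p :* t :* β :* α′) :* T) :=
                t :* β :* β :* αo :* T :* (p :* π :* (α′ :* α))) ∼-refl α αo β π p t α′ T) ⟩
      b₀ · (α · (α · αo)) · S · (p · π · (β′ · β)) ⊕ t · β · β · αo · T · (p · π · (α′ · α))
        ≈⟨ +-cong (∼-trans (*-cong (*-cong (*-cong ∼-refl (∼-sym αk≈)) ∼-refl) (∼-trans (*-cong pπ β′β) (*-identityʳ 1#))) (*-identityʳ _))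
                  (∼-trans (*-cong ∼-refl (∼-trans (*-cong pπ α′α) (*-identityʳ 1#))) (*-identityʳ _)) ⟩
      b₀ · αk · S ⊕ t · β · β · αo · T ∎

    -- With E = α²m² + β²n², X = α²/n² and Y = β²/m² we have P = α²/E, Q = β²/E and
    -- X + Y = E/(nm)², so that the factor X + Y of Xᴷ - (-Y)ᴷ cancels E.
    paired-term : ∀ {α β m n u v P Q αo βo z z′ Xᴷ Zᴷ X Z Y T ε σ a b t} →
      (u · n) ∼ 1# → (v · m) ∼ 1# →
      (P · (α · α · (m · m) ⊕ β · β · (n · n))) ∼ (α · α) →
      (Q · (β · β · (n · n) ⊕ α · α · (m · m))) ∼ (β · β) →
      (αo · z) ∼ Xᴷ → (σ · (βo · z′)) ∼ (ε · Zᴷ) → ε ∼ (- 1#) → X ∼ (α · α · (u · u)) → Y ∼ (β · β · (v · v)) → Z ∼ (ε · Y) →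
      ((X ⊖ Z) · T) ∼ (Xᴷ ⊖ Zᴷ) →
      (t · β · β · αo · (a · z · (b · P)) ⊕ σ · (t · α · α · βo · (b · z′ · (a · Q)))) ∼
      ((- t) · (a · b · (X · Z · T)))
    paired-term {α} {β} {m} {n} {u} {v} {P} {Q} {αo} {βo} {z} {z′} {Xᴷ} {Zᴷ} {X} {Z} {Y} {T} {ε} {σ} {a} {b} {t}
      un vm PE QE αz σβz ε≈ X≈ Y≈ Z≈ geometric = begin
      t · β · β · αo · (a · z · (b · P)) ⊕ σ · (t · α · α · βo · (b · z′ · (a · Q)))
        ≈⟨ +-cong
             (solve 7 (λ t β αo a z b P → t :* β :* β :* αo :* (a :* z :* (b :* P)) :=
                t :* (a :* b) :* (P :* (β :* β)) :* (αo :* z)) ∼-refl t β αo a z b P)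
             (solve 8 (λ σ t α βo b z′ a Q → σ :* (t :* α :* α :* βo :* (b :* z′ :* (a :* Q))) :=
                t :* (a :* b) :* (Q :* (α :* α)) :* (σ :* (βo :* z′))) ∼-refl σ t α βo b z′ a Q) ⟩
      c · (P · (β · β)) · (αo · z) ⊕ c · (Q · (α · α)) · (σ · (βo · z′))
        ≈⟨ +-cong (*-cong ∼-refl αz) (*-cong (*-cong ∼-refl (∼-sym Pβ≈Qα))
             (∼-trans σβz (*-cong ε≈con ∼-refl))) ⟩
      c · (P · (β · β)) · Xᴷ ⊕ c · (P · (β · β)) · ((- ⟦ 1ℚ ⟧) · Zᴷ)
        ≈⟨ solve 3 (λ w x z → w :* x :+ w :* ((:- con 1ℚ) :* z) := w :* (x :+ (:- z))) ∼-refl (c · (P · (β · β))) Xᴷ Zᴷ ⟩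
      c · (P · (β · β)) · (Xᴷ ⊕ (- Zᴷ))
        ≈⟨ *-cong ∼-refl (∼-trans (∼-sym (minus Xᴷ Zᴷ)) (∼-sym geometric)) ⟩
      c · (P · (β · β)) · ((X ⊖ Z) · T)
        ≈⟨ *-cong ∼-refl (*-cong (∼-trans (minus X Z) (+-cong ∼-refl (-‿cong Z≈′))) ∼-refl) ⟩
      c · (P · (β · β)) · ((X ⊕ (- ((- ⟦ 1ℚ ⟧) · (β · β · (v · v))))) · T)
        ≈⟨ solve 6 (λ c P β X v T → c :* (P :* (β :* β)) :* ((X :+ (:- ((:- con 1ℚ) :* (β :* β :* (v :* v))))) :* T) :=
             c :* (β :* β) :* T :* (P :* (X :+ β :* β :* (v :* v)))) ∼-refl c P β X v T ⟩
      c · (β · β) · T · (P · (X ⊕ β · β · (v · v)))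
        ≈⟨ *-cong ∼-refl P*[X+Y] ⟩
      c · (β · β) · T · (X · (v · v))
        ≈⟨ solve 6 (λ t d β T X v → t :* d :* (β :* β) :* T :* (X :* (v :* v)) :=
             (:- t) :* (d :* (X :* ((:- con 1ℚ) :* (β :* β :* (v :* v))) :* T))) ∼-refl t (a · b) β T X v ⟩
      (- t) · (a · b · (X · ((- ⟦ 1ℚ ⟧) · (β · β · (v · v))) · T))
        ≈⟨ *-cong ∼-refl (*-cong ∼-refl (*-cong (*-cong ∼-refl (∼-sym Z≈′)) ∼-refl)) ⟩
      (- t) · (a · b · (X · Z · T)) ∎
      where
      c : C
      c = t · (a · b)
      ε≈con : ε ∼ (- ⟦ 1ℚ ⟧)
      ε≈con = ∼-trans ε≈ (-‿cong (∼-sym 1-homo))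
      Z≈′ : Z ∼ ((- ⟦ 1ℚ ⟧) · (β · β · (v · v)))
      Z≈′ = ∼-trans Z≈ (*-cong ε≈con Y≈)
      -- Both sides are α²β²/E. Multiplying each kernel by the equation of the other compares them
      -- without dividing by E.
      Pβ≈Qα : (P · (β · β)) ∼ (Q · (α · α))
      Pβ≈Qα = begin
        P · (β · β)                                           ≈⟨ *-cong ∼-refl (∼-sym QE) ⟩
        P · (Q · (β · β · (n · n) ⊕ α · α · (m · m)))         ≈⟨ solve 6 (λ P Q α β m n →
          P :* (Q :* (β :* β :* (n :* n) :+ α :* α :* (m :* m))) :=
          Q :* (P :* (α :* α :* (m :* m) :+ β :* β :* (n :* n)))) ∼-refl P Q α β m n ⟩
        Q · (P · (α · α · (m · m) ⊕ β · β · (n · n)))         ≈⟨ *-cong ∼-refl PE ⟩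
        Q · (α · α)                                           ∎
      -- Inserting (vm)² = 1 and (un)² = 1 exhibits X + Y as u²v²E, and PE = α² removes E.
      P*[X+Y] : (P · (X ⊕ β · β · (v · v))) ∼ (X · (v · v))
      P*[X+Y] = begin
        P · (X ⊕ β · β · (v · v))
          ≈⟨ *-cong ∼-refl (+-cong X≈ ∼-refl) ⟩
        P · (α · α · (u · u) ⊕ β · β · (v · v))
          ≈⟨ *-cong ∼-refl (+-cong
               (∼-sym (∼-trans (*-cong ∼-refl (∼-trans (*-cong vm vm) (*-identityʳ 1#))) (*-identityʳ _)))
               (∼-sym (∼-trans (*-cong ∼-refl (∼-trans (*-cong un un) (*-identityʳ 1#))) (*-identityʳ _)))) ⟩
        P · (α · α · (u · u) · (v · m · (v · m)) ⊕ β · β · (v · v) · (u · n · (u · n)))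
          ≈⟨ solve 7 (λ P α u v m β n →
               P :* (α :* α :* (u :* u) :* (v :* m :* (v :* m)) :+ β :* β :* (v :* v) :* (u :* n :* (u :* n))) :=
               u :* u :* (v :* v) :* (P :* (α :* α :* (m :* m) :+ β :* β :* (n :* n)))) ∼-refl P α u v m β n ⟩
        u · u · (v · v) · (P · (α · α · (m · m) ⊕ β · β · (n · n)))
          ≈⟨ *-cong ∼-refl PE ⟩
        u · u · (v · v) · (α · α)
          ≈⟨ solve 3 (λ α u v → u :* u :* (v :* v) :* (α :* α) := α :* α :* (u :* u) :* (v :* v)) ∼-refl α u v ⟩
        α · α · (u · u) · (v · v)
          ≈⟨ *-cong (∼-sym X≈) ∼-refl ⟩
        X · (v · v) ∎

    perturbed : ∀ {b k t t′} → (b ⊕ k · t′ ⊖ k · (t′ ⊖ t)) ∼ (b ⊕ k · t)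
    perturbed {b} {k} {t} {t′} = ∼-trans
      (∼-trans (minus _ _) (+-cong ∼-refl (-‿cong (*-cong ∼-refl (minus t′ t)))))
      (solve 4 (λ b k t t′ → b :+ k :* t′ :+ (:- (k :* (t′ :+ (:- t)))) := b :+ k :* t) ∼-refl b k t t′)

    minus-zero : ∀ {x k} → (x ⊖ k · 0#) ∼ x
    minus-zero {x} {k} = ∼-trans (∼-trans (minus _ _) (+-cong ∼-refl (-‿cong (*-cong ∼-refl (∼-sym 0-homo)))))
      (solve 2 (λ x k → x :+ (:- (k :* con 0ℚ)) := x) ∼-refl x k)

    *-distrib-⊖ : ∀ {c x y} → (c · x ⊖ c · y) ∼ (c · (x ⊖ y))
    *-distrib-⊖ {c} {x} {y} = ∼-trans (minus _ _) (∼-trans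
      (solve 3 (λ c x y → c :* x :+ (:- (c :* y)) := c :* (x :+ (:- y))) ∼-refl c x y)
      (*-cong ∼-refl (∼-sym (minus x y))))

    reassociate₅ : ∀ {σ x y z s} → (σ · (x · y · z · s)) ∼ (σ · x · y · z · s)
    reassociate₅ {σ} {x} {y} {z} {s} =
      solve 5 (λ σ x y z s → σ :* (x :* y :* z :* s) := σ :* x :* y :* z :* s) ∼-refl σ x y z s

    paired-powers : ∀ {ε α β a b z w X Z} → (α · z) ∼ X → (ε · (β · w)) ∼ Z →
                    (ε · α · β · (a · z · (b · w))) ∼ (a · b · (X · Z))
    paired-powers {ε} {α} {β} {a} {b} {z} {w} {X} {Z} αz≈ εβw≈ = ∼-trans
      (solve 7 (λ ε α β a b z w → ε :* α :* β :* (a :* z :* (b :* w)) :=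
        a :* b :* (α :* z :* (ε :* (β :* w)))) ∼-refl ε α β a b z w)
      (*-cong ∼-refl (*-cong αz≈ εβw≈))

    regroup-powers : ∀ {X Z x z} → (X · x · (Z · z)) ∼ (X · Z · (x · z))
    regroup-powers {X} {Z} {x} {z} =
      solve 4 (λ X Z x z → X :* x :* (Z :* z) := X :* Z :* (x :* z)) ∼-refl X Z x z

    -- If T is the sum of XⁱZˡ⁻ⁱ over i ≤ l, the next such sum is ZT + Xˡ⁺¹; the mixed terms Zx
    -- cancel.
    geometric-step : ∀ {X Z T T′ x z} → ((X ⊖ Z) · T) ∼ (x ⊖ z) → T′ ∼ (Z · T ⊕ x · 1#) →
                     ((X ⊖ Z) · T′) ∼ (X · x ⊖ Z · z)
    geometric-step {X} {Z} {T} {T′} {x} {z} ih T′≈ = begin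
      (X ⊖ Z) · T′
        ≈⟨ *-cong (minus X Z) (∼-trans T′≈ (+-cong ∼-refl (*-identityʳ x))) ⟩
      (X ⊕ (- Z)) · (Z · T ⊕ x)
        ≈⟨ solve 4 (λ X Z T x → (X :+ (:- Z)) :* (Z :* T :+ x) :=
             Z :* ((X :+ (:- Z)) :* T) :+ (X :+ (:- Z)) :* x) ∼-refl X Z T x ⟩
      Z · ((X ⊕ (- Z)) · T) ⊕ (X ⊕ (- Z)) · x
        ≈⟨ +-cong (*-cong ∼-refl (∼-trans (*-cong (∼-sym (minus X Z)) ∼-refl) (∼-trans ih (minus x z)))) ∼-refl ⟩
      Z · (x ⊕ (- z)) ⊕ (X ⊕ (- Z)) · x
        ≈⟨ solve 4 (λ X Z x z → Z :* (x :+ (:- z)) :+ (X :+ (:- Z)) :* x := X :* x :+ (:- (Z :* z))) ∼-refl X Z x z ⟩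
      X · x ⊕ (- (Z · z))
        ≈⟨ ∼-sym (minus _ _) ⟩
      X · x ⊖ Z · z ∎

    geometric-zero : ∀ {X Z} → ((X ⊖ Z) · (0# ⊕ 1# · 1#)) ∼ (X · 1# ⊖ Z · 1#)
    geometric-zero {X} {Z} = begin
      (X ⊖ Z) · (0# ⊕ 1# · 1#)
        ≈⟨ *-cong ∼-refl (+-cong (∼-sym 0-homo) (*-cong (∼-sym 1-homo) (∼-sym 1-homo))) ⟩
      (X ⊖ Z) · (⟦ 0ℚ ⟧ ⊕ ⟦ 1ℚ ⟧ · ⟦ 1ℚ ⟧)
        ≈⟨ solve 1 (λ d → d :* (con 0ℚ :+ con 1ℚ :* con 1ℚ) := d) ∼-refl (X ⊖ Z) ⟩
      X ⊖ Z
        ≈⟨ ∼-trans (minus _ _) (∼-trans (+-cong (∼-sym (*-identityʳ X)) (-‿cong (∼-sym (*-identityʳ Z)))) (∼-sym (minus _ _))) ⟩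
      X · 1# ⊖ Z · 1# ∎

    assembled : ∀ {x σ a₀ βk s k₁ t₁ k₂ t₂ t R} → (k₁ · t₁ ⊕ σ · (k₂ · t₂)) ∼ ((- t) · R) →
                (x ⊕ k₁ · t₁ ⊕ σ · (a₀ · βk · s ⊕ k₂ · t₂)) ∼ (x ⊕ σ · a₀ · βk · s ⊖ t · R)
    assembled {x} {σ} {a₀} {βk} {s} {k₁} {t₁} {k₂} {t₂} {t} {R} h = begin
      x ⊕ k₁ · t₁ ⊕ σ · (a₀ · βk · s ⊕ k₂ · t₂)
        ≈⟨ solve 7 (λ x p σ a₀ βk s q → x :+ p :+ σ :* (a₀ :* βk :* s :+ q) :=
             x :+ σ :* a₀ :* βk :* s :+ (p :+ σ :* q)) ∼-refl x (k₁ · t₁) σ a₀ βk s (k₂ · t₂) ⟩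
      x ⊕ σ · a₀ · βk · s ⊕ (k₁ · t₁ ⊕ σ · (k₂ · t₂))
        ≈⟨ +-cong ∼-refl h ⟩
      x ⊕ σ · a₀ · βk · s ⊕ (- t) · R
        ≈⟨ +-cong ∼-refl (solve 2 (λ t R → (:- t) :* R := :- (t :* R)) ∼-refl t R) ⟩
      x ⊕ σ · a₀ · βk · s ⊕ (- (t · R))
        ≈⟨ ∼-sym (minus _ _) ⟩
      x ⊕ σ · a₀ · βk · s ⊖ t · R ∎

-- Bounds for complex numbers

0<½ : 0ℚ ℚ.< ½
0<½ = ℚP.positive⁻¹ ½

0<1 : 0ℚ ℚ.< 1ℚ
0<1 = ℚP.positive⁻¹ 1ℚ

abstract
  -- Reduces an inequality to a nonnegative difference and an equation, which is mostly left to the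
  -- ring solver.
  ≤-diff : ∀ {p q} d → 0ℚ ℚ.≤ d → p ℚ.+ d ≡ q → p ℚ.≤ q
  ≤-diff {p} d 0≤d refl =
    subst (ℚ._≤ p ℚ.+ d) (ℚP.+-identityʳ p) (ℚP.+-monoʳ-≤ p 0≤d)

  *-pos : ∀ {p q} → 0ℚ ℚ.< p → 0ℚ ℚ.< q → 0ℚ ℚ.< p ℚ.* q
  *-pos {p} {q} 0<p 0<q =
    subst (ℚ._< p ℚ.* q) (ℚP.*-zeroʳ p) (ℚP.*-monoʳ-<-pos p {{ℚ.positive 0<p}} 0<q)

  *-nonNeg : ∀ {p q} → 0ℚ ℚ.≤ p → 0ℚ ℚ.≤ q → 0ℚ ℚ.≤ p ℚ.* q
  *-nonNeg {p} {q} 0≤p 0≤q =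
    subst (ℚ._≤ p ℚ.* q) (ℚP.*-zeroʳ p) (ℚP.*-monoˡ-≤-nonNeg p {{ℚ.nonNegative 0≤p}} 0≤q)

  *-mono-≤ : ∀ {p q r s} → 0ℚ ℚ.≤ p → 0ℚ ℚ.≤ r → p ℚ.≤ q → r ℚ.≤ s → p ℚ.* r ℚ.≤ q ℚ.* s
  *-mono-≤ {q = q} {r = r} 0≤p 0≤r p≤q r≤s = ℚP.≤-trans
    (ℚP.*-monoʳ-≤-nonNeg r {{ℚ.nonNegative 0≤r}} p≤q)
    (ℚP.*-monoˡ-≤-nonNeg q {{ℚ.nonNegative (ℚP.≤-trans 0≤p p≤q)}} r≤s)

  +-nonNeg : ∀ {p q} → 0ℚ ℚ.≤ p → 0ℚ ℚ.≤ q → 0ℚ ℚ.≤ p ℚ.+ q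
  +-nonNeg = ℚP.+-mono-≤ {0ℚ} {_} {0ℚ}

  diff-nonNeg : ∀ {p q} → p ℚ.≤ q → 0ℚ ℚ.≤ q ℚ.- p
  diff-nonNeg {p} {q} p≤q =
    subst (ℚ._≤ q ℚ.- p) (ℚP.+-inverseʳ p) (ℚP.+-monoˡ-≤ (ℚ.- p) p≤q)

  ½-double : ∀ p → ½ ℚ.* p ℚ.+ ½ ℚ.* p ≡ p
  ½-double p = trans (sym (ℚP.*-distribʳ-+ p ½ ½)) (ℚP.*-identityˡ p)

  pos⇒≢0 : ∀ {p} → 0ℚ ℚ.< p → p ≢ 0ℚ
  pos⇒≢0 0<p refl = ℚP.<-irrefl refl 0<p

  ≤-limit : ∀ {p q} → (∀ ε → 0ℚ ℚ.< ε → p ℚ.≤ q ℚ.+ ε) → p ℚ.≤ q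
  ≤-limit {p} {q} h with p ℚP.≤? q
  ... | yes p≤q = p≤q
  ... | no  p≰q =
    let r , q<r , r<p = ℚP.<-dense (ℚP.≰⇒> p≰q)
        0<r-q = subst (ℚ._< r ℚ.- q) (ℚP.+-inverseʳ q) (ℚP.+-monoˡ-< (ℚ.- q) q<r)
    in contradiction (ℚP.≤-<-trans (subst (p ℚ.≤_) (eq q r) (h (r ℚ.- q) 0<r-q)) r<p)
                     (ℚP.<-irrefl refl)
    where
    open +-*-Solver
    eq : ∀ q r → q ℚ.+ (r ℚ.- q) ≡ r
    eq = solve 2 (λ q r → q :+ (r :- q) := r) refl

Eventually : (ℕ → Set) → Set
Eventually P = ∃[ N ] ∀ n → N ℕ.≤ n → P n

eventually-map : ∀ {P Q : ℕ → Set} → (∀ n → P n → Q n) → Eventually P → Eventually Q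
eventually-map f (N , h) = N , λ n N≤n → f n (h n N≤n)

eventually-map₂ : ∀ {P Q R : ℕ → Set} → (∀ n → P n → Q n → R n) →
                  Eventually P → Eventually Q → Eventually R
eventually-map₂ f (M , g) (N , h) = M ℕ.⊔ N , λ n p →
  f n (g n (ℕP.m⊔n≤o⇒m≤o M N p)) (h n (ℕP.m⊔n≤o⇒n≤o M N p))

Eventually⇒≤ : ∀ {p q} → Eventually (λ _ → p ℚ.≤ q) → p ℚ.≤ q
Eventually⇒≤ (N , h) = h N ℕP.≤-refl

-- The sum norm is rational on approximants, submultiplicative and within a factor √2 of the
-- absolute value, so no square roots arise.
size : ℂ → ℕ → ℚ
size z n = ℚ.∣ approx (re z) n ∣ ℚ.+ ℚ.∣ approx (im z) n ∣

infix 4 ∥_∥≤_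

-- |re z| + |im z| ≤ q
record ∥_∥≤_ (z : ℂ) (q : ℚ) : Set where
  constructor mk∥∥
  field
    bound : ∀ ε → 0ℚ ℚ.< ε → Eventually λ n → size z n ℚ.≤ q ℚ.+ ε

open ∥_∥≤_

infix 8 -ᶜ_

-ᶜ_ : ℂ → ℂ
-ᶜ z = (-ᴿ re z) +i (-ᴿ im z)

abstract
  size-nonNeg : ∀ z n → 0ℚ ℚ.≤ size z n
  size-nonNeg z n = +-nonNeg (ℚP.0≤∣p∣ (approx (re z) n)) (ℚP.0≤∣p∣ (approx (im z) n))

  size-+ : ∀ z w n → size (z + w) n ℚ.≤ size z n ℚ.+ size w n
  size-+ z w n = ℚP.≤-trans
    (ℚP.+-mono-≤ (ℚP.∣p+q∣≤∣p∣+∣q∣ a c) (ℚP.∣p+q∣≤∣p∣+∣q∣ b d))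
    (ℚP.≤-reflexive (eq ℚ.∣ a ∣ ℚ.∣ b ∣ ℚ.∣ c ∣ ℚ.∣ d ∣))
    where
    open +-*-Solver
    a b c d : ℚ
    a = approx (re z) n
    b = approx (im z) n
    c = approx (re w) n
    d = approx (im w) n
    eq : ∀ a b c d → a ℚ.+ c ℚ.+ (b ℚ.+ d) ≡ a ℚ.+ b ℚ.+ (c ℚ.+ d)
    eq = solve 4 (λ a b c d → a :+ c :+ (b :+ d) := a :+ b :+ (c :+ d)) refl

  size-* : ∀ z w n → size (z * w) n ℚ.≤ size z n ℚ.* size w n
  size-* z w n = ℚP.≤-trans
    (ℚP.+-mono-≤
      (ℚP.≤-trans (ℚP.∣p-q∣≤∣p∣+∣q∣ (a ℚ.* c) (b ℚ.* d))
        (ℚP.≤-reflexive (cong₂ ℚ._+_ (ℚP.∣p*q∣≡∣p∣*∣q∣ a c) (ℚP.∣p*q∣≡∣p∣*∣q∣ b d))))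
      (ℚP.≤-trans (ℚP.∣p+q∣≤∣p∣+∣q∣ (a ℚ.* d) (b ℚ.* c))
        (ℚP.≤-reflexive (cong₂ ℚ._+_ (ℚP.∣p*q∣≡∣p∣*∣q∣ a d) (ℚP.∣p*q∣≡∣p∣*∣q∣ b c)))))
    (ℚP.≤-reflexive (eq ℚ.∣ a ∣ ℚ.∣ b ∣ ℚ.∣ c ∣ ℚ.∣ d ∣))
    where
    open +-*-Solver
    a b c d : ℚ
    a = approx (re z) n
    b = approx (im z) n
    c = approx (re w) n
    d = approx (im w) n
    eq : ∀ a b c d → a ℚ.* c ℚ.+ b ℚ.* d ℚ.+ (a ℚ.* d ℚ.+ b ℚ.* c) ≡ (a ℚ.+ b) ℚ.* (c ℚ.+ d)
    eq = solve 4 (λ a b c d → a :* c :+ b :* d :+ (a :* d :+ b :* c) := (a :+ b) :* (c :+ d)) refl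

  size-neg : ∀ z n → size (-ᶜ z) n ≡ size z n
  size-neg z n = cong₂ ℚ._+_ (ℚP.∣-p∣≡∣p∣ (approx (re z) n)) (ℚP.∣-p∣≡∣p∣ (approx (im z) n))

  ∥∥-nonNeg : ∀ {z p} → ∥ z ∥≤ p → 0ℚ ℚ.≤ p
  ∥∥-nonNeg {z} b = ≤-limit λ ε 0<ε → Eventually⇒≤
    (eventually-map (λ n → ℚP.≤-trans (size-nonNeg z n)) (bound b ε 0<ε))

  ∥∥-mono : ∀ {z p q} → p ℚ.≤ q → ∥ z ∥≤ p → ∥ z ∥≤ q
  ∥∥-mono p≤q b = mk∥∥ λ ε 0<ε →
    eventually-map (λ n h → ℚP.≤-trans h (ℚP.+-monoˡ-≤ ε p≤q)) (bound b ε 0<ε)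

  ∥∥-neg : ∀ {z p} → ∥ z ∥≤ p → ∥ -ᶜ z ∥≤ p
  ∥∥-neg {z} {p} b = mk∥∥ λ ε 0<ε →
    eventually-map (λ n → subst (ℚ._≤ p ℚ.+ ε) (sym (size-neg z n))) (bound b ε 0<ε)

  ∥∥-+ : ∀ {z w p q} → ∥ z ∥≤ p → ∥ w ∥≤ q → ∥ z + w ∥≤ p ℚ.+ q
  ∥∥-+ {z} {w} {p} {q} b c = mk∥∥ λ ε 0<ε →
    let 0<½ε = *-pos 0<½ 0<ε in
    eventually-map₂
      (λ n h k → ℚP.≤-trans (size-+ z w n) (ℚP.≤-trans (ℚP.+-mono-≤ h k)
        (ℚP.≤-reflexive (trans (eq p q (½ ℚ.* ε)) (cong (p ℚ.+ q ℚ.+_) (½-double ε))))))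
      (bound b (½ ℚ.* ε) 0<½ε) (bound c (½ ℚ.* ε) 0<½ε)
    where
    open +-*-Solver
    eq : ∀ p q e → p ℚ.+ e ℚ.+ (q ℚ.+ e) ≡ p ℚ.+ q ℚ.+ (e ℚ.+ e)
    eq = solve 3 (λ p q e → p :+ e :+ (q :+ e) := p :+ q :+ (e :+ e)) refl

  -- e = ε / (p + q + 1 + ε), which is at most 1
  ∃-slack : ∀ {p q ε} → 0ℚ ℚ.≤ p → 0ℚ ℚ.≤ q → 0ℚ ℚ.< ε →
            ∃[ e ] 0ℚ ℚ.< e × e ℚ.* e ℚ.+ (p ℚ.* e ℚ.+ e ℚ.* q) ℚ.≤ ε
  ∃-slack {p} {q} {ε} 0≤p 0≤q 0<ε = e , 0<e ,
    ≤-diff (e ℚ.* (1ℚ ℚ.- e ℚ.+ ε))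
      (*-nonNeg (ℚP.<⇒≤ 0<e) (+-nonNeg 0≤1-e (ℚP.<⇒≤ 0<ε)))
      (trans (eq₂ p q (inv s) ε) (trans (cong (ℚ._* ε) i*s) (ℚP.*-identityˡ ε)))
    where
    open +-*-Solver
    s e : ℚ
    s = p ℚ.+ q ℚ.+ 1ℚ ℚ.+ ε
    e = inv s ℚ.* ε
    0≤p+q+1 : 0ℚ ℚ.≤ p ℚ.+ q ℚ.+ 1ℚ
    0≤p+q+1 = +-nonNeg (+-nonNeg 0≤p 0≤q) (ℚP.<⇒≤ 0<1)
    0<s : 0ℚ ℚ.< s
    0<s = ℚP.+-mono-≤-< {0ℚ} {p ℚ.+ q ℚ.+ 1ℚ} {0ℚ} 0≤p+q+1 0<ε
    0<e : 0ℚ ℚ.< e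
    0<e = *-pos (inv-pos 0<s) 0<ε
    i*s : inv s ℚ.* s ≡ 1ℚ
    i*s = inv-inverse s (pos⇒≢0 0<s)
    eq₁ : ∀ i p q ε → i ℚ.* (p ℚ.+ q ℚ.+ 1ℚ) ≡ i ℚ.* (p ℚ.+ q ℚ.+ 1ℚ ℚ.+ ε) ℚ.- i ℚ.* ε
    eq₁ = solve 4 (λ i p q ε → i :* (p :+ q :+ con 1ℚ) :=
      i :* (p :+ q :+ con 1ℚ :+ ε) :- i :* ε) refl
    eq₂ : ∀ p q i ε →
      (i ℚ.* ε) ℚ.* (i ℚ.* ε) ℚ.+ (p ℚ.* (i ℚ.* ε) ℚ.+ (i ℚ.* ε) ℚ.* q) ℚ.+
        (i ℚ.* ε) ℚ.* (1ℚ ℚ.- i ℚ.* ε ℚ.+ ε) ≡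
      i ℚ.* (p ℚ.+ q ℚ.+ 1ℚ ℚ.+ ε) ℚ.* ε
    eq₂ = solve 4 (λ p q i ε →
      (i :* ε) :* (i :* ε) :+ (p :* (i :* ε) :+ (i :* ε) :* q) :+
        (i :* ε) :* (con 1ℚ :- i :* ε :+ ε) :=
      i :* (p :+ q :+ con 1ℚ :+ ε) :* ε) refl
    0≤1-e : 0ℚ ℚ.≤ 1ℚ ℚ.- e
    0≤1-e = subst (0ℚ ℚ.≤_) (trans (eq₁ (inv s) p q ε) (cong (ℚ._- e) i*s))
      (*-nonNeg (ℚP.<⇒≤ (inv-pos 0<s)) 0≤p+q+1)

  ∥∥-* : ∀ {z w p q} → ∥ z ∥≤ p → ∥ w ∥≤ q → ∥ z * w ∥≤ p ℚ.* q
  ∥∥-* {z} {w} {p} {q} b c = mk∥∥ λ ε 0<ε →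
    let e , 0<e , small = ∃-slack (∥∥-nonNeg b) (∥∥-nonNeg c) 0<ε in
    eventually-map₂
      (λ n h k → ℚP.≤-trans (size-* z w n)
        (ℚP.≤-trans (*-mono-≤ (size-nonNeg z n) (size-nonNeg w n) h k)
        (ℚP.≤-trans (ℚP.≤-reflexive (eq p q e)) (ℚP.+-monoʳ-≤ (p ℚ.* q) small))))
      (bound b e 0<e) (bound c e 0<e)
    where
    open +-*-Solver
    eq : ∀ p q e → (p ℚ.+ e) ℚ.* (q ℚ.+ e) ≡ p ℚ.* q ℚ.+ (e ℚ.* e ℚ.+ (p ℚ.* e ℚ.+ e ℚ.* q))
    eq = solve 3 (λ p q e →
      (p :+ e) :* (q :+ e) := p :* q :+ (e :* e :+ (p :* e :+ e :* q))) refl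

  ∥∥-total : ∀ z → ∃[ q ] ∥ z ∥≤ q
  ∥∥-total z = ℚ.∣ a ∣ ℚ.+ 1ℚ ℚ.+ (ℚ.∣ b ∣ ℚ.+ 1ℚ) , mk∥∥ λ ε 0<ε → eventually-map₂
    (λ n h k → ℚP.≤-trans (ℚP.+-mono-≤ h k) (≤-diff ε (ℚP.<⇒≤ 0<ε) refl))
    (near (re z)) (near (im z))
    where
    open +-*-Solver
    modulus : ∀ x → ∃[ N ] ∀ m n → N ℕ.≤ m → N ℕ.≤ n →
              ℚ.∣ approx x m ℚ.- approx x n ∣ ℚ.≤ 1ℚ
    modulus x = cauchy x 1ℚ 0<1
    a b : ℚ
    a = approx (re z) (proj₁ (modulus (re z)))
    b = approx (im z) (proj₁ (modulus (im z)))
    eq : ∀ a b → b ℚ.+ (a ℚ.- b) ≡ a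
    eq = solve 2 (λ a b → b :+ (a :- b) := a) refl
    near : ∀ x → Eventually λ n → ℚ.∣ approx x n ∣ ℚ.≤ ℚ.∣ approx x (proj₁ (modulus x)) ∣ ℚ.+ 1ℚ
    near x with modulus x
    ... | N , h = N , λ n N≤n → ℚP.≤-trans
      (ℚP.≤-reflexive (cong ℚ.∣_∣ (sym (eq (approx x n) (approx x N)))))
      (ℚP.≤-trans (ℚP.∣p+q∣≤∣p∣+∣q∣ (approx x N) (approx x n ℚ.- approx x N))
        (ℚP.+-monoʳ-≤ ℚ.∣ approx x N ∣ (h n N N≤n ℕP.≤-refl)))

infix 4 _≗_

-- Stronger than `_≈_`. Since the operations act on approximants, the ring laws hold in this sense
-- and reduce to identities in ℚ.
record _≗_ (z w : ℂ) : Set where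
  constructor mk≗
  field
    re≗ : ∀ n → approx (re z) n ≡ approx (re w) n
    im≗ : ∀ n → approx (im z) n ≡ approx (im w) n

abstract
  size-≗ : ∀ {z w} → z ≗ w → ∀ n → size z n ≡ size w n
  size-≗ (mk≗ r i) n = cong₂ (λ a b → ℚ.∣ a ∣ ℚ.+ ℚ.∣ b ∣) (r n) (i n)

  ∥∥-≗ : ∀ {z w q} → z ≗ w → ∥ z ∥≤ q → ∥ w ∥≤ q
  ∥∥-≗ {q = q} e b = mk∥∥ λ ε 0<ε →
    eventually-map (λ n → subst (ℚ._≤ q ℚ.+ ε) (size-≗ e n)) (bound b ε 0<ε)

  ≈⇒∥∥ : ∀ {z w} → z ≈ w → ∥ z - w ∥≤ 0ℚ
  ≈⇒∥∥ z≈w = mk∥∥ λ ε 0<ε →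
    let 0<½ε = *-pos 0<½ 0<ε in
    eventually-map₂
      (λ n h k → ℚP.≤-trans (ℚP.+-mono-≤ h k)
        (ℚP.≤-reflexive (trans (½-double ε) (sym (ℚP.+-identityˡ ε)))))
      (_≈ᴿ_.close (_≈_.re≈ z≈w) (½ ℚ.* ε) 0<½ε)
      (_≈ᴿ_.close (_≈_.im≈ z≈w) (½ ℚ.* ε) 0<½ε)

  ∥∥⇒≈ : ∀ {z w} → ∥ z - w ∥≤ 0ℚ → z ≈ w
  ∥∥⇒≈ {z} {w} b = record
    { re≈ = mk≈ λ ε 0<ε → eventually-map (λ n h → ℚP.≤-trans
        (≤-diff ℚ.∣ approx (im (z - w)) n ∣ (ℚP.0≤∣p∣ (approx (im (z - w)) n)) refl)
        (ℚP.≤-trans h (ℚP.≤-reflexive (ℚP.+-identityˡ ε)))) (bound b ε 0<ε)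
    ; im≈ = mk≈ λ ε 0<ε → eventually-map (λ n h → ℚP.≤-trans
        (≤-diff ℚ.∣ approx (re (z - w)) n ∣ (ℚP.0≤∣p∣ (approx (re (z - w)) n))
          (ℚP.+-comm ℚ.∣ approx (im (z - w)) n ∣ ℚ.∣ approx (re (z - w)) n ∣))
        (ℚP.≤-trans h (ℚP.≤-reflexive (ℚP.+-identityˡ ε)))) (bound b ε 0<ε)
    }

  ∥∥-0 : ∥ 0ᶜ ∥≤ 0ℚ
  ∥∥-0 = mk∥∥ λ ε 0<ε → 0 , λ n _ → ℚP.≤-trans (ℚP.<⇒≤ 0<ε) (ℚP.≤-reflexive (sym (ℚP.+-identityˡ ε)))

  ≗⇒≈ : ∀ {z w} → z ≗ w → z ≈ w
  ≗⇒≈ {z} {w} (mk≗ r i) = ∥∥⇒≈ (∥∥-≗ (mk≗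
    (λ n → sym (trans (cong (ℚ._- approx (re w) n) (r n)) (ℚP.+-inverseʳ (approx (re w) n))))
    (λ n → sym (trans (cong (ℚ._- approx (im w) n) (i n)) (ℚP.+-inverseʳ (approx (im w) n))))) ∥∥-0)

  ≈-refl : ∀ {z} → z ≈ z
  ≈-refl = ≗⇒≈ (mk≗ (λ _ → refl) (λ _ → refl))

  ≈-sym : ∀ {z w} → z ≈ w → w ≈ z
  ≈-sym {z} {w} e = ∥∥⇒≈ (∥∥-≗ (mk≗ (λ n → eq (approx (re z) n) (approx (re w) n))
                                     (λ n → eq (approx (im z) n) (approx (im w) n)))
                                (∥∥-neg (≈⇒∥∥ e)))
    where
    open +-*-Solver
    eq : ∀ a b → ℚ.- (a ℚ.- b) ≡ b ℚ.- a
    eq = solve 2 (λ a b → :- (a :- b) := b :- a) refl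

  ≈-trans : ∀ {z w v} → z ≈ w → w ≈ v → z ≈ v
  ≈-trans {z} {w} {v} e f = ∥∥⇒≈ (∥∥-≗
    (mk≗ (λ n → eq (approx (re z) n) (approx (re w) n) (approx (re v) n))
         (λ n → eq (approx (im z) n) (approx (im w) n) (approx (im v) n)))
    (∥∥-+ (≈⇒∥∥ e) (≈⇒∥∥ f)))
    where
    open +-*-Solver
    eq : ∀ a b c → a ℚ.- b ℚ.+ (b ℚ.- c) ≡ a ℚ.- c
    eq = solve 3 (λ a b c → a :- b :+ (b :- c) := a :- c) refl

  +-cong : ∀ {z w z′ w′} → z ≈ z′ → w ≈ w′ → z + w ≈ z′ + w′
  +-cong {z} {w} {z′} {w′} e f = ∥∥⇒≈ (∥∥-≗
    (mk≗ (λ n → eq (approx (re z) n) (approx (re z′) n) (approx (re w) n) (approx (re w′) n))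
         (λ n → eq (approx (im z) n) (approx (im z′) n) (approx (im w) n) (approx (im w′) n)))
    (∥∥-+ (≈⇒∥∥ e) (≈⇒∥∥ f)))
    where
    open +-*-Solver
    eq : ∀ a b c d → a ℚ.- b ℚ.+ (c ℚ.- d) ≡ a ℚ.+ c ℚ.- (b ℚ.+ d)
    eq = solve 4 (λ a b c d → a :- b :+ (c :- d) := a :+ c :- (b :+ d)) refl

  -- By zw - z′w′ = (z - z′)w + z′(w - w′), with any bounds of w and z′.
  *-cong : ∀ {z w z′ w′} → z ≈ z′ → w ≈ w′ → z * w ≈ z′ * w′
  *-cong {z} {w} {z′} {w′} e f =
    let p , b = ∥∥-total w
        q , c = ∥∥-total z′
    in ∥∥⇒≈ (∥∥-≗
      (mk≗ (λ n → eq₁ (approx (re z) n) (approx (im z) n) (approx (re w) n) (approx (im w) n)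
                      (approx (re z′) n) (approx (im z′) n) (approx (re w′) n) (approx (im w′) n))
           (λ n → eq₂ (approx (re z) n) (approx (im z) n) (approx (re w) n) (approx (im w) n)
                      (approx (re z′) n) (approx (im z′) n) (approx (re w′) n) (approx (im w′) n)))
      (∥∥-mono (ℚP.≤-reflexive (trans (cong₂ ℚ._+_ (ℚP.*-zeroˡ p) (ℚP.*-zeroʳ q)) (ℚP.+-identityˡ 0ℚ)))
        (∥∥-+ (∥∥-* (≈⇒∥∥ e) b) (∥∥-* c (≈⇒∥∥ f)))))
    where
    open +-*-Solver
    eq₁ : ∀ a b c d a′ b′ c′ d′ →
      ((a ℚ.- a′) ℚ.* c ℚ.- (b ℚ.- b′) ℚ.* d) ℚ.+ (a′ ℚ.* (c ℚ.- c′) ℚ.- b′ ℚ.* (d ℚ.- d′)) ≡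
      (a ℚ.* c ℚ.- b ℚ.* d) ℚ.- (a′ ℚ.* c′ ℚ.- b′ ℚ.* d′)
    eq₁ = solve 8 (λ a b c d a′ b′ c′ d′ →
      ((a :- a′) :* c :- (b :- b′) :* d) :+ (a′ :* (c :- c′) :- b′ :* (d :- d′)) :=
      (a :* c :- b :* d) :- (a′ :* c′ :- b′ :* d′)) refl
    eq₂ : ∀ a b c d a′ b′ c′ d′ →
      ((a ℚ.- a′) ℚ.* d ℚ.+ (b ℚ.- b′) ℚ.* c) ℚ.+ (a′ ℚ.* (d ℚ.- d′) ℚ.+ b′ ℚ.* (c ℚ.- c′)) ≡
      (a ℚ.* d ℚ.+ b ℚ.* c) ℚ.- (a′ ℚ.* d′ ℚ.+ b′ ℚ.* c′)
    eq₂ = solve 8 (λ a b c d a′ b′ c′ d′ →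
      ((a :- a′) :* d :+ (b :- b′) :* c) :+ (a′ :* (d :- d′) :+ b′ :* (c :- c′)) :=
      (a :* d :+ b :* c) :- (a′ :* d′ :+ b′ :* c′)) refl

  -ᶜ-cong : ∀ {z w} → z ≈ w → -ᶜ z ≈ -ᶜ w
  -ᶜ-cong {z} {w} e = ∥∥⇒≈ (∥∥-≗ (mk≗ (λ n → eq (approx (re z) n) (approx (re w) n))
                                       (λ n → eq (approx (im z) n) (approx (im w) n)))
                                  (∥∥-neg (≈⇒∥∥ e)))
    where
    open +-*-Solver
    eq : ∀ a b → ℚ.- (a ℚ.- b) ≡ ℚ.- a ℚ.- ℚ.- b
    eq = solve 2 (λ a b → :- (a :- b) := :- a :- :- b) refl

abstract
  ℂ-isCommutativeRing : IsCommutativeRing _≈_ _+_ _*_ -ᶜ_ 0ᶜ 1ᶜ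
  ℂ-isCommutativeRing = record
    { isRing = record
      { +-isAbelianGroup = record
        { isGroup = record
          { isMonoid = record
            { isSemigroup = record
              { isMagma = record
                { isEquivalence = record { refl = ≈-refl ; sym = ≈-sym ; trans = ≈-trans }
                ; ∙-cong = +-cong
                }
              ; assoc = λ x y z → ≗⇒≈ (mk≗
                  (λ n → ℚP.+-assoc (approx (re x) n) (approx (re y) n) (approx (re z) n))
                  (λ n → ℚP.+-assoc (approx (im x) n) (approx (im y) n) (approx (im z) n)))
              }
            ; identity =
                (λ x → ≗⇒≈ (mk≗ (λ n → ℚP.+-identityˡ (approx (re x) n))
                                (λ n → ℚP.+-identityˡ (approx (im x) n)))) ,
                (λ x → ≗⇒≈ (mk≗ (λ n → ℚP.+-identityʳ (approx (re x) n))
                                (λ n → ℚP.+-identityʳ (approx (im x) n))))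
            }
          ; inverse =
              (λ x → ≗⇒≈ (mk≗ (λ n → ℚP.+-inverseˡ (approx (re x) n))
                              (λ n → ℚP.+-inverseˡ (approx (im x) n)))) ,
              (λ x → ≗⇒≈ (mk≗ (λ n → ℚP.+-inverseʳ (approx (re x) n))
                              (λ n → ℚP.+-inverseʳ (approx (im x) n))))
          ; ⁻¹-cong = -ᶜ-cong
          }
        ; comm = λ x y → ≗⇒≈ (mk≗
            (λ n → ℚP.+-comm (approx (re x) n) (approx (re y) n))
            (λ n → ℚP.+-comm (approx (im x) n) (approx (im y) n)))
        }
      ; *-cong = *-cong
      ; *-assoc = assoc
      ; *-identity = (λ x → ≈-trans (comm 1ᶜ x) (identityʳ x)) , identityʳ
      ; distrib = distribˡ , λ x y z → ≈-trans (comm (y + z) x)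
          (≈-trans (distribˡ x y z) (+-cong (comm x y) (comm x z)))
      }
    ; *-comm = comm
    }
    where
    open +-*-Solver
    assoc : ∀ x y z → x * y * z ≈ x * (y * z)
    assoc x y z = ≗⇒≈ (mk≗
      (λ n → eq₁ (approx (re x) n) (approx (im x) n) (approx (re y) n) (approx (im y) n)
                 (approx (re z) n) (approx (im z) n))
      (λ n → eq₂ (approx (re x) n) (approx (im x) n) (approx (re y) n) (approx (im y) n)
                 (approx (re z) n) (approx (im z) n)))
      where
      eq₁ : ∀ a b c d e f →
        (a ℚ.* c ℚ.- b ℚ.* d) ℚ.* e ℚ.- (a ℚ.* d ℚ.+ b ℚ.* c) ℚ.* f ≡
        a ℚ.* (c ℚ.* e ℚ.- d ℚ.* f) ℚ.- b ℚ.* (c ℚ.* f ℚ.+ d ℚ.* e)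
      eq₁ = solve 6 (λ a b c d e f →
        (a :* c :- b :* d) :* e :- (a :* d :+ b :* c) :* f :=
        a :* (c :* e :- d :* f) :- b :* (c :* f :+ d :* e)) refl
      eq₂ : ∀ a b c d e f →
        (a ℚ.* c ℚ.- b ℚ.* d) ℚ.* f ℚ.+ (a ℚ.* d ℚ.+ b ℚ.* c) ℚ.* e ≡
        a ℚ.* (c ℚ.* f ℚ.+ d ℚ.* e) ℚ.+ b ℚ.* (c ℚ.* e ℚ.- d ℚ.* f)
      eq₂ = solve 6 (λ a b c d e f →
        (a :* c :- b :* d) :* f :+ (a :* d :+ b :* c) :* e :=
        a :* (c :* f :+ d :* e) :+ b :* (c :* e :- d :* f)) refl
    comm : ∀ x y → x * y ≈ y * x
    comm x y = ≗⇒≈ (mk≗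
      (λ n → eq₁ (approx (re x) n) (approx (im x) n) (approx (re y) n) (approx (im y) n))
      (λ n → eq₂ (approx (re x) n) (approx (im x) n) (approx (re y) n) (approx (im y) n)))
      where
      eq₁ : ∀ a b c d → a ℚ.* c ℚ.- b ℚ.* d ≡ c ℚ.* a ℚ.- d ℚ.* b
      eq₁ = solve 4 (λ a b c d → a :* c :- b :* d := c :* a :- d :* b) refl
      eq₂ : ∀ a b c d → a ℚ.* d ℚ.+ b ℚ.* c ≡ c ℚ.* b ℚ.+ d ℚ.* a
      eq₂ = solve 4 (λ a b c d → a :* d :+ b :* c := c :* b :+ d :* a) refl
    identityʳ : ∀ x → x * 1ᶜ ≈ x
    identityʳ x = ≗⇒≈ (mk≗ (λ n → eq₁ (approx (re x) n) (approx (im x) n))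
                           (λ n → eq₂ (approx (re x) n) (approx (im x) n)))
      where
      eq₁ : ∀ a b → a ℚ.* 1ℚ ℚ.- b ℚ.* 0ℚ ≡ a
      eq₁ = solve 2 (λ a b → a :* con 1ℚ :- b :* con 0ℚ := a) refl
      eq₂ : ∀ a b → a ℚ.* 0ℚ ℚ.+ b ℚ.* 1ℚ ≡ b
      eq₂ = solve 2 (λ a b → a :* con 0ℚ :+ b :* con 1ℚ := b) refl
    distribˡ : ∀ x y z → x * (y + z) ≈ x * y + x * z
    distribˡ x y z = ≗⇒≈ (mk≗
      (λ n → eq₁ (approx (re x) n) (approx (im x) n) (approx (re y) n) (approx (im y) n)
                 (approx (re z) n) (approx (im z) n))
      (λ n → eq₂ (approx (re x) n) (approx (im x) n) (approx (re y) n) (approx (im y) n)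
                 (approx (re z) n) (approx (im z) n)))
      where
      eq₁ : ∀ a b c d e f → a ℚ.* (c ℚ.+ e) ℚ.- b ℚ.* (d ℚ.+ f) ≡
            (a ℚ.* c ℚ.- b ℚ.* d) ℚ.+ (a ℚ.* e ℚ.- b ℚ.* f)
      eq₁ = solve 6 (λ a b c d e f → a :* (c :+ e) :- b :* (d :+ f) :=
            (a :* c :- b :* d) :+ (a :* e :- b :* f)) refl
      eq₂ : ∀ a b c d e f → a ℚ.* (d ℚ.+ f) ℚ.+ b ℚ.* (c ℚ.+ e) ≡
            (a ℚ.* d ℚ.+ b ℚ.* c) ℚ.+ (a ℚ.* f ℚ.+ b ℚ.* e)
      eq₂ = solve 6 (λ a b c d e f → a :* (d :+ f) :+ b :* (c :+ e) :=
            (a :* d :+ b :* c) :+ (a :* f :+ b :* e)) refl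

ℂ-commutativeRing : CommutativeRing 0ℓ 0ℓ
ℂ-commutativeRing = record { isCommutativeRing = ℂ-isCommutativeRing }

ofℚ : ℚ → ℂ
ofℚ q = ofℝ (fromℚ q)

abstract
  ofℚ-+ : ∀ p q → ofℚ (p ℚ.+ q) ≈ ofℚ p + ofℚ q
  ofℚ-+ p q = ≗⇒≈ (mk≗ (λ _ → refl) (λ _ → refl))

  ofℚ-* : ∀ p q → ofℚ (p ℚ.* q) ≈ ofℚ p * ofℚ q
  ofℚ-* p q = ≗⇒≈ (mk≗ (λ _ → eq₁ p q) (λ _ → eq₂ p q))
    where
    open +-*-Solver
    eq₁ : ∀ p q → p ℚ.* q ≡ p ℚ.* q ℚ.- 0ℚ ℚ.* 0ℚ
    eq₁ = solve 2 (λ p q → p :* q := p :* q :- con 0ℚ :* con 0ℚ) refl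
    eq₂ : ∀ p q → 0ℚ ≡ p ℚ.* 0ℚ ℚ.+ 0ℚ ℚ.* q
    eq₂ = solve 2 (λ p q → con 0ℚ := p :* con 0ℚ :+ con 0ℚ :* q) refl

  ofℚ-neg : ∀ p → ofℚ (ℚ.- p) ≈ -ᶜ ofℚ p
  ofℚ-neg p = ≗⇒≈ (mk≗ (λ _ → refl) (λ _ → refl))

ℚ→ℂ : CommutativeRing.rawRing ℚP.+-*-commutativeRing -Raw-AlmostCommutative⟶
      fromCommutativeRing ℂ-commutativeRing
ℚ→ℂ = record
  { ⟦_⟧ = ofℚ ; +-homo = ofℚ-+ ; *-homo = ofℚ-* ; -‿homo = ofℚ-neg ; 0-homo = ≈-refl ; 1-homo = ≈-refl }

coeff≟ : ∀ p q → Maybe (ofℚ p ≈ ofℚ q)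
coeff≟ p q with p ℚP.≟ q
... | yes refl = just ≈-refl
... | no  _    = nothing

module ℂ-Solver = RingSolver _ (fromCommutativeRing ℂ-commutativeRing) ℚ→ℂ coeff≟

-- Limits and series

module ℂR = CommutativeRing ℂ-commutativeRing

module ≈-Reasoning = SetoidReasoning ℂR.setoid

infix 4 _≈[_]_

-- A record, because z and w cannot be inferred from z - w.
record _≈[_]_ (z : ℂ) (q : ℚ) (w : ℂ) : Set where
  constructor mk≈[]
  field
    ∥-∥ : ∥ z - w ∥≤ q

open _≈[_]_

abstract
  ∥∥-cong : ∀ {z w q} → z ≈ w → ∥ z ∥≤ q → ∥ w ∥≤ q
  ∥∥-cong {z} {w} {q} e b = ∥∥-mono (ℚP.≤-reflexive (ℚP.+-identityʳ q)) (∥∥-≗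
    (mk≗ (λ n → eq (approx (re z) n) (approx (re w) n))
         (λ n → eq (approx (im z) n) (approx (im w) n)))
    (∥∥-+ b (≈⇒∥∥ (≈-sym e))))
    where
    open +-*-Solver
    eq : ∀ a b → a ℚ.+ (b ℚ.- a) ≡ b
    eq = solve 2 (λ a b → a :+ (b :- a) := b) refl

  ≈[]-sym : ∀ {z w q} → z ≈[ q ] w → w ≈[ q ] z
  ≈[]-sym {z} {w} (mk≈[] b) =
    mk≈[] (∥∥-cong (solve 2 (λ z w → :- (z :- w) := w :- z) ≈-refl z w) (∥∥-neg b))
    where open ℂ-Solver

  ≈[]-trans : ∀ {x y z p q} → x ≈[ p ] y → y ≈[ q ] z → x ≈[ p ℚ.+ q ] z
  ≈[]-trans {x} {y} {z} (mk≈[] b) (mk≈[] c) =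
    mk≈[] (∥∥-cong (solve 3 (λ x y z → x :- y :+ (y :- z) := x :- z) ≈-refl x y z) (∥∥-+ b c))
    where open ℂ-Solver

  ≈[]-mono : ∀ {z w p q} → p ℚ.≤ q → z ≈[ p ] w → z ≈[ q ] w
  ≈[]-mono p≤q (mk≈[] b) = mk≈[] (∥∥-mono p≤q b)

  ≈⇒≈[0] : ∀ {z w} → z ≈ w → z ≈[ 0ℚ ] w
  ≈⇒≈[0] e = mk≈[] (≈⇒∥∥ e)

  ≈[]-cong : ∀ {z w z′ w′ q} → z ≈ z′ → w ≈ w′ → z ≈[ q ] w → z′ ≈[ q ] w′
  ≈[]-cong e f (mk≈[] b) = mk≈[] (∥∥-cong (+-cong e (-ᶜ-cong f)) b)

  ∥∥-limit : ∀ {z q} → (∀ ε → 0ℚ ℚ.< ε → ∥ z ∥≤ q ℚ.+ ε) → ∥ z ∥≤ q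
  ∥∥-limit {z} {q} h = mk∥∥ λ ε 0<ε →
    let 0<½ε = *-pos 0<½ 0<ε in
    eventually-map (λ n k → ℚP.≤-trans k (ℚP.≤-reflexive
        (trans (ℚP.+-assoc q (½ ℚ.* ε) (½ ℚ.* ε)) (cong (q ℚ.+_) (½-double ε)))))
      (bound (h (½ ℚ.* ε) 0<½ε) (½ ℚ.* ε) 0<½ε)

  ≈[]-limit : ∀ {z w} → (∀ ε → 0ℚ ℚ.< ε → z ≈[ ε ] w) → z ≈ w
  ≈[]-limit h = ∥∥⇒≈ (∥∥-limit λ ε 0<ε →
    ∥∥-mono (ℚP.≤-reflexive (sym (ℚP.+-identityˡ ε))) (∥-∥ (h ε 0<ε)))

infix 4 _⟶_

record _⟶_ (f : ℕ → ℂ) (L : ℂ) : Set where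
  constructor mk⟶
  field
    tends : ∀ ε → 0ℚ ℚ.< ε → Eventually λ n → f n ≈[ ε ] L

open _⟶_

abstract
  ⟶-cong : ∀ {f g L M} → (∀ n → f n ≈ g n) → L ≈ M → f ⟶ L → g ⟶ M
  ⟶-cong f≈g L≈M l = mk⟶ λ ε 0<ε → eventually-map
    (λ n → ≈[]-cong (f≈g n) L≈M) (tends l ε 0<ε)

  ⟶-const : ∀ z → (λ _ → z) ⟶ z
  ⟶-const z = mk⟶ λ ε 0<ε → 0 , λ _ _ →
    ≈[]-mono (ℚP.<⇒≤ 0<ε) (≈⇒≈[0] ≈-refl)

  ⟶-+ : ∀ {f g L M} → f ⟶ L → g ⟶ M → (λ n → f n + g n) ⟶ L + M
  ⟶-+ {f} {g} {L} {M} l m = mk⟶ λ ε 0<ε →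
    let 0<½ε = *-pos 0<½ 0<ε in
    eventually-map₂
      (λ n b c → mk≈[] (∥∥-mono (ℚP.≤-reflexive (½-double ε))
        (∥∥-cong (eq (f n) (g n) L M) (∥∥-+ (∥-∥ b) (∥-∥ c)))))
      (tends l (½ ℚ.* ε) 0<½ε) (tends m (½ ℚ.* ε) 0<½ε)
    where
    open ℂ-Solver
    eq : ∀ x y L M → x - L + (y - M) ≈ x + y - (L + M)
    eq = solve 4 (λ x y L M → x :- L :+ (y :- M) := x :+ y :- (L :+ M)) ≈-refl

  ⟶-* : ∀ {f g L M} → f ⟶ L → g ⟶ M → (λ n → f n * g n) ⟶ L * M
  ⟶-* {f} {g} {L} {M} l m = mk⟶ λ ε 0<ε →
    let p , L≤p = ∥∥-total L
        q , M≤q = ∥∥-total M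
        e , 0<e , small = ∃-slack (∥∥-nonNeg L≤p) (∥∥-nonNeg M≤q) 0<ε
    in eventually-map₂
      (λ { n (mk≈[] b) (mk≈[] c) → mk≈[] (∥∥-mono small (∥∥-cong (eq (f n) (g n) L M)
        (∥∥-+ (∥∥-* b c) (∥∥-+ (∥∥-* L≤p c) (∥∥-* b M≤q))))) })
      (tends l e 0<e) (tends m e 0<e)
    where
    open ℂ-Solver
    eq : ∀ x y L M → (x - L) * (y - M) + (L * (y - M) + (x - L) * M) ≈ x * y - L * M
    eq = solve 4 (λ x y L M →
      (x :- L) :* (y :- M) :+ (L :* (y :- M) :+ (x :- L) :* M) := x :* y :- L :* M) ≈-refl

  ⟶-scale : ∀ {f L} c → f ⟶ L → (λ n → c * f n) ⟶ c * L
  ⟶-scale c = ⟶-* (⟶-const c)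

  ⟶-- : ∀ {f g L M} → f ⟶ L → g ⟶ M → (λ n → f n - g n) ⟶ L - M
  ⟶-- {f} {g} {L} {M} l m =
    ⟶-cong (λ n → eq (f n) (g n)) (eq L M) (⟶-+ l (⟶-scale (ofℚ (ℚ.- 1ℚ)) m))
    where
    open ℂ-Solver
    eq : ∀ x y → x + ofℚ (ℚ.- 1ℚ) * y ≈ x - y
    eq = solve 2 (λ x y → x :+ con (ℚ.- 1ℚ) :* y := x :- y) ≈-refl

  ⟶-unique : ∀ {f L M} → f ⟶ L → f ⟶ M → L ≈ M
  ⟶-unique {f} {L} {M} l m = ≈[]-limit λ ε 0<ε →
    let 0<½ε  = *-pos 0<½ 0<ε
        N , h = eventually-map₂ {R = λ _ → L ≈[ ½ ℚ.* ε ℚ.+ ½ ℚ.* ε ] M}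
                  (λ n b c → ≈[]-trans (≈[]-sym b) c)
                  (tends l (½ ℚ.* ε) 0<½ε) (tends m (½ ℚ.* ε) 0<½ε)
    in ≈[]-mono (ℚP.≤-reflexive (½-double ε)) (h N ℕP.≤-refl)

-- Natural numbers in ℚ, and null sequences

ι : ℕ → ℚ
ι n = + n ℚ./ 1

abstract
  ι-suc : ∀ n → ι (suc n) ≡ 1ℚ ℚ.+ ι n
  ι-suc n = trans
    (ℚP./-cong {+ suc n} {1} {+ 1 ℤ.* + 1 ℤ.+ + n ℤ.* + 1} {1}
      (cong (λ m → + 1 ℤ.+ m) (sym (ℤP.*-identityʳ (+ n)))) refl)
    -- The sum 1ℚ ℚ.+ q computes to a fraction only when q is a visible reduced fraction, so `ι n`
    -- is replaced by n/1 in lowest terms.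
    (cong (1ℚ ℚ.+_) (sym (ℚP.normalize-coprime (Coprime.sym (Coprime.1-coprimeTo n)))))

  ι-+ : ∀ m n → ι (m ℕ.+ n) ≡ ι m ℚ.+ ι n
  ι-+ zero    n = sym (ℚP.+-identityˡ (ι n))
  ι-+ (suc m) n = trans (ι-suc (m ℕ.+ n)) (trans (cong (1ℚ ℚ.+_) (ι-+ m n))
    (trans (sym (ℚP.+-assoc 1ℚ (ι m) (ι n))) (cong (ℚ._+ ι n) (sym (ι-suc m)))))

  ι-* : ∀ m n → ι (m ℕ.* n) ≡ ι m ℚ.* ι n
  ι-* zero    n = sym (ℚP.*-zeroˡ (ι n))
  ι-* (suc m) n = trans (ι-+ n (m ℕ.* n)) (trans (cong (ι n ℚ.+_) (ι-* m n))
    (trans (eq (ι m) (ι n)) (cong (ℚ._* ι n) (sym (ι-suc m)))))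
    where
    open +-*-Solver
    eq : ∀ a b → b ℚ.+ a ℚ.* b ≡ (1ℚ ℚ.+ a) ℚ.* b
    eq = solve 2 (λ a b → b :+ a :* b := (con 1ℚ :+ a) :* b) refl

  ι-nonNeg : ∀ n → 0ℚ ℚ.≤ ι n
  ι-nonNeg zero    = ℚP.≤-refl
  ι-nonNeg (suc n) = subst (0ℚ ℚ.≤_) (sym (ι-suc n)) (+-nonNeg (ℚP.<⇒≤ 0<1) (ι-nonNeg n))

  ι-pos : ∀ n → 0ℚ ℚ.< ι (suc n)
  ι-pos n = subst (0ℚ ℚ.<_) (sym (ι-suc n))
    (ℚP.+-mono-<-≤ {0ℚ} {1ℚ} {0ℚ} 0<1 (ι-nonNeg n))

  ι-mono : ∀ {m n} → m ℕ.≤ n → ι m ℚ.≤ ι n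
  ι-mono {m} {n} m≤n = ≤-diff (ι (n ℕ.∸ m)) (ι-nonNeg (n ℕ.∸ m))
    (trans (sym (ι-+ m (n ℕ.∸ m))) (cong ι (ℕP.m+[n∸m]≡n m≤n)))

  archimedean : ∀ q → ∃[ n ] q ℚ.≤ ι n
  archimedean (ℚ.mkℚ i d _) = ℤ.∣ i ∣ , ℚP.toℚᵘ-cancel-≤
    (ℚᵘP.≤-respʳ-≃ (ℚᵘP.≃-sym (ℚP.toℚᵘ-fromℚᵘ (ℚᵘ.mkℚᵘ (+ ℤ.∣ i ∣) 0)))
      (ℚᵘ.*≤* (bnd i d)))
    where
    bnd : ∀ i d → i ℤ.* + 1 ℤ.≤ + ℤ.∣ i ∣ ℤ.* + suc d
    bnd (+ n)      d = subst₂ ℤ._≤_ (ℤP.pos-* n 1) (ℤP.pos-* n (suc d))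
                         (ℤ.+≤+ (ℕP.*-monoʳ-≤ n (s≤s z≤n)))
    bnd ℤ.-[1+ n ] d = ℤ.-≤+

  inv-anti : ∀ {p q} → 0ℚ ℚ.< p → p ℚ.≤ q → inv q ℚ.≤ inv p
  inv-anti {p} {q} 0<p p≤q =
    subst₂ ℚ._≤_ (trans (eq (inv p) (inv q) p) (trans (cong (ℚ._* inv q) (inv-inverse p (pos⇒≢0 0<p))) (ℚP.*-identityˡ (inv q))))
      (trans (eq′ (inv p) (inv q) q) (trans (cong (ℚ._* inv p) (inv-inverse q (pos⇒≢0 0<q))) (ℚP.*-identityˡ (inv p))))
      (ℚP.*-monoˡ-≤-nonNeg (inv p ℚ.* inv q)
        {{ℚ.nonNegative (*-nonNeg (ℚP.<⇒≤ (inv-pos 0<p)) (ℚP.<⇒≤ (inv-pos 0<q)))}} p≤q)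
    where
    open +-*-Solver
    0<q : 0ℚ ℚ.< q
    0<q = ℚP.<-≤-trans 0<p p≤q
    eq : ∀ i j p → i ℚ.* j ℚ.* p ≡ i ℚ.* p ℚ.* j
    eq = solve 3 (λ i j p → i :* j :* p := i :* p :* j) refl
    eq′ : ∀ i j q → i ℚ.* j ℚ.* q ≡ j ℚ.* q ℚ.* i
    eq′ = solve 3 (λ i j q → i :* j :* q := j :* q :* i) refl

  inv-inv≤ : ∀ {p q} → 0ℚ ℚ.< p → 0ℚ ℚ.< q → inv p ℚ.≤ q → inv q ℚ.≤ p
  inv-inv≤ {p} {q} 0<p 0<q h = subst (inv q ℚ.≤_) inv-inv (inv-anti (inv-pos 0<p) h)
    where
    open +-*-Solver
    eq : ∀ j i p → j ℚ.* (i ℚ.* p) ≡ j ℚ.* i ℚ.* p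
    eq = solve 3 (λ j i p → j :* (i :* p) := j :* i :* p) refl
    inv-inv : inv (inv p) ≡ p
    inv-inv = trans (sym (ℚP.*-identityʳ (inv (inv p))))
      (trans (cong (inv (inv p) ℚ.*_) (sym (inv-inverse p (pos⇒≢0 0<p))))
      (trans (eq (inv (inv p)) (inv p) p)
      (trans (cong (ℚ._* p) (inv-inverse (inv p) (pos⇒≢0 (inv-pos 0<p)))) (ℚP.*-identityˡ p))))

-- One-sided, because it is applied to nonnegative error bounds.
Null : (ℕ → ℚ) → Set
Null g = ∀ ε → 0ℚ ℚ.< ε → Eventually λ n → g n ℚ.≤ ε

abstract
  Null-inv-ι : Null (λ n → inv (ι (suc n)))
  Null-inv-ι ε 0<ε =
    let N , h = archimedean (inv ε) in
    N , λ n N≤n → inv-inv≤ 0<ε (ι-pos n) (ℚP.≤-trans h (ι-mono (ℕP.m≤n⇒m≤1+n N≤n)))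

  Null-+ : ∀ {g h} → Null g → Null h → Null (λ n → g n ℚ.+ h n)
  Null-+ g h ε 0<ε =
    let 0<½ε = *-pos 0<½ 0<ε in
    eventually-map₂ (λ n b c → ℚP.≤-trans (ℚP.+-mono-≤ b c) (ℚP.≤-reflexive (½-double ε)))
      (g (½ ℚ.* ε) 0<½ε) (h (½ ℚ.* ε) 0<½ε)

  Null-scale : ∀ {g p} → 0ℚ ℚ.≤ p → Null g → Null (λ n → g n ℚ.* p)
  Null-scale {g} {p} 0≤p null ε 0<ε = eventually-map
    (λ n h → ℚP.≤-trans
      (ℚP.*-monoʳ-≤-nonNeg p {{ℚ.nonNegative 0≤p}} h)
      (≤-diff (inv s ℚ.* ε) (ℚP.<⇒≤ (*-pos (inv-pos 0<s) 0<ε))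
        (trans (eq (inv s) p ε) (trans (cong (ℚ._* ε) (inv-inverse s (pos⇒≢0 0<s))) (ℚP.*-identityˡ ε)))))
    (null (inv s ℚ.* ε) (*-pos (inv-pos 0<s) 0<ε))
    where
    open +-*-Solver
    -- Adding 1 keeps the divisor positive when p is 0.
    s : ℚ
    s = p ℚ.+ 1ℚ
    0<s : 0ℚ ℚ.< s
    0<s = ℚP.+-mono-≤-< {0ℚ} {p} {0ℚ} 0≤p 0<1
    eq : ∀ i p ε → i ℚ.* ε ℚ.* p ℚ.+ i ℚ.* ε ≡ i ℚ.* (p ℚ.+ 1ℚ) ℚ.* ε
    eq = solve 3 (λ i p ε → i :* ε :* p :+ i :* ε := i :* (p :+ con 1ℚ) :* ε) refl

-- The limit is diagonal: its k-th approximant is a rational point c k within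
-- 2 / (k + 1) of f (index k), where index k is so large that g ≤ 1 / (k + 1).
module Completeness (f : ℕ → ℂ) (g : ℕ → ℚ)
  (tail : ∀ d n → f (d ℕ.+ n) ≈[ g n ] f n) (null : Null g) where

  ε′ : ℕ → ℚ
  ε′ k = inv (ι (suc k))

  0<ε′ : ∀ k → 0ℚ ℚ.< ε′ k
  0<ε′ k = inv-pos (ι-pos k)

  index : ℕ → ℕ
  index k = proj₁ (null (ε′ k) (0<ε′ k))

  point : ℕ → ℂ
  point k = f (index k)

  g-index : ∀ k → g (index k) ℚ.≤ ε′ k
  g-index k = proj₂ (null (ε′ k) (0<ε′ k)) (index k) ℕP.≤-refl

  x y : ℕ → ℚ
  x k = approx (re (point k)) (proj₁ (cauchy (re (point k)) (ε′ k) (0<ε′ k)))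
  y k = approx (im (point k)) (proj₁ (cauchy (im (point k)) (ε′ k) (0<ε′ k)))

  c : ℕ → ℂ
  c k = fromℚ (x k) +i fromℚ (y k)

  near : ∀ z ε (0<ε : 0ℚ ℚ.< ε) →
         Eventually λ n → ℚ.∣ approx z n ℚ.- approx z (proj₁ (cauchy z ε 0<ε)) ∣ ℚ.≤ ε
  near z ε 0<ε with cauchy z ε 0<ε
  ... | N , h = N , λ n N≤n → h n N N≤n ℕP.≤-refl

  abstract
    point-c : ∀ k → point k ≈[ ε′ k ℚ.+ ε′ k ] c k
    point-c k = mk≈[] $ mk∥∥ λ ε 0<ε → eventually-map₂
      (λ n b d → ℚP.≤-trans (ℚP.+-mono-≤ b d) (≤-diff ε (ℚP.<⇒≤ 0<ε) refl))
      (near (re (point k)) (ε′ k) (0<ε′ k)) (near (im (point k)) (ε′ k) (0<ε′ k))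

    tail′ : ∀ {m n} → n ℕ.≤ m → f m ≈[ g n ] f n
    tail′ {m} {n} n≤m = subst (λ k → f k ≈[ g n ] f n) (ℕP.m∸n+n≡m n≤m) (tail (m ℕ.∸ n) n)

    f-f : ∀ m n → f m ≈[ g m ℚ.+ g n ] f n
    f-f m n with ℕP.≤-total n m
    ... | inj₁ n≤m = ≈[]-mono (≤-diff (g m) (∥∥-nonNeg (∥-∥ (tail 0 m))) (ℚP.+-comm (g n) (g m))) (tail′ n≤m)
    ... | inj₂ m≤n = ≈[]-mono (≤-diff (g n) (∥∥-nonNeg (∥-∥ (tail 0 n))) refl) (≈[]-sym (tail′ m≤n))

    -- For each index, 2/(k + 1) leads from `c k` to its point and 1/(k + 1) bounds the tail there;
    -- this is the 3.
    c-c : ∀ k l → c k ≈[ ι 3 ℚ.* ε′ k ℚ.+ ι 3 ℚ.* ε′ l ] c l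
    c-c k l = ≈[]-mono (ℚP.≤-reflexive (eq (ε′ k) (ε′ l)))
      (≈[]-trans (≈[]-sym (point-c k)) (≈[]-trans
        (≈[]-mono (ℚP.+-mono-≤ (g-index k) (g-index l)) (f-f (index k) (index l))) (point-c l)))
      where
      open +-*-Solver
      eq : ∀ a b → a ℚ.+ a ℚ.+ (a ℚ.+ b ℚ.+ (b ℚ.+ b)) ≡ ι 3 ℚ.* a ℚ.+ ι 3 ℚ.* b
      eq = solve 2 (λ a b → a :+ a :+ (a :+ b :+ (b :+ b)) := con (ι 3) :* a :+ con (ι 3) :* b) refl

    x-y-near : ∀ k l → ℚ.∣ x k ℚ.- x l ∣ ℚ.+ ℚ.∣ y k ℚ.- y l ∣ ℚ.≤ ι 3 ℚ.* ε′ k ℚ.+ ι 3 ℚ.* ε′ l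
    x-y-near k l = ≤-limit λ ε 0<ε → Eventually⇒≤ (bound (∥-∥ (c-c k l)) ε 0<ε)

    ε′-small : Null (λ k → ι 3 ℚ.* ε′ k)
    ε′-small ε 0<ε = eventually-map
      (λ n → subst (ℚ._≤ ε) (ℚP.*-comm (ε′ n) (ι 3))) (Null-scale (ι-nonNeg 3) Null-inv-ι ε 0<ε)

    x-y-cauchy : ∀ ε → 0ℚ ℚ.< ε → ∃[ N ] ∀ m n → N ℕ.≤ m → N ℕ.≤ n →
                 ℚ.∣ x m ℚ.- x n ∣ ℚ.+ ℚ.∣ y m ℚ.- y n ∣ ℚ.≤ ε
    x-y-cauchy ε 0<ε =
      let N , h = ε′-small (½ ℚ.* ε) (*-pos 0<½ 0<ε) in
      N , λ m n N≤m N≤n → ℚP.≤-trans (x-y-near m n)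
        (ℚP.≤-trans (ℚP.+-mono-≤ (h m N≤m) (h n N≤n)) (ℚP.≤-reflexive (½-double ε)))

    x-cauchy : IsCauchy x
    x-cauchy ε 0<ε = let N , h = x-y-cauchy ε 0<ε in N , λ m n p q → ℚP.≤-trans
      (≤-diff ℚ.∣ y m ℚ.- y n ∣ (ℚP.0≤∣p∣ (y m ℚ.- y n)) refl) (h m n p q)

    y-cauchy : IsCauchy y
    y-cauchy ε 0<ε = let N , h = x-y-cauchy ε 0<ε in N , λ m n p q → ℚP.≤-trans
      (≤-diff ℚ.∣ x m ℚ.- x n ∣ (ℚP.0≤∣p∣ (x m ℚ.- x n)) (ℚP.+-comm ℚ.∣ y m ℚ.- y n ∣ ℚ.∣ x m ℚ.- x n ∣))
      (h m n p q)

  limit : ℂ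
  limit = mkℝ x x-cauchy +i mkℝ y y-cauchy

  abstract
    limit-c : ∀ k → limit ≈[ ι 3 ℚ.* ε′ k ] c k
    limit-c k = mk≈[] $ mk∥∥ λ ε 0<ε → eventually-map
      (λ n h → ℚP.≤-trans (x-y-near n k) (ℚP.≤-trans (ℚP.+-monoˡ-≤ (ι 3 ℚ.* ε′ k) h)
        (ℚP.≤-reflexive (ℚP.+-comm ε (ι 3 ℚ.* ε′ k))))) (ε′-small ε 0<ε)

    limit-tail : ∀ n → limit ≈[ g n ] f n
    limit-tail n = mk≈[] $ ∥∥-limit λ ε 0<ε →
      -- The 6 collects 3 from `limit-c`, 2 from `point-c` and 1 from `g-index`; k only serves to
      -- make this detour small.
      let k , h = Null-scale (ι-nonNeg 6) Null-inv-ι ε 0<ε in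
      ∥-∥ $ ≈[]-mono (ℚP.≤-trans (ℚP.≤-reflexive (eq (ε′ k) (g n))) (ℚP.+-monoʳ-≤ (g n) (h k ℕP.≤-refl)))
        (≈[]-trans (limit-c k) (≈[]-trans (≈[]-sym (point-c k))
          (≈[]-mono (ℚP.+-monoˡ-≤ (g n) (g-index k)) (f-f (index k) n))))
      where
      open +-*-Solver
      eq : ∀ a b → ι 3 ℚ.* a ℚ.+ (a ℚ.+ a ℚ.+ (a ℚ.+ b)) ≡ b ℚ.+ a ℚ.* ι 6
      eq = solve 2 (λ a b → con (ι 3) :* a :+ (a :+ a :+ (a :+ b)) := b :+ a :* con (ι 6)) refl

-- Since the decrements telescope, `g n` bounds everything from index n on and is thus a rate of
-- convergence. Closure under sums and under bounded factors reduces every series here to the aₙ/n²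
-- and bₘ/m².
record Dominated (f : ℕ → ℂ) (g : ℕ → ℚ) : Set where
  field
    nonNeg : ∀ n → 0ℚ ℚ.≤ g n
    null   : Null g
    step   : ∀ n → ∥ f n ∥≤ g n ℚ.- g (suc n)

open Dominated

abstract
  ∑<-tail : ∀ {f g} → Dominated f g → ∀ d n → ∑< (d ℕ.+ n) f ≈[ g n ℚ.- g (d ℕ.+ n) ] ∑< n f
  ∑<-tail {f} {g} dom zero    n =
    ≈[]-mono (ℚP.≤-reflexive (sym (ℚP.+-inverseʳ (g n)))) (≈⇒≈[0] ≈-refl)
  ∑<-tail {f} {g} dom (suc d) n =
    mk≈[] $ ∥∥-mono (ℚP.≤-reflexive (eqℚ (g n) (g (d ℕ.+ n)) (g (suc d ℕ.+ n))))
      (∥∥-cong (eq (∑< (d ℕ.+ n) f) (∑< n f) (f (d ℕ.+ n)))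
        (∥∥-+ (∥-∥ (∑<-tail dom d n)) (step dom (d ℕ.+ n))))
    where
    eqℚ : ∀ a b c → a ℚ.- b ℚ.+ (b ℚ.- c) ≡ a ℚ.- c
    eqℚ = solve 3 (λ a b c → a :- b :+ (b :- c) := a :- c) refl
      where open +-*-Solver
    eq : ∀ a b c → a - b + c ≈ a + c - b
    eq = solve 3 (λ a b c → a :- b :+ c := a :+ c :- b) ≈-refl
      where open ℂ-Solver

  ∑<-tail-≤ : ∀ {f g} → Dominated f g → ∀ d n → ∑< (d ℕ.+ n) f ≈[ g n ] ∑< n f
  ∑<-tail-≤ {f} {g} dom d n = ≈[]-mono (≤-diff (g (d ℕ.+ n)) (nonNeg dom (d ℕ.+ n)) (eq (g n) (g (d ℕ.+ n))))
    (∑<-tail dom d n)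
    where
    eq : ∀ a b → a ℚ.- b ℚ.+ b ≡ a
    eq = solve 2 (λ a b → a :- b :+ b := a) refl
      where open +-*-Solver

  ∑<-≤ : ∀ {f g} → Dominated f g → ∀ n → ∥ ∑< n f ∥≤ g 0
  ∑<-≤ {f} {g} dom n = ∥∥-cong (≈-trans (eq (∑< (n ℕ.+ 0) f)) (ℂR.reflexive (cong (λ m → ∑< m f) (ℕP.+-identityʳ n))))
    (∥-∥ (∑<-tail-≤ dom n 0))
    where
    eq : ∀ a → a - 0ᶜ ≈ a
    eq = solve 1 (λ a → a :- con 0ℚ := a) ≈-refl
      where open ℂ-Solver

  ∣∣-square : ∀ a → a ℚ.* a ≡ ℚ.∣ a ∣ ℚ.* ℚ.∣ a ∣
  ∣∣-square a with ℚP.∣p∣≡p∨∣p∣≡-p a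
  ... | inj₁ e = sym (cong₂ ℚ._*_ e e)
  ... | inj₂ e = trans (eq a) (sym (cong₂ ℚ._*_ e e))
    where
    open +-*-Solver
    eq : ∀ a → a ℚ.* a ≡ (ℚ.- a) ℚ.* (ℚ.- a)
    eq = solve 1 (λ a → a :* a := (:- a) :* (:- a)) refl

  square-nonNeg : ∀ a → 0ℚ ℚ.≤ a ℚ.* a
  square-nonNeg a = subst (0ℚ ℚ.≤_) (sym (∣∣-square a)) (*-nonNeg (ℚP.0≤∣p∣ a) (ℚP.0≤∣p∣ a))

  ∣∣²≤size² : ∀ z n → approx ∣ z ∣² n ℚ.≤ size z n ℚ.* size z n
  ∣∣²≤size² z n = ≤-diff (ι 2 ℚ.* (ℚ.∣ a ∣ ℚ.* ℚ.∣ b ∣))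
    (*-nonNeg (ι-nonNeg 2) (*-nonNeg (ℚP.0≤∣p∣ a) (ℚP.0≤∣p∣ b)))
    (trans (cong₂ (λ p q → p ℚ.+ q ℚ.+ ι 2 ℚ.* (ℚ.∣ a ∣ ℚ.* ℚ.∣ b ∣)) (∣∣-square a) (∣∣-square b))
      (eq ℚ.∣ a ∣ ℚ.∣ b ∣))
    where
    open +-*-Solver
    a b : ℚ
    a = approx (re z) n
    b = approx (im z) n
    eq : ∀ a b → a ℚ.* a ℚ.+ b ℚ.* b ℚ.+ ι 2 ℚ.* (a ℚ.* b) ≡ (a ℚ.+ b) ℚ.* (a ℚ.+ b)
    eq = solve 2 (λ a b → a :* a :+ b :* b :+ con (ι 2) :* (a :* b) := (a :+ b) :* (a :+ b)) refl

  ∥∥⇒∣∣≤ : ∀ {ε : ℝ} → 0ᴿ <ᴿ ε → ∃[ δ ] 0ℚ ℚ.< δ × ∀ {z} → ∥ z ∥≤ δ → ∣ z ∣≤ ε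
  -- Half of the gap is the bound demanded of z, the other half is the slack in `bound`.
  ∥∥⇒∣∣≤ {ε} (mk< gap 0<gap N apart) = ½ ℚ.* gap , *-pos 0<½ 0<gap , λ {z} b →
    mk≤ (λ η 0<η → N , λ n N≤n → ℚP.≤-trans (0≤ε n N≤n) (≤-diff η (ℚP.<⇒≤ 0<η) refl)) ,
    mk≤ (λ η 0<η → eventually-map₂
      (λ n k N≤n → ℚP.≤-trans (∣∣²≤size² z n) (ℚP.≤-trans
        (*-mono-≤ (size-nonNeg z n) (size-nonNeg z n) (ℚP.≤-trans k (gap≤ε n N≤n)) (ℚP.≤-trans k (gap≤ε n N≤n)))
        (≤-diff η (ℚP.<⇒≤ 0<η) refl)))
      (bound b (½ ℚ.* gap) (*-pos 0<½ 0<gap)) (N , λ n N≤n → N≤n))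
    where
    gap≤ε : ∀ n → N ℕ.≤ n → ½ ℚ.* gap ℚ.+ ½ ℚ.* gap ℚ.≤ approx ε n
    gap≤ε n N≤n = subst (ℚ._≤ approx ε n) (trans (ℚP.+-identityˡ gap) (sym (½-double gap))) (apart n N≤n)
    0≤ε : ∀ n → N ℕ.≤ n → 0ℚ ℚ.≤ approx ε n
    0≤ε n N≤n = ℚP.≤-trans (subst (0ℚ ℚ.≤_) (sym (½-double gap)) (ℚP.<⇒≤ 0<gap)) (gap≤ε n N≤n)

module _ {f g} (dom : Dominated f g) where

  open Completeness (λ n → ∑< n f) g (∑<-tail-≤ dom) (null dom) using (limit; limit-tail)

  abstract
    hasSum-limit : HasSum f limit
    hasSum-limit ε 0<ε =
      let δ , 0<δ , h = ∥∥⇒∣∣≤ 0<ε in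
      eventually-map (λ n k → h (∥-∥ (≈[]-mono k (≈[]-sym (limit-tail n))))) (null dom δ 0<δ)

  summable : Summable f
  summable = record { sum = limit ; hasSum = hasSum-limit }

  abstract
    ∑-tail : ∀ n → ∑ summable ≈[ g n ] ∑< n f
    ∑-tail = limit-tail

    ∑<⟶∑ : (λ n → ∑< n f) ⟶ ∑ summable
    ∑<⟶∑ = mk⟶ λ ε 0<ε → eventually-map (λ n k → ≈[]-mono k (≈[]-sym (limit-tail n))) (null dom ε 0<ε)

    ∑-≤ : ∥ ∑ summable ∥≤ g 0
    ∑-≤ = ∥∥-cong (eq (∑ summable)) (∥-∥ (limit-tail 0))
      where
      eq : ∀ a → a - 0ᶜ ≈ a
      eq = solve 1 (λ a → a :- con 0ℚ := a) ≈-refl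
        where open ℂ-Solver

abstract
  dominated-cong : ∀ {f h g} → (∀ n → f n ≈ h n) → Dominated f g → Dominated h g
  dominated-cong {f} {h} f≈h dom = record
    { nonNeg = nonNeg dom ; null = null dom ; step = λ n → ∥∥-cong {f n} {h n} (f≈h n) (step dom n) }

  dominated-+ : ∀ {f f′ g g′} → Dominated f g → Dominated f′ g′ →
                Dominated (λ n → f n + f′ n) (λ n → g n ℚ.+ g′ n)
  dominated-+ {g = g} {g′} dom dom′ = record
    { nonNeg = λ n → +-nonNeg (nonNeg dom n) (nonNeg dom′ n)
    ; null   = Null-+ (null dom) (null dom′)
    ; step   = λ n → ∥∥-mono (ℚP.≤-reflexive (eq (g n) (g (suc n)) (g′ n) (g′ (suc n))))
                       (∥∥-+ (step dom n) (step dom′ n))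
    }
    where
    open +-*-Solver
    eq : ∀ a b c d → a ℚ.- b ℚ.+ (c ℚ.- d) ≡ a ℚ.+ c ℚ.- (b ℚ.+ d)
    eq = solve 4 (λ a b c d → a :- b :+ (c :- d) := a :+ c :- (b :+ d)) refl

  dominated-* : ∀ {f} {u : ℕ → ℂ} {g p} → Dominated f g → (∀ n → ∥ u n ∥≤ p) →
                Dominated (λ n → f n * u n) (λ n → g n ℚ.* p)
  dominated-* {f} {u} {g} {p} dom u≤p = record
    { nonNeg = λ n → *-nonNeg (nonNeg dom n) 0≤p
    ; null   = Null-scale 0≤p (null dom)
    ; step   = λ n → ∥∥-mono (ℚP.≤-reflexive (eq (g n) (g (suc n)) p))
                       (∥∥-* {f n} {u n} (step dom n) (u≤p n))
    }
    where
    open +-*-Solver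
    0≤p : 0ℚ ℚ.≤ p
    0≤p = ∥∥-nonNeg (u≤p 0)
    eq : ∀ a b p → (a ℚ.- b) ℚ.* p ≡ a ℚ.* p ℚ.- b ℚ.* p
    eq = solve 3 (λ a b p → (a :- b) :* p := a :* p :- b :* p) refl

-- Little-o sequences

infixr 8 _^ℚ_

_^ℚ_ : ℚ → ℕ → ℚ
p ^ℚ zero  = 1ℚ
p ^ℚ suc n = p ℚ.* p ^ℚ n

abstract
  approx-^ᴿ : ∀ x n k → approx (x ^ᴿ n) k ≡ approx x k ^ℚ n
  approx-^ᴿ x zero    k = refl
  approx-^ᴿ x (suc n) k = cong (approx x k ℚ.*_) (approx-^ᴿ x n k)

  ^ℚ-nonNeg : ∀ {p} → 0ℚ ℚ.≤ p → ∀ n → 0ℚ ℚ.≤ p ^ℚ n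
  ^ℚ-nonNeg 0≤p zero    = ℚP.<⇒≤ 0<1
  ^ℚ-nonNeg 0≤p (suc n) = *-nonNeg 0≤p (^ℚ-nonNeg 0≤p n)

  ι-^ : ∀ m n → ι (m ℕ.^ n) ≡ ι m ^ℚ n
  ι-^ m zero    = refl
  ι-^ m (suc n) = trans (ι-* m (m ℕ.^ n)) (cong (ι m ℚ.*_) (ι-^ m n))

  -- Induction by mx + 1 ≤ (m + 1)(x + 1).
  ^ℚ-+1< : ∀ {p m} → 0ℚ ℚ.≤ m → m ℚ.+ 1ℚ ℚ.< p → ∀ n → m ^ℚ suc n ℚ.+ 1ℚ ℚ.< p ^ℚ suc n
  ^ℚ-+1< {p} {m} 0≤m m+1<p zero = subst₂ ℚ._<_
    (cong (ℚ._+ 1ℚ) (sym (ℚP.*-identityʳ m))) (sym (ℚP.*-identityʳ p)) m+1<p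
  ^ℚ-+1< {p} {m} 0≤m m+1<p (suc n) = ℚP.≤-<-trans
    (≤-diff (m ℚ.+ m ^ℚ suc n) (+-nonNeg 0≤m (^ℚ-nonNeg 0≤m (suc n))) (eq m (m ^ℚ suc n)))
    (ℚP.<-trans (ℚP.*-monoʳ-<-pos (m ℚ.+ 1ℚ) {{ℚ.positive 0<m+1}} ih)
      (ℚP.*-monoˡ-<-pos (p ^ℚ suc n) {{ℚ.positive 0<pⁿ}} m+1<p))
    where
    open +-*-Solver
    ih : m ^ℚ suc n ℚ.+ 1ℚ ℚ.< p ^ℚ suc n
    ih = ^ℚ-+1< 0≤m m+1<p n
    0<m+1 : 0ℚ ℚ.< m ℚ.+ 1ℚ
    0<m+1 = ℚP.+-mono-≤-< {0ℚ} {m} {0ℚ} 0≤m 0<1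
    0<pⁿ : 0ℚ ℚ.< p ^ℚ suc n
    0<pⁿ = ℚP.<-trans (ℚP.+-mono-≤-< {0ℚ} {m ^ℚ suc n} {0ℚ} (^ℚ-nonNeg 0≤m (suc n)) 0<1) ih
    eq : ∀ m x → m ℚ.* x ℚ.+ 1ℚ ℚ.+ (m ℚ.+ x) ≡ (m ℚ.+ 1ℚ) ℚ.* (x ℚ.+ 1ℚ)
    eq = solve 2 (λ m x → m :* x :+ con 1ℚ :+ (m :+ x) := (m :+ con 1ℚ) :* (x :+ con 1ℚ)) refl

  -- The substitute for extracting a root: an error of 1 in the power costs at most 1 in the base.
  root-bound : ∀ {p m} → 0ℚ ℚ.≤ m → ∀ n → p ^ℚ suc n ℚ.≤ m ^ℚ suc n ℚ.+ 1ℚ → p ℚ.≤ m ℚ.+ 1ℚ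
  root-bound 0≤m n h = ℚP.≮⇒≥ λ m+1<p → ℚP.<-irrefl refl (ℚP.<-≤-trans (^ℚ-+1< 0≤m m+1<p n) h)

  square-cancel-≤ : ∀ {p q} → 0ℚ ℚ.≤ p → 0ℚ ℚ.≤ q → p ℚ.* p ℚ.≤ q ℚ.* q → p ℚ.≤ q
  square-cancel-≤ {p} {q} 0≤p 0≤q h = ℚP.≮⇒≥ λ q<p → ℚP.<-irrefl refl (ℚP.≤-<-trans
    (ℚP.≤-trans h (ℚP.*-monoˡ-≤-nonNeg q {{ℚ.nonNegative 0≤q}} (ℚP.<⇒≤ q<p)))
    (ℚP.*-monoˡ-<-pos p {{ℚ.positive (ℚP.≤-<-trans 0≤q q<p)}} q<p))

  /-*-ι : ∀ a b → (+ a ℚ./ suc b) ℚ.* ι (suc b) ≡ ι a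
  /-*-ι a b = ℚP.toℚᵘ-injective (begin
    ℚ.toℚᵘ ((+ a ℚ./ suc b) ℚ.* ι (suc b))             ≈⟨ ℚP.toℚᵘ-homo-* (+ a ℚ./ suc b) (ι (suc b)) ⟩
    ℚ.toℚᵘ (+ a ℚ./ suc b) ℚᵘ.* ℚ.toℚᵘ (ι (suc b))     ≈⟨ ℚᵘP.*-cong (ℚP.toℚᵘ-fromℚᵘ (ℚᵘ.mkℚᵘ (+ a) b)) (ℚP.toℚᵘ-fromℚᵘ (ℚᵘ.mkℚᵘ (+ suc b) 0)) ⟩
    ℚᵘ.mkℚᵘ (+ a) b ℚᵘ.* ℚᵘ.mkℚᵘ (+ suc b) 0          ≈⟨ ℚᵘ.*≡* (eq (+ a) b) ⟩
    ℚᵘ.mkℚᵘ (+ a) 0                                     ≈⟨ ℚP.toℚᵘ-fromℚᵘ (ℚᵘ.mkℚᵘ (+ a) 0) ⟨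
    ℚ.toℚᵘ (ι a)                                        ∎)
    where
    open SetoidReasoning ℚᵘP.≃-setoid
    eq : ∀ a b → a ℤ.* + suc b ℤ.* + 1 ≡ a ℤ.* + suc (b ℕ.* 1)
    eq a b = trans (ℤP.*-identityʳ (a ℤ.* + suc b))
      (cong (λ n → a ℤ.* + suc n) (sym (ℕP.*-identityʳ b)))

  inv-unique : ∀ {p q} → p ℚ.* q ≡ 1ℚ → p ≡ inv q
  inv-unique {p} {q} pq = trans (sym (ℚP.*-identityʳ p))
    (trans (cong (p ℚ.*_) (sym (inv-inverse q q≢0)))
    (trans (eq p q (inv q)) (trans (cong (ℚ._* inv q) pq) (ℚP.*-identityˡ (inv q)))))
    where
    open +-*-Solver
    q≢0 : q ≢ 0ℚ
    q≢0 refl = contradiction (trans (sym pq) (ℚP.*-zeroʳ p)) ℚP.1≢0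
    eq : ∀ p q i → p ℚ.* (i ℚ.* q) ≡ p ℚ.* q ℚ.* i
    eq = solve 3 (λ p q i → p :* (i :* q) := p :* q :* i) refl

  inv-ι-inverse : ∀ n → inv (ι (suc n)) ℚ.* ι (suc n) ≡ 1ℚ
  inv-ι-inverse n = inv-inverse (ι (suc n)) (pos⇒≢0 (ι-pos n))

  inv-^ℚ : ∀ {p q} n → p ℚ.* q ≡ 1ℚ → p ^ℚ n ℚ.* q ^ℚ n ≡ 1ℚ
  inv-^ℚ zero    pq = refl
  inv-^ℚ {p} {q} (suc n) pq = trans (eq p q (p ^ℚ n) (q ^ℚ n)) (cong₂ ℚ._*_ pq (inv-^ℚ n pq))
    where
    open +-*-Solver
    eq : ∀ p q x y → p ℚ.* x ℚ.* (q ℚ.* y) ≡ p ℚ.* q ℚ.* (x ℚ.* y)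
    eq = solve 4 (λ p q x y → p :* x :* (q :* y) := p :* q :* (x :* y)) refl

  1/ℚ≡ : ∀ n j → 1/ℚ suc n ^ j ≡ inv (ι (suc n)) ^ℚ j
  1/ℚ≡ n j = trans (inv-unique (unit (suc n ℕ.^ j) {{ℕP.m^n≢0 (suc n) j}}))
    (sym (inv-unique (trans (cong (inv (ι (suc n)) ^ℚ j ℚ.*_) (ι-^ (suc n) j)) (inv-^ℚ j (inv-ι-inverse n)))))
    where
    unit : ∀ m .{{_ : ℕ.NonZero m}} → (+ 1 ℚ./ m) ℚ.* ι m ≡ 1ℚ
    unit (suc m) = /-*-ι 1 m

  ∥∥-ofℚ : ∀ {q} → 0ℚ ℚ.≤ q → ∥ ofℚ q ∥≤ q
  ∥∥-ofℚ {q} 0≤q = mk∥∥ λ ε 0<ε → 0 , λ n _ → ℚP.≤-trans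
    (ℚP.≤-reflexive (trans (ℚP.+-identityʳ ℚ.∣ q ∣) (ℚP.0≤p⇒∣p∣≡p 0≤q)))
    (≤-diff ε (ℚP.<⇒≤ 0<ε) refl)

  Null-suc : ∀ {g} → Null (λ n → g (suc n)) → Null g
  Null-suc null ε 0<ε = let N , h = null ε 0<ε in suc N , λ { (suc n) (s≤s N≤n) → h n N≤n }

  Null-≤ : ∀ {g h} → (∀ n → h n ℚ.≤ g n) → Null g → Null h
  Null-≤ h≤g null ε 0<ε = eventually-map (λ n → ℚP.≤-trans (h≤g n)) (null ε 0<ε)

-- The growth condition says nothing about finitely many initial terms. Each of them is prepended
-- with a bound of its own norm as the decrement.
dominated-from : ∀ N (f : ℕ → ℂ) (g : ℕ → ℚ) → (∀ n → 0ℚ ℚ.≤ g n) → Null g →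
  (∀ n → N ℕ.≤ n → ∥ f n ∥≤ g n ℚ.- g (suc n)) → ∃[ h ] Dominated f h
dominated-from zero    f g 0≤g g→0 h =
  g , record { nonNeg = 0≤g ; null = g→0 ; step = λ n → h n z≤n }
dominated-from (suc N) f g 0≤g g→0 h =
  let q , b   = ∥∥-total (f 0)
      g′ , dom = dominated-from N (λ n → f (suc n)) (λ n → g (suc n)) (λ n → 0≤g (suc n))
                   (λ ε 0<ε → let M , k = g→0 ε 0<ε in M , λ n M≤n → k (suc n) (ℕP.m≤n⇒m≤1+n M≤n))
                   (λ n N≤n → h (suc n) (s≤s N≤n))
  in (λ { zero → g′ 0 ℚ.+ q ; (suc n) → g′ n }) , record
    { nonNeg = λ { zero → +-nonNeg (nonNeg dom 0) (∥∥-nonNeg b) ; (suc n) → nonNeg dom n }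
    ; null   = Null-suc (null dom)
    ; step   = λ { zero → ∥∥-mono (ℚP.≤-reflexive (eq (g′ 0) q)) b ; (suc n) → step dom n }
    }
  where
  open +-*-Solver
  eq : ∀ a q → q ≡ a ℚ.+ q ℚ.- a
  eq = solve 2 (λ a q → q := a :+ q :- a) refl

-- Integer majorants on blocks of indices

abstract
  ^-distribʳ-* : ∀ m n k → (m ℕ.* n) ℕ.^ k ≡ m ℕ.^ k ℕ.* n ℕ.^ k
  ^-distribʳ-* m n zero    = refl
  ^-distribʳ-* m n (suc k) = trans (cong (m ℕ.* n ℕ.*_) (^-distribʳ-* m n k))
    (ℕP.[m*n]*[o*p]≡[m*o]*[n*p] m n (m ℕ.^ k) (n ℕ.^ k))

-- For n = suc i put j = level i, so that (2M)ʲ ≤ n < (2M)ʲ⁺¹.  The decrements of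
-- g i = 4 (2 Mʲ⁺¹/n + 2 M/2ʲ) are at least 4 Mʲ⁺¹/n²: inside a block because
-- 2/n - 2/(n+1) ≥ 1/n², and at the end of a block because the drop of 2 M/2ʲ pays for
-- the increase of Mʲ⁺¹/n.
module Blocks (M : ℕ) (1≤M : 1 ℕ.≤ M) where

  b : ℕ
  b = 2 ℕ.* M

  level : ℕ → ℕ
  level zero = zero
  level (suc i) with suc (suc i) ℕ.<? b ℕ.^ suc (level i)
  ... | yes _ = level i
  ... | no  _ = suc (level i)

  data Step (i : ℕ) : Set where
    stay : level (suc i) ≡ level i → suc (suc i) ℕ.< b ℕ.^ suc (level i) → Step i
    jump : level (suc i) ≡ suc (level i) → b ℕ.^ suc (level i) ℕ.≤ suc (suc i) → Step i

  step? : ∀ i → Step i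
  step? i with suc (suc i) ℕ.<? b ℕ.^ suc (level i) in eq
  ... | yes p = stay (lemma eq) p
    where
    lemma : (suc (suc i) ℕ.<? b ℕ.^ suc (level i)) ≡ yes p → level (suc i) ≡ level i
    lemma eq rewrite eq = refl
  ... | no ¬p = jump (lemma eq) (ℕP.≮⇒≥ ¬p)
    where
    lemma : (suc (suc i) ℕ.<? b ℕ.^ suc (level i)) ≡ no ¬p → level (suc i) ≡ suc (level i)
    lemma eq rewrite eq = refl

  2≤b : 2 ℕ.≤ b
  2≤b = ℕP.*-monoʳ-≤ 2 1≤M

  abstract
    ≤level : ∀ i → b ℕ.^ level i ℕ.≤ suc i
    ≤level zero    = ℕP.≤-refl
    ≤level (suc i) with step? i
    ... | stay e p = subst (λ j → b ℕ.^ j ℕ.≤ suc (suc i)) (sym e) (ℕP.m≤n⇒m≤1+n (≤level i))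
    ... | jump e p = subst (λ j → b ℕ.^ j ℕ.≤ suc (suc i)) (sym e) p

    level< : ∀ i → suc i ℕ.< b ℕ.^ suc (level i)
    level< zero    = subst (1 ℕ.<_) (sym (ℕP.*-identityʳ b)) 2≤b
    level< (suc i) with step? i
    ... | stay e p = subst (λ j → suc (suc i) ℕ.< b ℕ.^ suc j) (sym e) p
    ... | jump e p = subst (λ j → suc (suc i) ℕ.< b ℕ.^ suc j) (sym e)
      (ℕP.<-≤-trans
        (ℕP.≤-<-trans (level< i) (ℕP.^-monoʳ-< b 2≤b (ℕP.n<1+n (suc (level i))))) ℕP.≤-refl)

    -- Indices grow by one, so a block begins exactly at a power of b, where the value of `g` is
    -- known exactly.
    jump-≡ : ∀ {i} → b ℕ.^ suc (level i) ℕ.≤ suc (suc i) → suc (suc i) ≡ b ℕ.^ suc (level i)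
    jump-≡ {i} p = ℕP.≤-antisym (level< i) p

  bound-at : (m a w : ℚ) → ℚ
  bound-at m a w = ι 4 ℚ.* (ι 2 ℚ.* (m ℚ.* a) ℚ.+ ι 2 ℚ.* (ι M ℚ.* w))

  a w m g : ℕ → ℚ
  a i = inv (ι (suc i))
  w j = inv (ι (2 ℕ.^ j))
  m j = ι (M ℕ.^ suc j)
  g i = bound-at (m (level i)) (a i) (w (level i))

  abstract
    ι-pos′ : ∀ {n} → 1 ℕ.≤ n → 0ℚ ℚ.< ι n
    ι-pos′ {suc n} _ = ι-pos n

    1≤^ : ∀ {n} → 1 ℕ.≤ n → ∀ j → 1 ℕ.≤ n ℕ.^ j
    1≤^ {suc n} _ j = ℕP.m^n>0 (suc n) j

    a-pos : ∀ i → 0ℚ ℚ.< a i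
    a-pos i = inv-pos (ι-pos i)

    w-pos : ∀ j → 0ℚ ℚ.< w j
    w-pos j = inv-pos (ι-pos′ (1≤^ (s≤s z≤n) j))

    w-inverse : ∀ j → w j ℚ.* ι (2 ℕ.^ j) ≡ 1ℚ
    w-inverse j = inv-inverse (ι (2 ℕ.^ j)) (pos⇒≢0 (ι-pos′ (1≤^ (s≤s z≤n) j)))

    w-suc : ∀ j → w j ≡ ι 2 ℚ.* w (suc j)
    w-suc j = sym (inv-unique (trans (eq (ι 2) (w (suc j)) (ι (2 ℕ.^ j)))
      (trans (cong (w (suc j) ℚ.*_) (sym (ι-* 2 (2 ℕ.^ j)))) (w-inverse (suc j)))))
      where
      open +-*-Solver
      eq : ∀ t w x → t ℚ.* w ℚ.* x ≡ w ℚ.* (t ℚ.* x)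
      eq = solve 3 (λ t w x → t :* w :* x := w :* (t :* x)) refl

    m-nonNeg : ∀ j → 0ℚ ℚ.≤ m j
    m-nonNeg j = ι-nonNeg (M ℕ.^ suc j)

    1≤m : ∀ j → 1ℚ ℚ.≤ m j
    1≤m j = ι-mono (1≤^ 1≤M (suc j))

    -- The reason for the base b = 2M: the majorant divided by the end of its block is a power of
    -- 1/2.
    m*inv-b : ∀ j → m j ℚ.* inv (ι (b ℕ.^ suc j)) ≡ w (suc j)
    m*inv-b j = inv-unique (trans (eq (m j) (inv (ι (b ℕ.^ suc j))) (ι (2 ℕ.^ suc j)))
      (trans (cong (inv (ι (b ℕ.^ suc j)) ℚ.*_)
        (trans (sym (ι-* (2 ℕ.^ suc j) (M ℕ.^ suc j))) (cong ι (sym (^-distribʳ-* 2 M (suc j))))))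
        (inv-inverse (ι (b ℕ.^ suc j)) (pos⇒≢0 (ι-pos′ (1≤^ (ℕP.≤-trans (s≤s z≤n) 2≤b) (suc j)))))))
      where
      open +-*-Solver
      eq : ∀ m i t → m ℚ.* i ℚ.* t ≡ i ℚ.* (t ℚ.* m)
      eq = solve 3 (λ m i t → m :* i :* t := i :* (t :* m)) refl

    a²≤ : ∀ i → a i ℚ.* a i ℚ.≤ ι 2 ℚ.* (a i ℚ.- a (suc i))
    -- For n = i + 1 the difference of the two sides is (n - 1)/(n²(n + 1)), hence the factor `ι i`.
    a²≤ i = ≤-diff (a i ℚ.* (a i ℚ.* a (suc i)) ℚ.* ι i)
      (*-nonNeg (*-nonNeg 0≤a (*-nonNeg 0≤a (ℚP.<⇒≤ (a-pos (suc i))))) (ι-nonNeg i))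
      (trans (cong (λ x → x ℚ.+ a i ℚ.* (a i ℚ.* a (suc i)) ℚ.* ι i) (times-1 (a i ℚ.* a i) u₁))
        (trans (eq₁ (a i) (a (suc i)) (ι i))
        (trans (cong (λ x → ι 2 ℚ.* (x ℚ.* (a i ℚ.* a (suc i)))) u₀)
        (cong (ι 2 ℚ.*_) (trans (eq₂ (a i) (a (suc i)) (ι i))
          (sym (cong₂ ℚ._-_ (times-1 (a i) u₁) (times-1 (a (suc i)) u₀))))))))
      where
      open +-*-Solver
      0≤a : 0ℚ ℚ.≤ a i
      0≤a = ℚP.<⇒≤ (a-pos i)
      u₀ : a i ℚ.* (1ℚ ℚ.+ ι i) ≡ 1ℚ
      u₀ = trans (cong (a i ℚ.*_) (sym (ι-suc i))) (inv-ι-inverse i)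
      u₁ : a (suc i) ℚ.* (1ℚ ℚ.+ (1ℚ ℚ.+ ι i)) ≡ 1ℚ
      u₁ = trans (cong (a (suc i) ℚ.*_) (trans (cong (1ℚ ℚ.+_) (sym (ι-suc i))) (sym (ι-suc (suc i)))))
             (inv-ι-inverse (suc i))
      times-1 : ∀ x {y} → y ≡ 1ℚ → x ≡ x ℚ.* y
      times-1 x refl = sym (ℚP.*-identityʳ x)
      eq₁ : ∀ a c n → a ℚ.* a ℚ.* (c ℚ.* (1ℚ ℚ.+ (1ℚ ℚ.+ n))) ℚ.+ a ℚ.* (a ℚ.* c) ℚ.* n ≡
            ι 2 ℚ.* (a ℚ.* (1ℚ ℚ.+ n) ℚ.* (a ℚ.* c))
      eq₁ = solve 3 (λ a c n → a :* a :* (c :* (con 1ℚ :+ (con 1ℚ :+ n))) :+ a :* (a :* c) :* n :=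
            con (ι 2) :* (a :* (con 1ℚ :+ n) :* (a :* c))) refl
      eq₂ : ∀ a c n → 1ℚ ℚ.* (a ℚ.* c) ≡ a ℚ.* (c ℚ.* (1ℚ ℚ.+ (1ℚ ℚ.+ n))) ℚ.- c ℚ.* (a ℚ.* (1ℚ ℚ.+ n))
      eq₂ = solve 3 (λ a c n → con 1ℚ :* (a :* c) :=
            a :* (c :* (con 1ℚ :+ (con 1ℚ :+ n))) :- c :* (a :* (con 1ℚ :+ n))) refl

    a≤1 : ∀ i → a i ℚ.≤ 1ℚ
    a≤1 i = subst (a i ℚ.≤_) (sym (inv-unique {1ℚ} {ι 1} refl))
      (inv-anti (ι-pos 0) (ι-mono {1} {suc i} (s≤s z≤n)))

    g-nonNeg : ∀ i → 0ℚ ℚ.≤ g i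
    g-nonNeg i = *-nonNeg (ι-nonNeg 4) (+-nonNeg
      (*-nonNeg (ι-nonNeg 2) (*-nonNeg (m-nonNeg (level i)) (ℚP.<⇒≤ (a-pos i))))
      (*-nonNeg (ι-nonNeg 2) (*-nonNeg (ι-nonNeg M) (ℚP.<⇒≤ (w-pos (level i))))))

    bound-at-stay : ∀ {m a a′ w} → 0ℚ ℚ.≤ m → a ℚ.* a ℚ.≤ ι 2 ℚ.* (a ℚ.- a′) →
                    ι 4 ℚ.* m ℚ.* (a ℚ.* a) ℚ.≤ bound-at m a w ℚ.- bound-at m a′ w
    bound-at-stay {m} {a} {a′} {w} 0≤m h = ℚP.≤-trans
      (ℚP.*-monoˡ-≤-nonNeg (ι 4 ℚ.* m) {{ℚ.nonNegative (*-nonNeg (ι-nonNeg 4) 0≤m)}} h)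
      (ℚP.≤-reflexive (eq m a a′ (ι 2 ℚ.* (ι M ℚ.* w))))
      where
      open +-*-Solver
      eq : ∀ m a c v → ι 4 ℚ.* m ℚ.* (ι 2 ℚ.* (a ℚ.- c)) ≡
           ι 4 ℚ.* (ι 2 ℚ.* (m ℚ.* a) ℚ.+ v) ℚ.- ι 4 ℚ.* (ι 2 ℚ.* (m ℚ.* c) ℚ.+ v)
      eq = solve 4 (λ m a c v → con (ι 4) :* m :* (con (ι 2) :* (a :- c)) :=
           con (ι 4) :* (con (ι 2) :* (m :* a) :+ v) :- con (ι 4) :* (con (ι 2) :* (m :* c) :+ v)) refl

    -- Inside the outer factor 4, the term 2Mw = 4Mw′ equals the whole next value 2m′a′ + 2Mw′. What
    -- remains is 8ma, and 4ma² is at most that because a ≤ 1.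
    bound-at-jump : ∀ {m a m′ a′ w w′} → 0ℚ ℚ.≤ m → 0ℚ ℚ.≤ a → a ℚ.≤ 1ℚ →
                    m′ ℚ.* a′ ≡ ι M ℚ.* w′ → w ≡ ι 2 ℚ.* w′ →
                    ι 4 ℚ.* m ℚ.* (a ℚ.* a) ℚ.≤ bound-at m a w ℚ.- bound-at m′ a′ w′
    bound-at-jump {m} {a} {m′} {a′} {w} {w′} 0≤m 0≤a a≤1 e refl = ℚP.≤-trans
      (ℚP.*-monoˡ-≤-nonNeg (ι 4 ℚ.* m) {{ℚ.nonNegative (*-nonNeg (ι-nonNeg 4) 0≤m)}}
        (ℚP.*-monoʳ-≤-nonNeg a {{ℚ.nonNegative 0≤a}} (ℚP.≤-trans a≤1 (ι-mono {1} {2} (s≤s z≤n)))))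
      (ℚP.≤-reflexive (trans (eq m a (ι M) w′)
        (cong (λ y → bound-at m a (ι 2 ℚ.* w′) ℚ.- ι 4 ℚ.* (ι 2 ℚ.* y ℚ.+ ι 2 ℚ.* (ι M ℚ.* w′))) (sym e))))
      where
      open +-*-Solver
      eq : ∀ m a M w → ι 4 ℚ.* m ℚ.* (ι 2 ℚ.* a) ≡
           ι 4 ℚ.* (ι 2 ℚ.* (m ℚ.* a) ℚ.+ ι 2 ℚ.* (M ℚ.* (ι 2 ℚ.* w))) ℚ.-
           ι 4 ℚ.* (ι 2 ℚ.* (M ℚ.* w) ℚ.+ ι 2 ℚ.* (M ℚ.* w))
      eq = solve 4 (λ m a M w → con (ι 4) :* m :* (con (ι 2) :* a) :=
           con (ι 4) :* (con (ι 2) :* (m :* a) :+ con (ι 2) :* (M :* (con (ι 2) :* w))) :-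
           con (ι 4) :* (con (ι 2) :* (M :* w) :+ con (ι 2) :* (M :* w))) refl

    m*a-jump : ∀ i → b ℕ.^ suc (level i) ℕ.≤ suc (suc i) →
               m (suc (level i)) ℚ.* a (suc i) ≡ ι M ℚ.* w (suc (level i))
    m*a-jump i p = trans (cong₂ ℚ._*_ (ι-* M (M ℕ.^ suc (level i))) (cong (λ n → inv (ι n)) (jump-≡ p)))
      (trans (ℚP.*-assoc (ι M) (m (level i)) (inv (ι (b ℕ.^ suc (level i)))))
             (cong (ι M ℚ.*_) (m*inv-b (level i))))

    g-step : ∀ i → ι 4 ℚ.* m (level i) ℚ.* (a i ℚ.* a i) ℚ.≤ g i ℚ.- g (suc i)
    g-step i = by-cases (step? i)
      where
      Goal : ℕ → Set
      Goal l = ι 4 ℚ.* m (level i) ℚ.* (a i ℚ.* a i) ℚ.≤ g i ℚ.- bound-at (m l) (a (suc i)) (w l)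
      by-cases : Step i → Goal (level (suc i))
      by-cases (stay e p) = subst Goal (sym e)
        (bound-at-stay {m (level i)} {a i} {a (suc i)} {w (level i)} (m-nonNeg (level i)) (a²≤ i))
      by-cases (jump e p) = subst Goal (sym e)
        (bound-at-jump {m (level i)} {a i} {m (suc (level i))} {a (suc i)}
          (m-nonNeg (level i)) (ℚP.<⇒≤ (a-pos i)) (a≤1 i) (m*a-jump i p) (w-suc (level i)))

    -- Because n ≥ bʲ on the block. It makes `g` of order 2⁻ʲ, hence null.
    m*a≤ : ∀ i → m (level i) ℚ.* a i ℚ.≤ ι M ℚ.* w (level i)
    m*a≤ i = ℚP.≤-trans
      (ℚP.*-monoˡ-≤-nonNeg (m j) {{ℚ.nonNegative (m-nonNeg j)}}
        (inv-anti (ι-pos′ (1≤^ (ℕP.≤-trans (s≤s z≤n) 2≤b) j)) (ι-mono (≤level i))))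
      (ℚP.≤-reflexive (trans (cong (ℚ._* inv (ι (b ℕ.^ j))) (ι-* M (M ℕ.^ j)))
        (trans (ℚP.*-assoc (ι M) (ι (M ℕ.^ j)) (inv (ι (b ℕ.^ j)))) (cong (ι M ℚ.*_) (M*inv-b j)))))
      where
      j : ℕ
      j = level i
      M*inv-b : ∀ j → ι (M ℕ.^ j) ℚ.* inv (ι (b ℕ.^ j)) ≡ w j
      M*inv-b zero    = ℚP.*-identityˡ (w 0)
      M*inv-b (suc j) = m*inv-b j

    w-null : Null (λ i → w (level i))
    w-null ε 0<ε =
      let N , h = Null-inv-ι ε 0<ε in
      b ℕ.^ N , λ i b^N≤i → ℚP.≤-trans
        (inv-anti (ι-pos (level i)) (ι-mono (<2^ (level i))))
        -- For i ≥ bᴺ a level below N would give i + 1 < bᴺ by `level<`.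
        (h (level i) (ℕP.≮⇒≥ λ level<N → ℕP.<⇒≱ (level< i)
          (ℕP.≤-trans (ℕP.^-monoʳ-≤ b {{ℕ.>-nonZero (ℕP.≤-trans (s≤s z≤n) 2≤b)}} level<N)
            (ℕP.m≤n⇒m≤1+n b^N≤i))))
      where
      <2^ : ∀ j → suc j ℕ.≤ 2 ℕ.^ j
      <2^ zero    = ℕP.≤-refl
      <2^ (suc j) = ℕP.≤-trans (s≤s (<2^ j)) (ℕP.≤-trans
        (ℕP.+-monoˡ-≤ (2 ℕ.^ j) (1≤^ (s≤s z≤n) j))
        (ℕP.+-monoʳ-≤ (2 ℕ.^ j) (ℕP.m≤m+n (2 ℕ.^ j) 0)))

    g-null : Null g
    g-null = Null-≤
      (λ i → ℚP.≤-trans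
        (ℚP.*-monoˡ-≤-nonNeg (ι 4) (ℚP.+-monoˡ-≤ (ι 2 ℚ.* (ι M ℚ.* w (level i)))
          (ℚP.*-monoˡ-≤-nonNeg (ι 2) (m*a≤ i))))
        (ℚP.≤-reflexive (eq (ι M) (w (level i)))))
      (Null-scale (*-nonNeg (ι-nonNeg 16) (ι-nonNeg M)) w-null)
      where
      open +-*-Solver
      eq : ∀ M w → ι 4 ℚ.* (ι 2 ℚ.* (M ℚ.* w) ℚ.+ ι 2 ℚ.* (M ℚ.* w)) ≡ w ℚ.* (ι 16 ℚ.* M)
      eq = solve 2 (λ M w → con (ι 4) :* (con (ι 2) :* (M :* w) :+ con (ι 2) :* (M :* w)) :=
                            w :* (con (ι 16) :* M)) refl

-- e / (e + 1)
exponent : ℕ → ℚ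
exponent e = ℚ.mkℚ (+ e) e
  (Coprime.sym (subst (λ d → Coprime.Coprime d e) (ℕP.+-comm e 1)
    (Coprime.coprime-+ (Coprime.1-coprimeTo e))))

abstract
  exponent+inv : ∀ e → exponent e ℚ.+ inv (ι (suc e)) ≡ 1ℚ
  exponent+inv e = trans (sym (ℚP.*-identityʳ (x ℚ.+ i)))
    (trans (cong ((x ℚ.+ i) ℚ.*_) (sym (inv-ι-inverse e)))
    (trans (eq x i (ι (suc e)))
    (trans (cong₂ (λ p q → i ℚ.* (p ℚ.+ q)) (inv-ι-inverse e) x*ι)
    (trans (cong (i ℚ.*_) (sym (ι-suc e))) (inv-ι-inverse e)))))
    where
    open +-*-Solver
    x i : ℚ
    x = exponent e
    i = inv (ι (suc e))
    x*ι : x ℚ.* ι (suc e) ≡ ι e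
    x*ι = trans (cong (ℚ._* ι (suc e)) (sym (ℚP.normalize-coprime {e} {e}
      (Coprime.sym (subst (λ d → Coprime.Coprime d e) (ℕP.+-comm e 1)
        (Coprime.coprime-+ (Coprime.1-coprimeTo e))))))) (/-*-ι e e)
    eq : ∀ x i d → (x ℚ.+ i) ℚ.* (i ℚ.* d) ≡ i ℚ.* (i ℚ.* d ℚ.+ x ℚ.* d)
    eq = solve 3 (λ x i d → (x :+ i) :* (i :* d) := i :* (i :* d :+ x :* d)) refl

  -- As c + gap ≤ 1, choosing 1/(e + 1) ≤ gap/2 leaves the other half of the gap between c and 1 -
  -- 1/(e + 1) = e/(e + 1).
  below-exponent : ∀ {c} → c <ᴿ 1ᴿ → ∃[ e ] c <ᴿ fromℚ (exponent e)
  below-exponent {c} (mk< gap 0<gap N apart) =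
    let e , h = Null-inv-ι (½ ℚ.* gap) (*-pos 0<½ 0<gap)
    in e , mk< (½ ℚ.* gap) (*-pos 0<½ 0<gap) N λ n N≤n → ≤-diff
      (1ℚ ℚ.- (approx c n ℚ.+ gap) ℚ.+ (½ ℚ.* gap ℚ.- inv (ι (suc e))))
      (+-nonNeg (diff-nonNeg (apart n N≤n)) (diff-nonNeg (h e ℕP.≤-refl)))
      (trans (eq (approx c n) gap (½ ℚ.* gap) (inv (ι (suc e))))
        (trans (cong₂ (λ p q → p ℚ.+ q ℚ.- inv (ι (suc e)) ℚ.- gap) (½-double gap) (sym (exponent+inv e)))
          (eq′ gap (exponent e) (inv (ι (suc e))))))
    where
    open +-*-Solver
    eq : ∀ c g h i → c ℚ.+ h ℚ.+ (1ℚ ℚ.- (c ℚ.+ g) ℚ.+ (h ℚ.- i)) ≡ h ℚ.+ h ℚ.+ 1ℚ ℚ.- i ℚ.- g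
    eq = solve 4 (λ c g h i → c :+ h :+ (con 1ℚ :- (c :+ g) :+ (h :- i)) :=
                              h :+ h :+ con 1ℚ :- i :- g) refl
    eq′ : ∀ g x i → g ℚ.+ (x ℚ.+ i) ℚ.- i ℚ.- g ≡ x
    eq′ = solve 3 (λ g x i → g :+ (x :+ i) :- i :- g := x) refl

  size²≤2∣∣² : ∀ z n → size z n ℚ.* size z n ℚ.≤ ι 2 ℚ.* approx ∣ z ∣² n
  size²≤2∣∣² z n = ≤-diff ((p ℚ.- q) ℚ.* (p ℚ.- q)) (square-nonNeg (p ℚ.- q))
    (trans (eq p q) (cong (ι 2 ℚ.*_) (cong₂ ℚ._+_ (sym (∣∣-square (approx (re z) n)))
                                                   (sym (∣∣-square (approx (im z) n))))))
    where
    open +-*-Solver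
    p q : ℚ
    p = ℚ.∣ approx (re z) n ∣
    q = ℚ.∣ approx (im z) n ∣
    eq : ∀ p q → (p ℚ.+ q) ℚ.* (p ℚ.+ q) ℚ.+ (p ℚ.- q) ℚ.* (p ℚ.- q) ≡ ι 2 ℚ.* (p ℚ.* p ℚ.+ q ℚ.* q)
    eq = solve 2 (λ p q → (p :+ q) :* (p :+ q) :+ (p :- q) :* (p :- q) :=
                          con (ι 2) :* (p :* p :+ q :* q)) refl

module _ (e : ℕ) where

  private
    M : ℕ
    M = 2 ℕ.^ e

  open Blocks M (ℕP.m^n>0 2 e)

  abstract
    -- With M = 2ᵉ the base is b = 2ᵉ⁺¹, and n < bᴶ gives nᵉ ≤ 2^((e+1)Je) = (Mᴶ)ᵉ⁺¹. So the integer
    -- Mᴶ majorizes n^(e/(e+1)) on the whole block.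
    power-bound : ∀ n → ι (suc n ℕ.^ e) ℚ.≤ m (level n) ^ℚ suc e
    power-bound n = ℚP.≤-trans (ι-mono (ℕP.^-monoˡ-≤ e (ℕP.<⇒≤ (level< n))))
      (ℚP.≤-reflexive (trans (cong ι eq) (ι-^ (M ℕ.^ J) (suc e))))
      where
      J : ℕ
      J = suc (level n)
      eq : ((2 ℕ.^ suc e) ℕ.^ J) ℕ.^ e ≡ ((2 ℕ.^ e) ℕ.^ J) ℕ.^ suc e
      eq = trans (cong (ℕ._^ e) (ℕP.^-*-assoc 2 (suc e) J))
        (trans (ℕP.^-*-assoc 2 (suc e ℕ.* J) e)
        (trans (cong (2 ℕ.^_) exps)
        (sym (trans (cong (ℕ._^ suc e) (ℕP.^-*-assoc 2 e J)) (ℕP.^-*-assoc 2 (e ℕ.* J) (suc e))))))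
        where
        exps : suc e ℕ.* J ℕ.* e ≡ e ℕ.* J ℕ.* suc e
        exps = trans (ℕP.*-comm (suc e ℕ.* J) e) (trans (cong (e ℕ.*_) (ℕP.*-comm (suc e) J))
          (sym (ℕP.*-assoc e J (suc e))))

    power⇒∥∥≤ : ∀ {c t} z n → c <ᴿ fromℚ (exponent e) → IsPower (suc n) c t → ∣ z ∣≤ (1ᴿ *ᴿ t) →
                ∥ z ∥≤ ι 4 ℚ.* m (level n)
    power⇒∥∥≤ {c} {t} z n c<r isPow (_ , mk≤ z²≤t²) = mk∥∥ λ ε 0<ε → eventually-map₂
      (λ k 0≤t (tᴰ≤ , z²≤) → ℚP.≤-trans (size≤ k 0≤t tᴰ≤ z²≤) (≤-diff ε (ℚP.<⇒≤ 0<ε) refl))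
      t-nonNeg (eventually-map₂ (λ _ → _,_) tᴰ-bound (z²≤t² 1ℚ 0<1))
      where
      open +-*-Solver
      μ : ℚ
      μ = m (level n)
      0≤μ : 0ℚ ℚ.≤ μ
      0≤μ = m-nonNeg (level n)
      t-nonNeg : Eventually λ k → 0ℚ ℚ.≤ approx t k
      t-nonNeg with IsPower.positive isPow
      ... | mk< gap 0<gap N h = N , λ k N≤k →
        ℚP.≤-trans (subst (0ℚ ℚ.≤_) (sym (ℚP.+-identityˡ gap)) (ℚP.<⇒≤ 0<gap)) (h k N≤k)
      -- `exponent e` is in lowest terms by construction, so `upper` compares tᵉ⁺¹ with nᵉ; the
      -- slack 1 is what `root-bound` tolerates.
      tᴰ-bound : Eventually λ k → approx t k ^ℚ suc e ℚ.≤ μ ^ℚ suc e ℚ.+ 1ℚ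
      tᴰ-bound = eventually-map
        (λ k tᴰ≤ → ℚP.≤-trans (ℚP.≤-reflexive (sym (approx-^ᴿ t (suc e) k)))
          (ℚP.≤-trans tᴰ≤ (ℚP.+-monoˡ-≤ 1ℚ (power-bound n))))
        (_≤ᴿ_.almost (IsPower.upper isPow (exponent e) c<r) 1ℚ 0<1)
      -- t ≤ μ + 1 ≤ 2μ, hence size² ≤ 2 |z|² ≤ 2 (4μ² + μ²) ≤ (4μ)²
      size≤ : ∀ k → 0ℚ ℚ.≤ approx t k → approx t k ^ℚ suc e ℚ.≤ μ ^ℚ suc e ℚ.+ 1ℚ →
              approx ∣ z ∣² k ℚ.≤ 1ℚ ℚ.* approx t k ℚ.* (1ℚ ℚ.* approx t k) ℚ.+ 1ℚ →
              size z k ℚ.≤ ι 4 ℚ.* μ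
      size≤ k 0≤t tᴰ≤ z²≤ = square-cancel-≤ (size-nonNeg z k) (*-nonNeg (ι-nonNeg 4) 0≤μ)
        (ℚP.≤-trans (size²≤2∣∣² z k)
        (ℚP.≤-trans (ℚP.*-monoˡ-≤-nonNeg (ι 2) (ℚP.≤-trans z²≤ (ℚP.+-mono-≤
          (*-mono-≤ 0≤1*t 0≤1*t 1*t≤ 1*t≤)
          (*-mono-≤ {1ℚ} {μ} {1ℚ} {μ} (ℚP.<⇒≤ 0<1) (ℚP.<⇒≤ 0<1) (1≤m (level n)) (1≤m (level n))))))
        (≤-diff (ι 6 ℚ.* (μ ℚ.* μ)) (*-nonNeg (ι-nonNeg 6) (*-nonNeg 0≤μ 0≤μ)) (eq μ))))
        where
        0≤1*t : 0ℚ ℚ.≤ 1ℚ ℚ.* approx t k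
        0≤1*t = *-nonNeg (ℚP.<⇒≤ 0<1) 0≤t
        1*t≤ : 1ℚ ℚ.* approx t k ℚ.≤ μ ℚ.+ μ
        1*t≤ = ℚP.≤-trans (ℚP.≤-reflexive (ℚP.*-identityˡ (approx t k)))
          (ℚP.≤-trans (root-bound 0≤μ e tᴰ≤) (ℚP.+-monoʳ-≤ μ (1≤m (level n))))
        eq : ∀ μ → ι 2 ℚ.* ((μ ℚ.+ μ) ℚ.* (μ ℚ.+ μ) ℚ.+ μ ℚ.* μ) ℚ.+ ι 6 ℚ.* (μ ℚ.* μ) ≡
                   ι 4 ℚ.* μ ℚ.* (ι 4 ℚ.* μ)
        eq = solve 1 (λ μ → con (ι 2) :* ((μ :+ μ) :* (μ :+ μ) :+ μ :* μ) :+ con (ι 6) :* (μ :* μ) :=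
                            con (ι 4) :* μ :* (con (ι 4) :* μ)) refl

    ∥1/^2∥≤ : ∀ n → ∥ 1/ suc n ^ 2 ∥≤ a n ℚ.* a n
    ∥1/^2∥≤ n = subst (λ q → ∥ ofℚ q ∥≤ a n ℚ.* a n)
      (sym (trans (1/ℚ≡ n 2) (cong (a n ℚ.*_) (ℚP.*-identityʳ (a n)))))
      (∥∥-ofℚ (*-nonNeg (ℚP.<⇒≤ (a-pos n)) (ℚP.<⇒≤ (a-pos n))))

    dominated-exponent : ∀ {A c} → c <ᴿ fromℚ (exponent e) → A =o[k^ c ] →
                         ∃[ h ] Dominated (λ n → A (+ suc n) * 1/ suc n ^ 2) h
    dominated-exponent {A} c<r A=o =
      -- The growth condition is applied with ε = 1; the n-th summand has index n + 1, so N ≤ n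
      -- suffices.
      let N , bnd = A=o 1ᴿ (mk< 1ℚ 0<1 0 λ _ _ → ℚP.≤-refl)
      in dominated-from N _ g g-nonNeg g-null λ n N≤n →
        let t , isPow , A≤ = bnd (+ suc n) (ℕP.m≤n⇒m≤1+n N≤n)
        in ∥∥-mono {A (+ suc n) * 1/ suc n ^ 2} (g-step n)
          (∥∥-* {A (+ suc n)} {1/ suc n ^ 2} (power⇒∥∥≤ (A (+ suc n)) n c<r isPow A≤) (∥1/^2∥≤ n))

abstract
  little-o⇒dominated : ∀ {A} → (∃[ c ] c <ᴿ 1ᴿ × A =o[k^ c ]) →
                       ∃[ h ] Dominated (λ n → A (+ suc n) * 1/ suc n ^ 2) h
  little-o⇒dominated {A} (c , c<1 , A=o) =
    let e , c<r = below-exponent c<1 in dominated-exponent e {A} c<r A=o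

-- Finite sums and Dirichlet series

abstract
  -- Eventually size w ≤ L and size (zw - 1) ≤ 1/2, so size z is at least δ = 1/(2L). From size² ≤
  -- 2|z|² the square |z|² is then at least δ²/2, the required gap.
  invertible⇒≉0 : ∀ {z w} → z * w ≈ 1ᶜ → z ≉0
  invertible⇒≉0 {z} {w} zw≈1 =
    let K , w≤K = ∥∥-total w
        L       = K ℚ.+ 1ℚ
        0<L     = ℚP.+-mono-≤-< {0ℚ} {K} {0ℚ} (∥∥-nonNeg w≤K) 0<1
        δ       = inv L ℚ.* ½
        0<δ     = *-pos (inv-pos 0<L) 0<½
        0<½δ²   = *-pos 0<½ (*-pos 0<δ 0<δ)
        N , h   = eventually-map₂ {R = λ n → 0ℚ ℚ.+ ½ ℚ.* (δ ℚ.* δ) ℚ.≤ approx ∣ z ∣² n}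
                    (λ n b c → subst₂ ℚ._≤_ (sym (ℚP.+-identityˡ (½ ℚ.* (δ ℚ.* δ)))) (half-double (approx ∣ z ∣² n))
                      (ℚP.*-monoˡ-≤-nonNeg ½ (ℚP.≤-trans
                        (let δ≤ = δ≤size n L 0<L b c in *-mono-≤ (ℚP.<⇒≤ 0<δ) (ℚP.<⇒≤ 0<δ) δ≤ δ≤)
                        (size²≤2∣∣² z n))))
                    (bound w≤K 1ℚ 0<1) (bound (≈⇒∥∥ zw≈1) ½ 0<½)
    in inj₂ (mk< (½ ℚ.* (δ ℚ.* δ)) 0<½δ² N h)
    where
    open +-*-Solver
    half-double : ∀ p → ½ ℚ.* (ι 2 ℚ.* p) ≡ p
    half-double = solve 1 (λ p → con ½ :* (con (ι 2) :* p) := p) refl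
    1≤ : ∀ n → 1ℚ ℚ.≤ size z n ℚ.* size w n ℚ.+ size (z * w - 1ᶜ) n
    1≤ n = ℚP.≤-trans
      (ℚP.≤-reflexive (size-≗ {1ᶜ} {z * w + -ᶜ (z * w - 1ᶜ)}
        (mk≗ (λ n → eq (approx (re (z * w)) n) 1ℚ) (λ n → eq (approx (im (z * w)) n) 0ℚ)) n))
      (ℚP.≤-trans (size-+ (z * w) (-ᶜ (z * w - 1ᶜ)) n)
        (ℚP.+-mono-≤ (size-* z w n) (ℚP.≤-reflexive (size-neg (z * w - 1ᶜ) n))))
      where
      eq : ∀ a o → o ≡ a ℚ.+ ℚ.- (a ℚ.- o)
      eq = solve 2 (λ a o → o := a :+ :- (a :- o)) refl
    δ≤size : ∀ n L → 0ℚ ℚ.< L → size w n ℚ.≤ L → size (z * w - 1ᶜ) n ℚ.≤ 0ℚ ℚ.+ ½ →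
             inv L ℚ.* ½ ℚ.≤ size z n
    δ≤size n L 0<L w≤L close = subst (inv L ℚ.* ½ ℚ.≤_)
      (trans (eq (inv L) (size z n) L) (trans (cong (ℚ._* size z n) (inv-inverse L (pos⇒≢0 0<L)))
        (ℚP.*-identityˡ (size z n))))
      (ℚP.*-monoˡ-≤-nonNeg (inv L) {{ℚ.nonNegative (ℚP.<⇒≤ (inv-pos 0<L))}}
        (≤-diff (size z n ℚ.* L ℚ.+ ½ ℚ.- 1ℚ)
          (diff-nonNeg (ℚP.≤-trans (1≤ n) (ℚP.+-mono-≤
            (ℚP.*-monoˡ-≤-nonNeg (size z n) {{ℚ.nonNegative (size-nonNeg z n)}} w≤L) close)))
          (eq′ (size z n ℚ.* L))))
      where
      eq : ∀ i z L → i ℚ.* (z ℚ.* L) ≡ i ℚ.* L ℚ.* z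
      eq = solve 3 (λ i z L → i :* (z :* L) := i :* L :* z) refl
      eq′ : ∀ x → ½ ℚ.+ (x ℚ.+ ½ ℚ.- 1ℚ) ≡ x
      eq′ = solve 1 (λ x → con ½ :+ (x :+ con ½ :- con 1ℚ) := x) refl

  ofℝ-* : ∀ x y → ofℝ (x *ᴿ y) ≈ ofℝ x * ofℝ y
  ofℝ-* x y = ≗⇒≈ (mk≗ (λ n → eq₁ (approx x n) (approx y n)) (λ n → eq₂ (approx x n) (approx y n)))
    where
    open +-*-Solver
    eq₁ : ∀ p q → p ℚ.* q ≡ p ℚ.* q ℚ.- 0ℚ ℚ.* 0ℚ
    eq₁ = solve 2 (λ p q → p :* q := p :* q :- con 0ℚ :* con 0ℚ) refl
    eq₂ : ∀ p q → 0ℚ ≡ p ℚ.* 0ℚ ℚ.+ 0ℚ ℚ.* q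
    eq₂ = solve 2 (λ p q → con 0ℚ := p :* con 0ℚ :+ con 0ℚ :* q) refl

  ofℝ-+ : ∀ x y → ofℝ (x +ᴿ y) ≈ ofℝ x + ofℝ y
  ofℝ-+ x y = ≗⇒≈ (mk≗ (λ n → refl) (λ n → refl))

  #0⇒≢0 : ∀ x → x #ᴿ 0ᴿ → Eventually λ n → approx x n ≢ 0ℚ
  #0⇒≢0 x (inj₁ (mk< gap 0<gap N h)) = N , λ n N≤n x≡0 → ℚP.<-irrefl refl (ℚP.<-≤-trans 0<gap
    (ℚP.≤-trans (ℚP.≤-reflexive (trans (sym (ℚP.+-identityˡ gap)) (cong (ℚ._+ gap) (sym x≡0)))) (h n N≤n)))
  #0⇒≢0 x (inj₂ (mk< gap 0<gap N h)) = N , λ n N≤n x≡0 → ℚP.<-irrefl refl (ℚP.<-≤-trans 0<gap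
    (ℚP.≤-trans (ℚP.≤-reflexive (sym (ℚP.+-identityˡ gap))) (subst (0ℚ ℚ.+ gap ℚ.≤_) x≡0 (h n N≤n))))

  ofℝ-recip : ∀ x (x#0 : x #ᴿ 0ᴿ) → ofℝ (recip x x#0) * ofℝ x ≈ 1ᶜ
  ofℝ-recip x x#0 = ≈-trans (≈-sym (ofℝ-* (recip x x#0) x)) (∥∥⇒≈ (mk∥∥ λ ε 0<ε → eventually-map
    (λ n x≢0 → ℚP.≤-trans
      (ℚP.≤-reflexive (cong (λ y → ℚ.∣ y ℚ.- 1ℚ ∣ ℚ.+ ℚ.∣ 0ℚ ℚ.- 0ℚ ∣) (inv-inverse (approx x n) x≢0)))
      (≤-diff ε (ℚP.<⇒≤ 0<ε) refl))
    (#0⇒≢0 x x#0)))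

  -- Uniqueness of inverses, w⁻¹ = w⁻¹(wv) = v, where w⁻¹ is the conjugate over |w|². It trades a
  -- quotient that carries a proof of `w ≉0` for a product with a convenient v.
  ÷-* : ∀ z w (w≉0 : w ≉0) v → w * v ≈ 1ᶜ → z ÷ w [ w≉0 ] ≈ z * v
  ÷-* z w w≉0 v wv≈1 = *-cong (≈-refl {z}) (begin
    w⁻¹              ≈⟨ ℂR.*-identityʳ w⁻¹ ⟨
    w⁻¹ * 1ᶜ         ≈⟨ *-cong (≈-refl {w⁻¹}) wv≈1 ⟨
    w⁻¹ * (w * v)    ≈⟨ ℂR.*-assoc w⁻¹ w v ⟨
    w⁻¹ * w * v      ≈⟨ *-cong w⁻¹*w (≈-refl {v}) ⟩
    1ᶜ * v           ≈⟨ ℂR.*-identityˡ v ⟩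
    v                ∎)
    where
    open ≈-Reasoning
    w⁻¹ : ℂ
    w⁻¹ = re w ÷ᴿ ∣ w ∣² [ w≉0 ] +i (-ᴿ (im w ÷ᴿ ∣ w ∣² [ w≉0 ]))
    w⁻¹*w : w⁻¹ * w ≈ 1ᶜ
    w⁻¹*w = ≈-trans (≗⇒≈ (mk≗
      (λ n → eq₁ (approx (re w) n) (approx (im w) n) (approx (recip ∣ w ∣² w≉0) n))
      (λ n → eq₂ (approx (re w) n) (approx (im w) n) (approx (recip ∣ w ∣² w≉0) n))))
      (≈-trans (ofℝ-* (recip ∣ w ∣² w≉0) ∣ w ∣²) (ofℝ-recip ∣ w ∣² w≉0))
      where
      open +-*-Solver
      eq₁ : ∀ a b r → a ℚ.* r ℚ.* a ℚ.- (ℚ.- (b ℚ.* r)) ℚ.* b ≡ r ℚ.* (a ℚ.* a ℚ.+ b ℚ.* b)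
      eq₁ = solve 3 (λ a b r → a :* r :* a :- (:- (b :* r)) :* b := r :* (a :* a :+ b :* b)) refl
      eq₂ : ∀ a b r → a ℚ.* r ℚ.* b ℚ.+ (ℚ.- (b ℚ.* r)) ℚ.* a ≡ 0ℚ
      eq₂ = solve 3 (λ a b r → a :* r :* b :+ (:- (b :* r)) :* a := con 0ℚ) refl

  𝑖*𝑖 : 𝑖 * 𝑖 ≈ -ᶜ 1ᶜ
  𝑖*𝑖 = ≗⇒≈ (mk≗ (λ _ → refl) (λ _ → refl))

  square : ∀ z → z ^ 2 ≈ z * z
  square z = *-cong (≈-refl {z}) (ℂR.*-identityʳ z)

  ^-cong : ∀ {z w} → z ≈ w → ∀ n → z ^ n ≈ w ^ n
  ^-cong z≈w zero    = ≈-refl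
  ^-cong z≈w (suc n) = *-cong z≈w (^-cong z≈w n)

  ^-+ : ∀ z m n → z ^ (m ℕ.+ n) ≈ z ^ m * z ^ n
  ^-+ z zero    n = ≈-sym (ℂR.*-identityˡ (z ^ n))
  ^-+ z (suc m) n = ≈-trans (*-cong (≈-refl {z}) (^-+ z m n)) (≈-sym (ℂR.*-assoc z (z ^ m) (z ^ n)))

  ^-distrib-* : ∀ z w n → (z * w) ^ n ≈ z ^ n * w ^ n
  ^-distrib-* z w zero    = ≈-sym (ℂR.*-identityˡ 1ᶜ)
  ^-distrib-* z w (suc n) = ≈-trans (*-cong (≈-refl {z * w}) (^-distrib-* z w n))
    (solve 4 (λ z w x y → z :* w :* (x :* y) := z :* x :* (w :* y)) ≈-refl z w (z ^ n) (w ^ n))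
    where open ℂ-Solver

  ^-2* : ∀ z n → z ^ (2 ℕ.* n) ≈ (z * z) ^ n
  ^-2* z zero    = ≈-refl
  ^-2* z (suc n) = ≈-trans (ℂR.reflexive (cong (z ^_) (ℕP.*-suc 2 n)))
    (≈-trans (≈-sym (ℂR.*-assoc z z (z ^ (2 ℕ.* n)))) (*-cong (≈-refl {z * z}) (^-2* z n)))

  ∑<-cong< : ∀ N {f g} → (∀ n → n ℕ.< N → f n ≈ g n) → ∑< N f ≈ ∑< N g
  ∑<-cong< zero    f≈g = ≈-refl
  ∑<-cong< (suc N) f≈g = +-cong (∑<-cong< N (λ n n<N → f≈g n (ℕP.m≤n⇒m≤1+n n<N))) (f≈g N ℕP.≤-refl)

  ∑<-cong : ∀ N {f g} → (∀ n → f n ≈ g n) → ∑< N f ≈ ∑< N g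
  ∑<-cong N f≈g = ∑<-cong< N (λ n _ → f≈g n)

  ∑<-+ : ∀ N f g → ∑< N (λ n → f n + g n) ≈ ∑< N f + ∑< N g
  ∑<-+ zero    f g = ≈-sym (ℂR.+-identityˡ 0ᶜ)
  ∑<-+ (suc N) f g = ≈-trans (+-cong (∑<-+ N f g) (≈-refl {f N + g N}))
    (solve 4 (λ F G x y → F :+ G :+ (x :+ y) := F :+ x :+ (G :+ y)) ≈-refl (∑< N f) (∑< N g) (f N) (g N))
    where open ℂ-Solver

  ∑<-- : ∀ N f g → ∑< N (λ n → f n - g n) ≈ ∑< N f - ∑< N g
  ∑<-- zero    f g = ≈-sym (ℂR.-‿inverseʳ 0ᶜ)
  ∑<-- (suc N) f g = ≈-trans (+-cong (∑<-- N f g) (≈-refl {f N - g N}))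
    (solve 4 (λ F G x y → F :- G :+ (x :- y) := F :+ x :- (G :+ y)) ≈-refl (∑< N f) (∑< N g) (f N) (g N))
    where open ℂ-Solver

  ∑<-* : ∀ N c f → ∑< N (λ n → c * f n) ≈ c * ∑< N f
  ∑<-* zero    c f = ≈-sym (ℂR.zeroʳ c)
  ∑<-* (suc N) c f = ≈-trans (+-cong (∑<-* N c f) (≈-refl {c * f N})) (≈-sym (ℂR.distribˡ c (∑< N f) (f N)))

  ∑<-swap : ∀ M N (f : ℕ → ℕ → ℂ) → ∑< M (λ m → ∑< N (λ n → f m n)) ≈ ∑< N (λ n → ∑< M (λ m → f m n))
  ∑<-swap M zero    f = ≈-trans (≈-trans (∑<-cong M (λ _ → ≈-sym (ℂR.zeroˡ 0ᶜ))) (∑<-* M 0ᶜ (λ _ → 0ᶜ)))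
                                (ℂR.zeroˡ (∑< M (λ _ → 0ᶜ)))
  ∑<-swap M (suc N) f = ≈-trans (∑<-+ M (λ m → ∑< N (f m)) (λ m → f m N)) (+-cong (∑<-swap M N f) (≈-refl {∑< M (λ m → f m N)}))

  ∑<-product : ∀ N f g → ∑< N f * ∑< N g ≈ ∑< N (λ m → ∑< N (λ n → f m * g n))
  ∑<-product N f g = ≈-trans (ℂR.*-comm (∑< N f) (∑< N g)) (≈-trans (≈-sym (∑<-* N (∑< N g) f))
    (∑<-cong N (λ m → ≈-trans (ℂR.*-comm (∑< N g) (f m)) (≈-sym (∑<-* N (f m) g)))))

  ⟶-∑< : ∀ N {f : ℕ → ℕ → ℂ} {L : ℕ → ℂ} → (∀ i → f i ⟶ L i) →
         (λ n → ∑< N (λ i → f i n)) ⟶ ∑< N L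
  ⟶-∑< zero    l = ⟶-const 0ᶜ
  ⟶-∑< (suc N) l = ⟶-+ (⟶-∑< N l) (l N)

u : ℕ → ℂ
u n = ofℚ (inv (ι (suc n)))

abstract
  u-inverse : ∀ n → u n * ofℕ (suc n) ≈ 1ᶜ
  u-inverse n = ≈-trans (≈-sym (ofℚ-* (inv (ι (suc n))) (ι (suc n))))
    (ℂR.reflexive (cong ofℚ (inv-ι-inverse n)))

  1/^≈u^ : ∀ n j → (1/ suc n ^ j) ≈ u n ^ j
  1/^≈u^ n j = ≈-trans (ℂR.reflexive (cong ofℚ (1/ℚ≡ n j))) (powers j)
    where
    powers : ∀ j → ofℚ (inv (ι (suc n)) ^ℚ j) ≈ u n ^ j
    powers zero    = ≈-refl
    powers (suc j) = ≈-trans (ofℚ-* (inv (ι (suc n))) (inv (ι (suc n)) ^ℚ j)) (*-cong (≈-refl {u n}) (powers j))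

  ∥u∥≤ : ∀ n → ∥ u n ∥≤ inv (ι (suc n))
  ∥u∥≤ n = ∥∥-ofℚ (ℚP.<⇒≤ (inv-pos (ι-pos n)))

  ∥u∥≤1 : ∀ n → ∥ u n ∥≤ 1ℚ
  ∥u∥≤1 n = ∥∥-mono (ℚP.≤-trans (inv-anti (ι-pos 0) (ι-mono {1} {suc n} (s≤s z≤n)))
    (ℚP.≤-reflexive (sym (inv-unique {1ℚ} {ι 1} refl)))) (∥u∥≤ n)

  ∥^∥≤1 : ∀ {z} → ∥ z ∥≤ 1ℚ → ∀ j → ∥ z ^ j ∥≤ 1ℚ
  ∥^∥≤1 b zero    = ∥∥-ofℚ (ℚP.<⇒≤ 0<1)
  ∥^∥≤1 b (suc j) = ∥∥-* b (∥^∥≤1 b j)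

module Dirichlet {A : ℤ → ℂ} {g} (dom : Dominated (λ n → A (+ suc n) * (1/ suc n ^ 2)) g) where

  abstract
    -- For j ≥ 2 the term is aₙ/n² times the (j - 2)-nd power of 1/n, which is at most 1.
    dirichlet-dominated : ∀ j → 1 ℕ.< j →
                          Dominated (λ n → A (+ suc n) * (1/ suc n ^ j)) (λ n → g n ℚ.* 1ℚ)
    dirichlet-dominated j 1<j = dominated-cong
      (λ n → begin
        A (+ suc n) * (1/ suc n ^ 2) * u n ^ (j ℕ.∸ 2)
          ≈⟨ ℂR.*-assoc (A (+ suc n)) (1/ suc n ^ 2) (u n ^ (j ℕ.∸ 2)) ⟩
        A (+ suc n) * ((1/ suc n ^ 2) * u n ^ (j ℕ.∸ 2))
          ≈⟨ *-cong (≈-refl {A (+ suc n)}) (*-cong (1/^≈u^ n 2) (≈-refl {u n ^ (j ℕ.∸ 2)})) ⟩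
        A (+ suc n) * (u n ^ 2 * u n ^ (j ℕ.∸ 2))
          ≈⟨ *-cong (≈-refl {A (+ suc n)}) (^-+ (u n) 2 (j ℕ.∸ 2)) ⟨
        A (+ suc n) * u n ^ (2 ℕ.+ (j ℕ.∸ 2))
          ≈⟨ *-cong (≈-refl {A (+ suc n)}) (ℂR.reflexive (cong (u n ^_) (ℕP.m+[n∸m]≡n 1<j))) ⟩
        A (+ suc n) * u n ^ j
          ≈⟨ *-cong (≈-refl {A (+ suc n)}) (1/^≈u^ n j) ⟨
        A (+ suc n) * (1/ suc n ^ j) ∎)
      (dominated-* dom (λ n → ∥^∥≤1 (∥u∥≤1 n) (j ℕ.∸ 2)))
      where open ≈-Reasoning

  converges : DirichletConverges A
  converges j 1<j = summable (dirichlet-dominated j 1<j)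

  partial⟶ : ∀ j 1<j → (λ N → ∑< N (λ n → A (+ suc n) * (1/ suc n ^ j))) ⟶ D A converges j 1<j
  partial⟶ j 1<j = ∑<⟶∑ (dirichlet-dominated j 1<j)

-- The two cotangent series

module Identities = RingIdentities (algebra ℂ _≈_ _+_ _*_ _-_ -ᶜ_ 0ᶜ 1ᶜ
  ℂ-isCommutativeRing (λ x y → ≈-refl {x - y}) ofℚ ofℚ-+ ofℚ-* ofℚ-neg (≈-refl {0ᶜ}) (≈-refl {1ᶜ}))

-- Here s = i · `y n`, and `P n m` is the reciprocal of m² + y² with m counted from 1. The bound of
-- `P` by 1/m² is the same for all n.
module CotSeries (B : ℤ → ℂ) {g} (dom : Dominated (λ m → B (+ suc m) * (1/ suc m ^ 2)) g)
  (z y 1/y : ℕ → ℂ) (P : ℕ → ℕ → ℂ)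
  (z/π≈ : ∀ n → z n /π ≈ 𝑖 * y n)
  (y-inverse : ∀ n → y n * 1/y n ≈ 1ᶜ)
  (P-inverse : ∀ n m → P n m * (ofℕ (suc m) * ofℕ (suc m) + y n * y n) ≈ 1ᶜ)
  (∥P∥≤ : ∀ n m → ∥ P n m ∥≤ inv (ι (suc m)) ℚ.* inv (ι (suc m)))
  where

  abstract
    z/π-inverse : ∀ n → z n /π * (-ᶜ (𝑖 * 1/y n)) ≈ 1ᶜ
    z/π-inverse n = Identities.rotated-inverse {𝑖} {z n /π} {y n} {1/y n} 𝑖*𝑖 (z/π≈ n) (y-inverse n)

    divisor-inverse : ∀ n m → (ofℕ (suc m) ^ 2 - (z n /π) ^ 2) * P n m ≈ 1ᶜ
    divisor-inverse n m = Identities.difference-inverse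
      {𝑖} {z n /π} {y n} {ofℕ (suc m)} {ofℕ (suc m) ^ 2} {(z n /π) ^ 2} {P n m} 𝑖*𝑖 (z/π≈ n)
      (square (ofℕ (suc m))) (square (z n /π)) (P-inverse n m)

    z/π≉0 : ∀ n → z n /π ≉0
    z/π≉0 n = invertible⇒≉0 {z n /π} { -ᶜ (𝑖 * 1/y n)} (z/π-inverse n)

    divisor≉0 : ∀ n m → ofℕ (suc m) ^ 2 - (z n /π) ^ 2 ≉0
    divisor≉0 n m = invertible⇒≉0 {ofℕ (suc m) ^ 2 - (z n /π) ^ 2} {P n m} (divisor-inverse n m)

    ∥m²P∥≤1 : ∀ n m → ∥ ofℕ (suc m) * ofℕ (suc m) * P n m ∥≤ 1ℚ
    ∥m²P∥≤1 n m = ∥∥-mono (ℚP.≤-reflexive (trans (eq (inv (ι (suc m))) (ι (suc m)))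
        (cong₂ ℚ._*_ (inv-ι-inverse m) (inv-ι-inverse m))))
      (∥∥-* {ofℕ (suc m) * ofℕ (suc m)} {P n m}
        (∥∥-* {ofℕ (suc m)} {ofℕ (suc m)} (∥∥-ofℚ (ι-nonNeg (suc m))) (∥∥-ofℚ (ι-nonNeg (suc m)))) (∥P∥≤ n m))
      where
      open +-*-Solver
      eq : ∀ i n → n ℚ.* n ℚ.* (i ℚ.* i) ≡ i ℚ.* n ℚ.* (i ℚ.* n)
      eq = solve 2 (λ i n → n :* n :* (i :* i) := i :* n :* (i :* n)) refl

    quotient≈ : ∀ n m → B (+ suc m) ÷ (ofℕ (suc m) ^ 2 - (z n /π) ^ 2) [ divisor≉0 n m ] ≈ B (+ suc m) * P n m
    quotient≈ n m = ÷-* (B (+ suc m)) (ofℕ (suc m) ^ 2 - (z n /π) ^ 2) (divisor≉0 n m) (P n m) (divisor-inverse n m)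

    -- The weight m²P is at most 1 for every n, so one majorant, that of bₘ/m², serves all n.
    quotients-dominated : ∀ n →
      Dominated (λ m → B (+ suc m) ÷ (ofℕ (suc m) ^ 2 - (z n /π) ^ 2) [ divisor≉0 n m ]) (λ m → g m ℚ.* 1ℚ)
    quotients-dominated n = dominated-cong
      {λ m → B (+ suc m) * (1/ suc m ^ 2) * (ofℕ (suc m) * ofℕ (suc m) * P n m)}
      {λ m → B (+ suc m) ÷ (ofℕ (suc m) ^ 2 - (z n /π) ^ 2) [ divisor≉0 n m ]}
      (λ m → ≈-trans (weighted≈ m) (≈-sym (quotient≈ n m)))
      (dominated-* {λ m → B (+ suc m) * (1/ suc m ^ 2)} {λ m → ofℕ (suc m) * ofℕ (suc m) * P n m} dom (∥m²P∥≤1 n))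
      where
      weighted≈ : ∀ m → B (+ suc m) * (1/ suc m ^ 2) * (ofℕ (suc m) * ofℕ (suc m) * P n m) ≈ B (+ suc m) * P n m
      weighted≈ m = Identities.weighted-term {B (+ suc m)} {u m} {1/ suc m ^ 2} {ofℕ (suc m)} {P n m}
        (≈-trans (1/^≈u^ m 2) (square (u m))) (u-inverse m)

  V : ℕ → ℂ
  V n = ∑ (summable (quotients-dominated n))

  cot-defined : ∀ n → CotDefined B (z n)
  cot-defined n = z/π≉0 n , divisor≉0 n , summable (quotients-dominated n)

  abstract
    ∥V∥≤ : ∀ n → ∥ V n ∥≤ g 0 ℚ.* 1ℚ
    ∥V∥≤ n = ∑-≤ (quotients-dominated n)

    V-tail : ∀ n N → V n ≈[ g N ℚ.* 1ℚ ] ∑< N (λ m → B (+ suc m) * P n m)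
    V-tail n N = ≈[]-cong (≈-refl {V n}) (∑<-cong N (quotient≈ n)) (∑-tail (quotients-dominated n) N)

    cot≈ : ∀ n → 𝑖 * cot B (z n) (cot-defined n) ≈
                 ofℝ (1ᴿ ÷ᴿ π [ π#0 ]) * (B (+ 0) * 1/y n + ofℕ 2 * y n * V n)
    cot≈ n = Identities.coth-value
      {𝑖} {B (+ 0)} {B (+ 0) ÷ z n /π [ z/π≉0 n ]} {z n /π} {y n} {1/y n} {ofℕ 2} {V n} {ofℝ (1ᴿ ÷ᴿ π [ π#0 ])} 𝑖*𝑖 (z/π≈ n)
      (÷-* (B (+ 0)) (z n /π) (z/π≉0 n) (-ᶜ (𝑖 * 1/y n)) (z/π-inverse n))

abstract
  ⟶-0 : ∀ {f h} → (∀ n → ∥ f n ∥≤ h n) → Null h → f ⟶ 0ᶜ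
  ⟶-0 {f} f≤h null = mk⟶ λ ε 0<ε → eventually-map
    (λ n h≤ε → mk≈[] (∥∥-mono h≤ε (∥∥-cong (eq (f n)) (f≤h n)))) (null ε 0<ε)
    where
    open ℂ-Solver
    eq : ∀ z → z ≈ z - 0ᶜ
    eq = solve 1 (λ z → z := z :- con 0ℚ) ≈-refl

-- One of the two series on the left, with o = 2k-2, j = 2k-1 and i = 2k; exchanging A, α with B, β
-- gives the other. `C n` is the value of coth, and `c₀`, `c₂` are the constants left from its 1/y
-- and y parts when the powers of n and the inner sum `V n` are taken out.
module TermSeries (A : ℤ → ℂ) {gA} (dom : Dominated (λ n → A (+ suc n) * (1/ suc n ^ 2)) gA)
  (α α′ β β′ π̂ π′ b₀ c₀ c₂ : ℂ) (b C V : ℕ → ℂ) (P : ℕ → ℕ → ℂ) {g : ℕ → ℚ}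
  (α-inverse : α′ * α ≈ 1ᶜ) (β-inverse : β′ * β ≈ 1ᶜ) (π-inverse : π′ * π̂ ≈ 1ᶜ)
  (c₀≈ : c₀ ≈ π′ * b₀ * β′ * α) (c₂≈ : c₂ ≈ π′ * ofℕ 2 * β * α′)
  (C≈ : ∀ n → C n ≈ π′ * (b₀ * (u n * β′ * α) + ofℕ 2 * (ofℕ (suc n) * β * α′) * V n))
  (∥V∥≤ : ∀ n → ∥ V n ∥≤ g 0 ℚ.* 1ℚ)
  (V-tail : ∀ n N → V n ≈[ g N ℚ.* 1ℚ ] ∑< N (λ m → b m * P n m))
  (g-null : Null g)
  (o j i : ℕ) (1<o : 1 ℕ.< o) (j≡ : j ≡ suc o) (i≡ : i ≡ suc (suc o))
  where

  open Dirichlet {A} dom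

  private
    1<i : 1 ℕ.< i
    1<i = subst (1 ℕ.<_) (sym i≡) (s≤s (s≤s z≤n))

  abstract
    1/^-suc : ∀ n p q → q ≡ suc p → (1/ suc n ^ q) ≈ u n * (1/ suc n ^ p)
    1/^-suc n p q refl = ≈-trans (1/^≈u^ n (suc p)) (*-cong (≈-refl {u n}) (≈-sym (1/^≈u^ n p)))

    term≈ : ∀ n → A (+ suc n) * (1/ suc n ^ i) * c₀ +
                  A (+ suc n) * (1/ suc n ^ o) * (V n * c₂) ≈
                  A (+ suc n) * C n * (1/ suc n ^ j)
    term≈ n = Identities.split-term
      {c₀} {c₂} {A (+ suc n)} {C n} {1/ suc n ^ o} {1/ suc n ^ j} {1/ suc n ^ i}
      {π′} {b₀} {u n} {ofℕ (suc n)} {α} {α′} {β} {β′} {ofℕ 2} {V n} (u-inverse n) (1/^-suc n o j j≡)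
      (≈-trans {1/ suc n ^ i} {u n * (1/ suc n ^ suc o)} {u n * (u n * (1/ suc n ^ o))} (1/^-suc n (suc o) i i≡)
        (*-cong {u n} {1/ suc n ^ suc o} {u n} {u n * (1/ suc n ^ o)} ≈-refl (1/^-suc n o (suc o) refl)))
      (C≈ n) c₀≈ c₂≈

    first-dominated : ∀ {p} → ∥ c₀ ∥≤ p →
      Dominated (λ n → A (+ suc n) * (1/ suc n ^ i) * c₀) (λ n → gA n ℚ.* 1ℚ ℚ.* p)
    first-dominated c₀≤p = dominated-* {λ n → A (+ suc n) * (1/ suc n ^ i)} {λ _ → c₀}
      (dirichlet-dominated i 1<i) (λ _ → c₀≤p)

    -- Here k > 1 enters, as o = 2k-2 has to be at least 2; `V n` is a bounded factor, uniformly in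
    -- n.
    second-dominated : ∀ {q} → ∥ c₂ ∥≤ q →
      Dominated (λ n → A (+ suc n) * (1/ suc n ^ o) * (V n * c₂)) (λ n → gA n ℚ.* 1ℚ ℚ.* (g 0 ℚ.* 1ℚ ℚ.* q))
    second-dominated c₂≤q = dominated-* {λ n → A (+ suc n) * (1/ suc n ^ o)} {λ n → V n * c₂}
      (dirichlet-dominated o 1<o) (λ n → ∥∥-* {V n} {c₂} (∥V∥≤ n) c₂≤q)

    ∃-terms-dominated : ∃[ h ] Dominated (λ n → A (+ suc n) * C n * (1/ suc n ^ j)) h
    ∃-terms-dominated =
      let p , c₀≤p = ∥∥-total c₀
          q , c₂≤q = ∥∥-total c₂
      in _ , dominated-cong {f = λ n → A (+ suc n) * (1/ suc n ^ i) * c₀ + A (+ suc n) * (1/ suc n ^ o) * (V n * c₂)}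
        term≈ (dominated-+ (first-dominated c₀≤p) (second-dominated c₂≤q))

  terms-summable : Summable (λ n → A (+ suc n) * C n * (1/ suc n ^ j))
  terms-summable = summable (proj₂ ∃-terms-dominated)

  -- `T′` cuts only the outer sum at N and so belongs to the given series. `T` cuts both sums at N,
  -- and this square shape is preserved when n and m are exchanged.
  S T T′ : ℕ → ℂ
  S N  = ∑< N (λ n → A (+ suc n) * (1/ suc n ^ i))
  T N  = ∑< N (λ n → ∑< N (λ m → A (+ suc n) * (1/ suc n ^ o) * (b m * P n m)))
  T′ N = ∑< N (λ n → A (+ suc n) * (1/ suc n ^ o) * V n)

  abstract
    ∑<-terms : ∀ N → ∑< N (λ n → A (+ suc n) * C n * (1/ suc n ^ j)) ≈ c₀ * S N + c₂ * T′ N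
    ∑<-terms N = begin
      ∑< N (λ n → A (+ suc n) * C n * (1/ suc n ^ j))
        ≈⟨ ∑<-cong N (λ n → ≈-trans (≈-sym (term≈ n)) (+-cong
             (ℂR.*-comm (A (+ suc n) * (1/ suc n ^ i)) c₀)
             (≈-trans (≈-sym (ℂR.*-assoc (A (+ suc n) * (1/ suc n ^ o)) (V n) c₂))
               (ℂR.*-comm (A (+ suc n) * (1/ suc n ^ o) * V n) c₂)))) ⟩
      ∑< N (λ n → c₀ * (A (+ suc n) * (1/ suc n ^ i)) + c₂ * (A (+ suc n) * (1/ suc n ^ o) * V n))
        ≈⟨ ∑<-+ N (λ n → c₀ * (A (+ suc n) * (1/ suc n ^ i))) (λ n → c₂ * (A (+ suc n) * (1/ suc n ^ o) * V n)) ⟩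
      ∑< N (λ n → c₀ * (A (+ suc n) * (1/ suc n ^ i))) + ∑< N (λ n → c₂ * (A (+ suc n) * (1/ suc n ^ o) * V n))
        ≈⟨ +-cong (∑<-* N c₀ (λ n → A (+ suc n) * (1/ suc n ^ i)))
                  (∑<-* N c₂ (λ n → A (+ suc n) * (1/ suc n ^ o) * V n)) ⟩
      c₀ * S N + c₂ * T′ N ∎
      where open ≈-Reasoning

    T′-T : ∀ N → ∑< N (λ n → A (+ suc n) * (1/ suc n ^ o) * (V n - ∑< N (λ m → b m * P n m))) ≈ T′ N - T N
    T′-T N = begin
      ∑< N (λ n → A (+ suc n) * (1/ suc n ^ o) * (V n - ∑< N (λ m → b m * P n m)))
        ≈⟨ ∑<-cong N (λ n → Identities.*-distrib-⊖ {A (+ suc n) * (1/ suc n ^ o)} {V n} {∑< N (λ m → b m * P n m)}) ⟨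
      ∑< N (λ n → A (+ suc n) * (1/ suc n ^ o) * V n - A (+ suc n) * (1/ suc n ^ o) * ∑< N (λ m → b m * P n m))
        ≈⟨ ∑<-- N (λ n → A (+ suc n) * (1/ suc n ^ o) * V n)
                  (λ n → A (+ suc n) * (1/ suc n ^ o) * ∑< N (λ m → b m * P n m)) ⟩
      T′ N - ∑< N (λ n → A (+ suc n) * (1/ suc n ^ o) * ∑< N (λ m → b m * P n m))
        ≈⟨ +-cong (≈-refl {T′ N}) (-ᶜ-cong (∑<-cong N (λ n →
             ∑<-* N (A (+ suc n) * (1/ suc n ^ o)) (λ m → b m * P n m)))) ⟨
      T′ N - T N ∎
      where open ≈-Reasoning

    -- For fixed N the inner remainders are a factor bounded by g N, so the sum over n is at most gA
    -- 0 · g N, however many terms it has.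
    T′-T⟶0 : (λ N → T′ N - T N) ⟶ 0ᶜ
    T′-T⟶0 = ⟶-0
      (λ N → ∥∥-cong (T′-T N) (∥∥-mono (ℚP.≤-reflexive (ℚP.*-comm (gA 0 ℚ.* 1ℚ) (g N ℚ.* 1ℚ)))
        (∑<-≤ (dominated-* (dirichlet-dominated o 1<o) (λ n → ∥-∥ (V-tail n N))) N)))
      (Null-scale (*-nonNeg (nonNeg dom 0) (ℚP.<⇒≤ 0<1)) (Null-scale (ℚP.<⇒≤ 0<1) g-null))

    -- The true partial sums contain `T′`. Subtracting a multiple of `T′ N - T N`, which tends to 0,
    -- puts `T` in its place and keeps the limit.
    partial-sums⟶ : (λ N → b₀ * α ^ i * S N + ofℕ 2 * β * β * α ^ o * T N) ⟶ α ^ j * β * π̂ * ∑ terms-summable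
    partial-sums⟶ = ⟶-cong
      (λ N → ≈-trans
        (+-cong (Identities.cleared-coefficients {c₀} {c₂} {α ^ o} {α ^ j} {α ^ i} {α} {α′} {β} {β′} {π̂} {π′} {b₀} {ofℕ 2} {S N} {T′ N}
           (ℂR.reflexive (cong (α ^_) j≡)) (ℂR.reflexive (cong (α ^_) i≡)) π-inverse α-inverse β-inverse c₀≈ c₂≈)
          (≈-refl { -ᶜ (ofℕ 2 * β * β * α ^ o * (T′ N - T N))}))
        (Identities.perturbed {b₀ * α ^ i * S N} {ofℕ 2 * β * β * α ^ o} {T N} {T′ N}))
      (Identities.minus-zero {α ^ j * β * π̂ * ∑ terms-summable} {ofℕ 2 * β * β * α ^ o})
      (⟶-- (⟶-scale (α ^ j * β * π̂) (⟶-cong ∑<-terms (≈-refl {∑ terms-summable}) (∑<⟶∑ (proj₂ ∃-terms-dominated))))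
           (⟶-scale (ofℕ 2 * β * β * α ^ o) T′-T⟶0))

-- The double sum

abstract
  scaled-power : ∀ α n j → α ^ (2 ℕ.* j) * (1/ suc n ^ (2 ℕ.* j)) ≈ (α * α * (u n * u n)) ^ j
  scaled-power α n j = ≈-trans
    (*-cong {α ^ (2 ℕ.* j)} {1/ suc n ^ (2 ℕ.* j)} {(α * α) ^ j} {(u n * u n) ^ j}
      (^-2* α j) (≈-trans (1/^≈u^ n (2 ℕ.* j)) (^-2* (u n) j)))
    (≈-sym (^-distrib-* (α * α) (u n * u n) j))

  geometric : ∀ X Z l → (X - Z) * ∑< (suc l) (λ i → X ^ i * Z ^ (l ℕ.∸ i)) ≈ X ^ suc l - Z ^ suc l
  geometric X Z zero    = Identities.geometric-zero {X} {Z}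
  geometric X Z (suc l) = Identities.geometric-step
    {X} {Z} {∑< (suc l) (λ i → X ^ i * Z ^ (l ℕ.∸ i))} {∑< (suc (suc l)) (λ i → X ^ i * Z ^ (suc l ℕ.∸ i))}
    {X ^ suc l} {Z ^ suc l} (geometric X Z l)
    (+-cong {∑< (suc l) (λ i → X ^ i * Z ^ (suc l ℕ.∸ i))} {X ^ suc l * Z ^ (l ℕ.∸ l)}
      {Z * ∑< (suc l) (λ i → X ^ i * Z ^ (l ℕ.∸ i))} {X ^ suc l * 1ᶜ}
      (≈-trans (∑<-cong< (suc l) peel) (∑<-* (suc l) Z (λ i → X ^ i * Z ^ (l ℕ.∸ i))))
      (ℂR.reflexive (cong (λ e → X ^ suc l * Z ^ e) (ℕP.n∸n≡0 l))))
    where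
    open ℂ-Solver
    exchange : ∀ z x p → x * (z * p) ≈ z * (x * p)
    exchange = solve 3 (λ z x p → x :* (z :* p) := z :* (x :* p)) ≈-refl
    -- Truncated subtraction: suc l ∸ i is suc (l ∸ i) only for i ≤ l, hence the range hypothesis of
    -- `∑<-cong<`.
    peel : ∀ i → i ℕ.< suc l → X ^ i * Z ^ (suc l ℕ.∸ i) ≈ Z * (X ^ i * Z ^ (l ℕ.∸ i))
    peel i i<1+l = ≈-trans
      (ℂR.reflexive (cong (λ e → X ^ i * Z ^ e) (ℕP.+-∸-assoc 1 (ℕP.≤-pred i<1+l))))
      (exchange Z (X ^ i) (Z ^ (l ℕ.∸ i)))

∑∑ : ℕ → (ℕ → ℕ → ℂ) → ℂ
∑∑ N f = ∑< N (λ n → ∑< N (f n))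

abstract
  ∑∑-cong : ∀ N {f g} → (∀ n m → f n m ≈ g n m) → ∑∑ N f ≈ ∑∑ N g
  ∑∑-cong N f≈g = ∑<-cong N (λ n → ∑<-cong N (f≈g n))

  ∑∑-+ : ∀ N f g → ∑∑ N (λ n m → f n m + g n m) ≈ ∑∑ N f + ∑∑ N g
  ∑∑-+ N f g = ≈-trans (∑<-cong N (λ n → ∑<-+ N (f n) (g n))) (∑<-+ N (λ n → ∑< N (f n)) (λ n → ∑< N (g n)))

  ∑∑-* : ∀ N c f → ∑∑ N (λ n m → c * f n m) ≈ c * ∑∑ N f
  ∑∑-* N c f = ≈-trans (∑<-cong N (λ n → ∑<-* N c (f n))) (∑<-* N c (λ n → ∑< N (f n)))

  ∑<-∑∑-swap : ∀ K N (f : ℕ → ℕ → ℕ → ℂ) → ∑< K (λ i → ∑∑ N (f i)) ≈ ∑∑ N (λ n m → ∑< K (λ i → f i n m))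
  ∑<-∑∑-swap K N f = ≈-trans (∑<-swap K N (λ i n → ∑< N (f i n)))
    (∑<-cong N (λ n → ∑<-swap K N (λ i m → f i n m)))

abstract
  -- For k = l + 2 the bound k ∸ 1 and the exponent k ∸ 2 ∸ i compute to suc l and l ∸ i, the shape
  -- of the geometric sum.
  ⟶-∑[] : ∀ l {f : ℕ → ℕ → ℂ} {F : ∀ j₁ j₂ → 1 ℕ.≤ j₁ → 1 ℕ.≤ j₂ → ℂ} →
          (∀ i → f i ⟶ F (suc i) (suc (l ℕ.∸ i)) (s≤s z≤n) (s≤s z≤n)) →
          (λ N → ∑< (suc l) (λ i → f i N)) ⟶ ∑[j₁+j₂≡ suc (suc l) ] F
  ⟶-∑[] l f⟶F = ⟶-∑< (suc l) f⟶F

module Pairing (A B : ℤ → ℂ) (α β : ℂ) (P Q : ℕ → ℕ → ℂ)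
  (P-scaled : ∀ n m → P n m * (α * α * (ofℕ (suc m) * ofℕ (suc m)) + β * β * (ofℕ (suc n) * ofℕ (suc n))) ≈ α * α)
  (Q-scaled : ∀ n m → Q n m * (β * β * (ofℕ (suc m) * ofℕ (suc m)) + α * α * (ofℕ (suc n) * ofℕ (suc n))) ≈ β * β)
  (l : ℕ)
  where

  -- Z = -Y absorbs the sign (-1)^j₂, so a plain geometric sum in X and Z appears. The factor `-1ᶜ`
  -- lets powers of Z split by `^-distrib-*`.
  X Y Z : ℕ → ℂ
  X n = α * α * (u n * u n)
  Y m = β * β * (u m * u m)
  Z m = -1ᶜ * Y m

  G f g E : ℕ → ℕ → ℂ
  G n m = ∑< (suc l) (λ i → X n ^ i * Z m ^ (l ℕ.∸ i))
  f n m = A (+ suc n) * (1/ suc n ^ (2 ℕ.* suc l)) * (B (+ suc m) * P n m)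
  g m n = B (+ suc m) * (1/ suc m ^ (2 ℕ.* suc l)) * (A (+ suc n) * Q m n)
  E n m = A (+ suc n) * B (+ suc m) * (X n * Z m * G n m)

  SA SB : ℕ → ℕ → ℂ
  SA j N = ∑< N (λ n → A (+ suc n) * (1/ suc n ^ j))
  SB j N = ∑< N (λ n → B (+ suc n) * (1/ suc n ^ j))

  product : ℕ → ℕ → ℂ
  product N i = -1ᶜ ^ suc (l ℕ.∸ i) * α ^ (2 ℕ.* suc i) * β ^ (2 ℕ.* suc (l ℕ.∸ i))
                * SA (2 ℕ.* suc i) N * SB (2 ℕ.* suc (l ℕ.∸ i)) N

  abstract
    -1≈ : -1ᶜ ≈ -ᶜ 1ᶜ
    -1≈ = ≗⇒≈ (mk≗ (λ _ → refl) (λ _ → refl))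

    Z-power : ∀ m j → -1ᶜ ^ j * (β ^ (2 ℕ.* j) * (1/ suc m ^ (2 ℕ.* j))) ≈ Z m ^ j
    Z-power m j = ≈-trans
      (*-cong { -1ᶜ ^ j} {β ^ (2 ℕ.* j) * (1/ suc m ^ (2 ℕ.* j))} { -1ᶜ ^ j} {Y m ^ j} ≈-refl (scaled-power β m j))
      (≈-sym (^-distrib-* -1ᶜ (Y m) j))

    -- The sign (-1)ᵏ has one factor -1 more than Zᵏ⁻¹ uses up; this surplus turns the sum of the
    -- two double sums into the difference Xᵏ⁻¹ - Zᵏ⁻¹.
    σ-power : ∀ m → -1ᶜ ^ suc (suc l) * (β ^ (2 ℕ.* suc l) * (1/ suc m ^ (2 ℕ.* suc l))) ≈ -1ᶜ * Z m ^ suc l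
    σ-power m = ≈-trans (ℂR.*-assoc -1ᶜ (-1ᶜ ^ suc l) (β ^ (2 ℕ.* suc l) * (1/ suc m ^ (2 ℕ.* suc l))))
      (*-cong { -1ᶜ} { -1ᶜ ^ suc l * (β ^ (2 ℕ.* suc l) * (1/ suc m ^ (2 ℕ.* suc l)))} { -1ᶜ} {Z m ^ suc l} ≈-refl (Z-power m (suc l)))

    pair≈ : ∀ n m → ofℕ 2 * β * β * α ^ (2 ℕ.* suc l) * f n m + -1ᶜ ^ suc (suc l) * (ofℕ 2 * α * α * β ^ (2 ℕ.* suc l) * g m n) ≈ (-ᶜ ofℕ 2) * E n m
    pair≈ n m = Identities.paired-term
      {α} {β} {ofℕ (suc m)} {ofℕ (suc n)} {u n} {u m} {P n m} {Q m n} {α ^ (2 ℕ.* suc l)} {β ^ (2 ℕ.* suc l)} {1/ suc n ^ (2 ℕ.* suc l)} {1/ suc m ^ (2 ℕ.* suc l)}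
      {X n ^ suc l} {Z m ^ suc l} {X n} {Z m} {Y m} {G n m} { -1ᶜ} { -1ᶜ ^ suc (suc l)} {A (+ suc n)} {B (+ suc m)} {ofℕ 2}
      (u-inverse n) (u-inverse m) (P-scaled n m) (Q-scaled m n) (scaled-power α n (suc l)) (σ-power m) -1≈
      (≈-refl {X n}) (≈-refl {Y m}) (≈-refl {Z m}) (geometric (X n) (Z m) l)

    product≈ : ∀ N i → product N i ≈
      ∑∑ N (λ n m → A (+ suc n) * B (+ suc m) * (X n ^ suc i * Z m ^ suc (l ℕ.∸ i)))
    product≈ N i = begin
      c * SA j₁ N * SB j₂ N
        ≈⟨ ℂR.*-assoc c (SA j₁ N) (SB j₂ N) ⟩
      c * (SA j₁ N * SB j₂ N)
        ≈⟨ *-cong {c} {SA j₁ N * SB j₂ N} {c} {∑∑ N F} ≈-refl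
             (∑<-product N (λ n → A (+ suc n) * (1/ suc n ^ j₁)) (λ m → B (+ suc m) * (1/ suc m ^ j₂))) ⟩
      c * ∑∑ N F
        ≈⟨ ∑∑-* N c F ⟨
      ∑∑ N (λ n m → c * F n m)
        ≈⟨ ∑∑-cong N (λ n m → Identities.paired-powers
             { -1ᶜ ^ suc (l ℕ.∸ i)} {α ^ j₁} {β ^ j₂} {A (+ suc n)} {B (+ suc m)} {1/ suc n ^ j₁} {1/ suc m ^ j₂}
             {X n ^ suc i} {Z m ^ suc (l ℕ.∸ i)} (scaled-power α n (suc i)) (Z-power m (suc (l ℕ.∸ i)))) ⟩
      ∑∑ N (λ n m → A (+ suc n) * B (+ suc m) * (X n ^ suc i * Z m ^ suc (l ℕ.∸ i))) ∎
      where
      open ≈-Reasoning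
      j₁ j₂ : ℕ
      j₁ = 2 ℕ.* suc i
      j₂ = 2 ℕ.* suc (l ℕ.∸ i)
      c : ℂ
      c = -1ᶜ ^ suc (l ℕ.∸ i) * α ^ j₁ * β ^ j₂
      F : ℕ → ℕ → ℂ
      F n m = A (+ suc n) * (1/ suc n ^ j₁) * (B (+ suc m) * (1/ suc m ^ j₂))

    -- The factor XZ raises both exponents by one, which carries i + (l - i) = k - 2 over to j₁ + j₂
    -- = k with j₁, j₂ ≥ 1.
    E≈ : ∀ n m → ∑< (suc l) (λ i → A (+ suc n) * B (+ suc m) * (X n ^ suc i * Z m ^ suc (l ℕ.∸ i))) ≈ E n m
    E≈ n m = begin
      ∑< (suc l) (λ i → ab * (X n ^ suc i * Z m ^ suc (l ℕ.∸ i)))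
        ≈⟨ ∑<-* (suc l) ab (λ i → X n ^ suc i * Z m ^ suc (l ℕ.∸ i)) ⟩
      ab * ∑< (suc l) (λ i → X n ^ suc i * Z m ^ suc (l ℕ.∸ i))
        ≈⟨ *-cong {ab} {∑< (suc l) (λ i → X n ^ suc i * Z m ^ suc (l ℕ.∸ i))} {ab} {X n * Z m * G n m} ≈-refl
             (≈-trans (∑<-cong (suc l) (λ i → Identities.regroup-powers {X n} {Z m} {X n ^ i} {Z m ^ (l ℕ.∸ i)}))
                      (∑<-* (suc l) (X n * Z m) (λ i → X n ^ i * Z m ^ (l ℕ.∸ i)))) ⟩
      ab * (X n * Z m * G n m) ∎
      where
      open ≈-Reasoning
      ab : ℂ
      ab = A (+ suc n) * B (+ suc m)

    pairing : ∀ N {S T} → S ≡ ∑∑ N f → T ≡ ∑∑ N g →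
      ofℕ 2 * β * β * α ^ (2 ℕ.* suc l) * S + -1ᶜ ^ suc (suc l) * (ofℕ 2 * α * α * β ^ (2 ℕ.* suc l) * T) ≈
      (-ᶜ ofℕ 2) * ∑< (suc l) (λ i → product N i)
    pairing N refl refl = begin
      k₁ * ∑∑ N f + σ * (k₂ * ∑∑ N g)
        ≈⟨ +-cong {k₁ * ∑∑ N f} {σ * (k₂ * ∑∑ N g)} {∑∑ N (λ n m → k₁ * f n m)} {∑∑ N (λ n m → σ * (k₂ * g m n))}
             (≈-sym (∑∑-* N k₁ f)) g≈ ⟩
      ∑∑ N (λ n m → k₁ * f n m) + ∑∑ N (λ n m → σ * (k₂ * g m n))
        ≈⟨ ∑∑-+ N (λ n m → k₁ * f n m) (λ n m → σ * (k₂ * g m n)) ⟨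
      ∑∑ N (λ n m → k₁ * f n m + σ * (k₂ * g m n))
        ≈⟨ ∑∑-cong N pair≈ ⟩
      ∑∑ N (λ n m → (-ᶜ ofℕ 2) * E n m)
        ≈⟨ ∑∑-* N (-ᶜ ofℕ 2) E ⟩
      (-ᶜ ofℕ 2) * ∑∑ N E
        ≈⟨ *-cong { -ᶜ ofℕ 2} {∑∑ N E} { -ᶜ ofℕ 2} {∑< (suc l) (λ i → product N i)} ≈-refl products≈ ⟩
      (-ᶜ ofℕ 2) * ∑< (suc l) (λ i → product N i) ∎
      where
      open ≈-Reasoning
      k₁ k₂ σ : ℂ
      k₁ = ofℕ 2 * β * β * α ^ (2 ℕ.* suc l)
      k₂ = ofℕ 2 * α * α * β ^ (2 ℕ.* suc l)
      σ  = -1ᶜ ^ suc (suc l)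
      -- In the second series the outer index belongs to B; the two finite sums are exchanged so
      -- that both series run over the same pairs.
      g≈ : σ * (k₂ * ∑∑ N g) ≈ ∑∑ N (λ n m → σ * (k₂ * g m n))
      g≈ = begin
        σ * (k₂ * ∑∑ N g)
          ≈⟨ ℂR.*-assoc σ k₂ (∑∑ N g) ⟨
        σ * k₂ * ∑∑ N g
          ≈⟨ *-cong { σ * k₂} {∑∑ N g} { σ * k₂} {∑∑ N (λ n m → g m n)} ≈-refl (∑<-swap N N g) ⟩
        σ * k₂ * ∑∑ N (λ n m → g m n)
          ≈⟨ ∑∑-* N (σ * k₂) (λ n m → g m n) ⟨
        ∑∑ N (λ n m → σ * k₂ * g m n)
          ≈⟨ ∑∑-cong N (λ n m → ℂR.*-assoc σ k₂ (g m n)) ⟩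
        ∑∑ N (λ n m → σ * (k₂ * g m n)) ∎
      F : ℕ → ℕ → ℕ → ℂ
      F i n m = A (+ suc n) * B (+ suc m) * (X n ^ suc i * Z m ^ suc (l ℕ.∸ i))
      products≈ : ∑∑ N E ≈ ∑< (suc l) (λ i → product N i)
      products≈ = ≈-sym (≈-trans (∑<-cong (suc l) (product≈ N))
        (≈-trans (∑<-∑∑-swap (suc l) N F) (∑∑-cong N E≈)))

-- The reciprocal of m² + (nβ/α)²

module Kernel (α β : ℝ) (α#0 : α #ᴿ 0ᴿ) where

  private
    y : ℕ → ℝ
    y n = fromℕ (suc n) *ᴿ β ÷ᴿ α [ α#0 ]

    W : ℕ → ℕ → ℝ
    W n m = fromℕ (suc m) *ᴿ fromℕ (suc m) +ᴿ y n *ᴿ y n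

  abstract
    m²-pos : ∀ m → 0ℚ ℚ.< ι (suc m) ℚ.* ι (suc m)
    m²-pos m = *-pos (ι-pos m) (ι-pos m)

    -- A square is nonnegative on every approximant. This one estimate gives both the apartness of
    -- `W` from 0 and the bound of the kernel, for either sign of α and β.
    m²≤W : ∀ n m k → ι (suc m) ℚ.* ι (suc m) ℚ.≤ approx (W n m) k
    m²≤W n m k = ≤-diff (approx (y n) k ℚ.* approx (y n) k) (square-nonNeg (approx (y n) k)) refl

    W#0 : ∀ n m → W n m #ᴿ 0ᴿ
    W#0 n m = inj₂ (mk< (ι (suc m) ℚ.* ι (suc m)) (m²-pos m) 0
      λ k _ → ℚP.≤-trans (ℚP.≤-reflexive (ℚP.+-identityˡ (ι (suc m) ℚ.* ι (suc m)))) (m²≤W n m k))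

    -- 1 / (m² + (nβ/α)²), for m and n counted from 1
    kernel : ℕ → ℕ → ℂ
    kernel n m = ofℝ (recip (W n m) (W#0 n m))

    kernel-inverse : ∀ n m → kernel n m * (ofℕ (suc m) * ofℕ (suc m) +
      ofℕ (suc n) * ofℝ β * ofℝ (recip α α#0) * (ofℕ (suc n) * ofℝ β * ofℝ (recip α α#0))) ≈ 1ᶜ
    kernel-inverse n m = ≈-trans (*-cong (≈-refl {kernel n m}) (≈-sym W≈)) (ofℝ-recip (W n m) (W#0 n m))
      where
      ŷ : ℂ
      ŷ = ofℕ (suc n) * ofℝ β * ofℝ (recip α α#0)
      y≈ : ofℝ (y n) ≈ ŷ
      y≈ = ≈-trans (ofℝ-* (fromℕ (suc n) *ᴿ β) (recip α α#0))
        (*-cong (ofℝ-* (fromℕ (suc n)) β) (≈-refl {ofℝ (recip α α#0)}))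
      W≈ : ofℝ (W n m) ≈ ofℕ (suc m) * ofℕ (suc m) + ŷ * ŷ
      W≈ = ≈-trans (ofℝ-+ (fromℕ (suc m) *ᴿ fromℕ (suc m)) (y n *ᴿ y n))
        (+-cong {ofℝ (fromℕ (suc m) *ᴿ fromℕ (suc m))} {ofℝ (y n *ᴿ y n)} {ofℕ (suc m) * ofℕ (suc m)} {ŷ * ŷ}
          (ofℝ-* (fromℕ (suc m)) (fromℕ (suc m)))
          (≈-trans (ofℝ-* (y n) (y n)) (*-cong {ofℝ (y n)} {ofℝ (y n)} {ŷ} {ŷ} y≈ y≈)))

    ∥kernel∥≤ : ∀ n m → ∥ kernel n m ∥≤ inv (ι (suc m)) ℚ.* inv (ι (suc m))
    ∥kernel∥≤ n m = mk∥∥ λ ε 0<ε → 0 , λ k _ → ℚP.≤-trans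
      (ℚP.≤-reflexive (trans (ℚP.+-identityʳ ℚ.∣ inv (approx (W n m) k) ∣)
        (ℚP.0≤p⇒∣p∣≡p (ℚP.<⇒≤ (inv-pos (ℚP.<-≤-trans (m²-pos m) (m²≤W n m k)))))))
      (ℚP.≤-trans (inv-anti (m²-pos m) (m²≤W n m k))
        (ℚP.≤-trans (ℚP.≤-reflexive (sym i²)) (≤-diff ε (ℚP.<⇒≤ 0<ε) refl)))
      where
      open +-*-Solver
      i : ℚ
      i = inv (ι (suc m))
      eq : ∀ i n → i ℚ.* i ℚ.* (n ℚ.* n) ≡ i ℚ.* n ℚ.* (i ℚ.* n)
      eq = solve 2 (λ i n → i :* i :* (n :* n) := i :* n :* (i :* n)) refl
      i² : i ℚ.* i ≡ inv (ι (suc m) ℚ.* ι (suc m))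
      i² = inv-unique (trans (eq i (ι (suc m))) (cong₂ ℚ._*_ (inv-ι-inverse m) (inv-ι-inverse m)))

    kernel-scaled : ∀ n m → kernel n m * (ofℝ α * ofℝ α * (ofℕ (suc m) * ofℕ (suc m)) +
                                          ofℝ β * ofℝ β * (ofℕ (suc n) * ofℕ (suc n))) ≈ ofℝ α * ofℝ α
    kernel-scaled n m = Identities.cleared-denominator
      {kernel n m} {ofℝ α} {ofℝ (recip α α#0)} {ofℝ β} {ofℕ (suc m)} {ofℕ (suc n)}
      (ofℝ-recip α α#0) (kernel-inverse n m)

abstract
  1/π*π : ofℝ (1ᴿ ÷ᴿ π [ π#0 ]) * ofℝ π ≈ 1ᶜ
  1/π*π = ≈-trans
    (*-cong {ofℝ (1ᴿ ÷ᴿ π [ π#0 ])} {ofℝ π} {ofℝ (recip π π#0)} {ofℝ π}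
      (≈-trans (ofℝ-* 1ᴿ (recip π π#0)) (ℂR.*-identityˡ (ofℝ (recip π π#0)))) ≈-refl)
    (ofℝ-recip π π#0)

  argument/π : ∀ α β (α#0 : α #ᴿ 0ᴿ) n → (𝑖 * ofℝ (fromℕ (suc n) *ᴿ β *ᴿ π ÷ᴿ α [ α#0 ])) /π ≈
                                         𝑖 * (ofℕ (suc n) * ofℝ β * ofℝ (recip α α#0))
  argument/π α β α#0 n = Identities.scaled-argument
    {ofℝ (fromℕ (suc n) *ᴿ β *ᴿ π ÷ᴿ α [ α#0 ])} {𝑖} {ofℕ (suc n)} {ofℝ β} {ofℝ (recip α α#0)} {ofℝ π}
    {ofℝ (1ᴿ ÷ᴿ π [ π#0 ])}
    (≈-trans (ofℝ-* (fromℕ (suc n) *ᴿ β *ᴿ π) (recip α α#0))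
      (*-cong {ofℝ (fromℕ (suc n) *ᴿ β *ᴿ π)} {ofℝ (recip α α#0)} {ofℕ (suc n) * ofℝ β * ofℝ π} {ofℝ (recip α α#0)}
        (≈-trans (ofℝ-* (fromℕ (suc n) *ᴿ β) π)
          (*-cong {ofℝ (fromℕ (suc n) *ᴿ β)} {ofℝ π} {ofℕ (suc n) * ofℝ β} {ofℝ π} (ofℝ-* (fromℕ (suc n)) β) ≈-refl))
        ≈-refl))
    1/π*π

-- Both sides as limits of one sequence, for k = l + 2

module Reciprocity (A B : ℤ → ℂ) {gA gB : ℕ → ℚ}
  (domA : Dominated (λ n → A (+ suc n) * (1/ suc n ^ 2)) gA)
  (domB : Dominated (λ n → B (+ suc n) * (1/ suc n ^ 2)) gB)
  (α β : ℝ) (α#0 : α #ᴿ 0ᴿ) (β#0 : β #ᴿ 0ᴿ) (l : ℕ)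
  where

  module KA = Kernel β α β#0
  module KB = Kernel α β α#0
  module DA = Dirichlet {A} domA
  module DB = Dirichlet {B} domB

  abstract
    argument-inverse : ∀ α β (α#0 : α #ᴿ 0ᴿ) (β#0 : β #ᴿ 0ᴿ) n →
      ofℕ (suc n) * ofℝ β * ofℝ (recip α α#0) * (u n * ofℝ (recip β β#0) * ofℝ α) ≈ 1ᶜ
    argument-inverse α β α#0 β#0 n = Identities.product-inverse
      {ofℕ (suc n)} {ofℝ β} {ofℝ α} {u n} {ofℝ (recip β β#0)} {ofℝ (recip α α#0)}
      (u-inverse n) (ofℝ-recip β β#0) (ofℝ-recip α α#0)

  module CB = CotSeries B domB (λ n → 𝑖 * ofℝ (fromℕ (suc n) *ᴿ β *ᴿ π ÷ᴿ α [ α#0 ]))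
    (λ n → ofℕ (suc n) * ofℝ β * ofℝ (recip α α#0)) (λ n → u n * ofℝ (recip β β#0) * ofℝ α) KB.kernel
    (argument/π α β α#0) (argument-inverse α β α#0 β#0) KB.kernel-inverse KB.∥kernel∥≤

  module CA = CotSeries A domA (λ n → 𝑖 * ofℝ (fromℕ (suc n) *ᴿ α *ᴿ π ÷ᴿ β [ β#0 ]))
    (λ n → ofℕ (suc n) * ofℝ α * ofℝ (recip β β#0)) (λ n → u n * ofℝ (recip α α#0) * ofℝ β) KA.kernel
    (argument/π β α β#0) (argument-inverse β α β#0 α#0) KA.kernel-inverse KA.∥kernel∥≤

  abstract
    2k≡ : 2 ℕ.* suc (suc l) ≡ suc (suc (2 ℕ.* suc l))
    2k≡ = ℕP.*-suc 2 (suc l)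

    2k-1≡ : 2 ℕ.* suc (suc l) ℕ.∸ 1 ≡ suc (2 ℕ.* suc l)
    2k-1≡ = cong (ℕ._∸ 1) 2k≡

  module TA = TermSeries A domA (ofℝ α) (ofℝ (recip α α#0)) (ofℝ β) (ofℝ (recip β β#0))
    (ofℝ π) (ofℝ (1ᴿ ÷ᴿ π [ π#0 ])) (B (+ 0))
    (ofℝ (1ᴿ ÷ᴿ π [ π#0 ]) * B (+ 0) * ofℝ (recip β β#0) * ofℝ α)
    (ofℝ (1ᴿ ÷ᴿ π [ π#0 ]) * ofℕ 2 * ofℝ β * ofℝ (recip α α#0))
    (λ m → B (+ suc m))
    (λ n → coth B (ofℝ (fromℕ (suc n) *ᴿ β *ᴿ π ÷ᴿ α [ α#0 ])) (CB.cot-defined n)) CB.V KB.kernel {gB}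
    (ofℝ-recip α α#0) (ofℝ-recip β β#0) 1/π*π ≈-refl ≈-refl CB.cot≈ CB.∥V∥≤ CB.V-tail (null domB)
    (2 ℕ.* suc l) (2 ℕ.* suc (suc l) ℕ.∸ 1) (2 ℕ.* suc (suc l)) (1<2* (s≤s z≤n)) 2k-1≡ 2k≡

  module TB = TermSeries B domB (ofℝ β) (ofℝ (recip β β#0)) (ofℝ α) (ofℝ (recip α α#0))
    (ofℝ π) (ofℝ (1ᴿ ÷ᴿ π [ π#0 ])) (A (+ 0))
    (ofℝ (1ᴿ ÷ᴿ π [ π#0 ]) * A (+ 0) * ofℝ (recip α α#0) * ofℝ β)
    (ofℝ (1ᴿ ÷ᴿ π [ π#0 ]) * ofℕ 2 * ofℝ α * ofℝ (recip β β#0))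
    (λ m → A (+ suc m))
    (λ n → coth A (ofℝ (fromℕ (suc n) *ᴿ α *ᴿ π ÷ᴿ β [ β#0 ])) (CA.cot-defined n)) CA.V KA.kernel {gA}
    (ofℝ-recip β β#0) (ofℝ-recip α α#0) 1/π*π ≈-refl ≈-refl CA.cot≈ CA.∥V∥≤ CA.V-tail (null domA)
    (2 ℕ.* suc l) (2 ℕ.* suc (suc l) ℕ.∸ 1) (2 ℕ.* suc (suc l)) (1<2* (s≤s z≤n)) 2k-1≡ 2k≡

  module PR = Pairing A B (ofℝ α) (ofℝ β) KB.kernel KA.kernel KB.kernel-scaled KA.kernel-scaled l

  abstract
    lhs⟶ : (λ N → (B (+ 0) * ofℝ α ^ (2 ℕ.* suc (suc l)) * TA.S N
                   + ofℕ 2 * ofℝ β * ofℝ β * ofℝ α ^ (2 ℕ.* suc l) * TA.T N)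
                + -1ᶜ ^ suc (suc l) * (A (+ 0) * ofℝ β ^ (2 ℕ.* suc (suc l)) * TB.S N
                   + ofℕ 2 * ofℝ α * ofℝ α * ofℝ β ^ (2 ℕ.* suc l) * TB.T N)) ⟶
           ofℝ α ^ (2 ℕ.* suc (suc l) ℕ.∸ 1) * ofℝ β * ofℝ π * ∑ TA.terms-summable
           + -1ᶜ ^ suc (suc l) * ofℝ β ^ (2 ℕ.* suc (suc l) ℕ.∸ 1) * ofℝ α * ofℝ π * ∑ TB.terms-summable
    lhs⟶ = ⟶-cong (λ N → ≈-refl)
      (+-cong {ofℝ α ^ (2 ℕ.* suc (suc l) ℕ.∸ 1) * ofℝ β * ofℝ π * ∑ TA.terms-summable}
        {σ * (ofℝ β ^ (2 ℕ.* suc (suc l) ℕ.∸ 1) * ofℝ α * ofℝ π * ∑ TB.terms-summable)} ≈-refl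
        (Identities.reassociate₅ {σ} {ofℝ β ^ (2 ℕ.* suc (suc l) ℕ.∸ 1)} {ofℝ α} {ofℝ π} {∑ TB.terms-summable}))
      (⟶-+ TA.partial-sums⟶ (⟶-scale σ TB.partial-sums⟶))
      where
      σ : ℂ
      σ = -1ᶜ ^ suc (suc l)

    SA⟶ : ∀ 1<j → TA.S ⟶ D A DA.converges (2 ℕ.* suc (suc l)) 1<j
    SA⟶ 1<j = DA.partial⟶ (2 ℕ.* suc (suc l)) 1<j

    SB⟶ : ∀ 1<j → TB.S ⟶ D B DB.converges (2 ℕ.* suc (suc l)) 1<j
    SB⟶ 1<j = DB.partial⟶ (2 ℕ.* suc (suc l)) 1<j

    products⟶ : (λ N → ∑< (suc l) (λ i → PR.product N i)) ⟶
      ∑[j₁+j₂≡ suc (suc l) ] (λ j₁ j₂ 1≤j₁ 1≤j₂ →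
        -1ᶜ ^ j₂ * ofℝ α ^ (2 ℕ.* j₁) * ofℝ β ^ (2 ℕ.* j₂)
        * D A DA.converges (2 ℕ.* j₁) (1<2* 1≤j₁) * D B DB.converges (2 ℕ.* j₂) (1<2* 1≤j₂))
    products⟶ = ⟶-∑[] l {λ i N → PR.product N i} {λ j₁ j₂ 1≤j₁ 1≤j₂ →
        -1ᶜ ^ j₂ * ofℝ α ^ (2 ℕ.* j₁) * ofℝ β ^ (2 ℕ.* j₂)
        * D A DA.converges (2 ℕ.* j₁) (1<2* 1≤j₁) * D B DB.converges (2 ℕ.* j₂) (1<2* 1≤j₂)}
      λ i → ⟶-* (⟶-scale (-1ᶜ ^ suc (l ℕ.∸ i) * ofℝ α ^ (2 ℕ.* suc i) * ofℝ β ^ (2 ℕ.* suc (l ℕ.∸ i)))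
                  (DA.partial⟶ (2 ℕ.* suc i) (1<2* (s≤s z≤n))))
                (DB.partial⟶ (2 ℕ.* suc (l ℕ.∸ i)) (1<2* (s≤s z≤n)))

    -- The sequence is that of `lhs⟶`. By `pairing` it consists of finitely many products of partial
    -- sums of D, so the limit is taken factor by factor.
    rhs⟶ : ∀ 1<j → (λ N → (B (+ 0) * ofℝ α ^ (2 ℕ.* suc (suc l)) * TA.S N
                   + ofℕ 2 * ofℝ β * ofℝ β * ofℝ α ^ (2 ℕ.* suc l) * TA.T N)
                + -1ᶜ ^ suc (suc l) * (A (+ 0) * ofℝ β ^ (2 ℕ.* suc (suc l)) * TB.S N
                   + ofℕ 2 * ofℝ α * ofℝ α * ofℝ β ^ (2 ℕ.* suc l) * TB.T N)) ⟶
      (B (+ 0) * ofℝ α ^ (2 ℕ.* suc (suc l)) * D A DA.converges (2 ℕ.* suc (suc l)) 1<j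
       + -1ᶜ ^ suc (suc l) * A (+ 0) * ofℝ β ^ (2 ℕ.* suc (suc l)) * D B DB.converges (2 ℕ.* suc (suc l)) 1<j
       - ofℕ 2 * ∑[j₁+j₂≡ suc (suc l) ] (λ j₁ j₂ 1≤j₁ 1≤j₂ →
           -1ᶜ ^ j₂ * ofℝ α ^ (2 ℕ.* j₁) * ofℝ β ^ (2 ℕ.* j₂)
           * D A DA.converges (2 ℕ.* j₁) (1<2* 1≤j₁) * D B DB.converges (2 ℕ.* j₂) (1<2* 1≤j₂)))
    rhs⟶ 1<j = ⟶-cong
      (λ N → ≈-sym (Identities.assembled
        {B (+ 0) * ofℝ α ^ (2 ℕ.* suc (suc l)) * TA.S N} { -1ᶜ ^ suc (suc l)} {A (+ 0)}
        {ofℝ β ^ (2 ℕ.* suc (suc l))} {TB.S N}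
        {ofℕ 2 * ofℝ β * ofℝ β * ofℝ α ^ (2 ℕ.* suc l)} {TA.T N}
        {ofℕ 2 * ofℝ α * ofℝ α * ofℝ β ^ (2 ℕ.* suc l)} {TB.T N}
        {ofℕ 2} {∑< (suc l) (λ i → PR.product N i)} (PR.pairing N refl refl)))
      ≈-refl
      (⟶-- (⟶-+ (⟶-scale (B (+ 0) * ofℝ α ^ (2 ℕ.* suc (suc l))) (SA⟶ 1<j))
                (⟶-scale (-1ᶜ ^ suc (suc l) * A (+ 0) * ofℝ β ^ (2 ℕ.* suc (suc l))) (SB⟶ 1<j)))
           (⟶-scale (ofℕ 2) products⟶))

theorem5p1 : (A B : ℤ → ℂ) →
    (∃[ c ] c <ᴿ 1ᴿ × A =o[k^ c ]) →
    (∃[ c ] c <ᴿ 1ᴿ × B =o[k^ c ]) →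
    (k : ℕ) (1<k : 1 ℕ.< k) →
    (α β : ℝ) (α#0 : α #ᴿ 0ᴿ) (β#0 : β #ᴿ 0ᴿ) →
    Σ[ DA ∈ DirichletConverges A ]
    Σ[ DB ∈ DirichletConverges B ]
    Σ[ cothB ∈ (∀ n → CothDefined B (ofℝ (fromℕ (suc n) *ᴿ β *ᴿ π ÷ᴿ α [ α#0 ]))) ]
    Σ[ cothA ∈ (∀ n → CothDefined A (ofℝ (fromℕ (suc n) *ᴿ α *ᴿ π ÷ᴿ β [ β#0 ]))) ]
    Σ[ SA ∈ Summable (λ n →
    A (+ suc n)
    * coth B (ofℝ (fromℕ (suc n) *ᴿ β *ᴿ π ÷ᴿ α [ α#0 ])) (cothB n)
    * 1/ suc n ^ (2 ℕ.* k ℕ.∸ 1)) ]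
    Σ[ SB ∈ Summable (λ n →
    B (+ suc n)
    * coth A (ofℝ (fromℕ (suc n) *ᴿ α *ᴿ π ÷ᴿ β [ β#0 ])) (cothA n)
    * 1/ suc n ^ (2 ℕ.* k ℕ.∸ 1)) ]
    (ofℝ α ^ (2 ℕ.* k ℕ.∸ 1) * ofℝ β * ofℝ π * ∑ SA
    + -1ᶜ ^ k * ofℝ β ^ (2 ℕ.* k ℕ.∸ 1) * ofℝ α * ofℝ π * ∑ SB)
    ≈
    (B (+ 0) * ofℝ α ^ (2 ℕ.* k) * D A DA (2 ℕ.* k) (1<2* (<⇒≤ 1<k))
    + -1ᶜ ^ k * A (+ 0) * ofℝ β ^ (2 ℕ.* k) * D B DB (2 ℕ.* k) (1<2* (<⇒≤ 1<k))
    - ofℕ 2 * ∑[j₁+j₂≡ k ] (λ j₁ j₂ 1≤j₁ 1≤j₂ →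
    -1ᶜ ^ j₂ * ofℝ α ^ (2 ℕ.* j₁) * ofℝ β ^ (2 ℕ.* j₂)
    * D A DA (2 ℕ.* j₁) (1<2* 1≤j₁) * D B DB (2 ℕ.* j₂) (1<2* 1≤j₂)))
theorem5p1 A B A=o B=o (suc zero) (s≤s ())
theorem5p1 A B A=o B=o (suc (suc l)) 1<k α β α#0 β#0 =
  DA.converges , DB.converges , CB.cot-defined , CA.cot-defined , TA.terms-summable , TB.terms-summable ,
  -- `D` takes the proof of 1 < 2k as an argument, so `rhs⟶` is applied to the very proof that
  -- occurs in the statement.
  ⟶-unique lhs⟶ (rhs⟶ (1<2* (<⇒≤ 1<k)))
  where
  open Reciprocity A B (proj₂ (little-o⇒dominated {A} A=o)) (proj₂ (little-o⇒dominated {B} B=o)) α β α#0 β#0 l
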